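{- For non-negative integers $x$, $y$, $z$ and $k$ of the same parity, with $k\leq x,y,z$, \[ \operatorname{M}_{\odot}(B_{x,y,z,k})=P\left(\tfrac{y+k}{2},\tfrac{z-k}{2},k\right) \prod_{i=1}^{(y-k)/2}\frac{\left(\frac{x-k}{2}+i\right)_k}{(i)_k} \prod_{i=1}^{(z-k)/2}\frac{\left(\frac{x+k}{2}+i\right)_{(y-k)/2}}{(k+i)_{(y-k)/2}} \frac{\left(\frac{x+k}{2}+i\right)_{(y+k)/2}}{(k+i)_{(y+k)/2}}. \]
   Context: $P(x,y,z)=\prod_{i=1}^x\prod_{j=1}^y\prod_{k=1}^z \frac{i+j+k-1}{i+j+k-2}$ (MacMahon's count of lozenge tilings of the hexagon with sides $x,y,z,x,y,z$), and $(a)_k$ is the Pochhammer symbol (rising factorial). $B_{x,y,z,k}$ is the region obtained from the hexagon $H_{x,y,z}$ of side-lengths $x,y,z,x,y,z$ (in cyclic order) on the triangular lattice by removing from its center a bowtie with lobes of size $k$ (two equilateral triangles of side $k$ touching at the center), whose edges not touching the center are parallel to the sides of length $z$. $\operatorname{M}_{\odot}(R)$ denotes the number of centrally symmetric lozenge tilings of the region $R$ (equivalently, centrally symmetric perfect matchings of its planar dual). -}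

module Defs where

open import Data.Bool using (Bool; true; false; _∧_; not; if_then_else_)
open import Data.Nat as ℕ using (ℕ; zero; suc; ⌊_/2⌋)
open import Data.Integer as ℤ using (ℤ; +_; -_; _≤ᵇ_)
open import Data.Fin using (Fin; zero; suc)
open import Data.Product using (_×_; _,_; proj₁; proj₂)
open import Data.List using (List; []; _∷_; map; concatMap; length; zip)
open import Data.Maybe using (Maybe; just; nothing)
open import Data.Rational as ℚ using (ℚ; 0ℚ; 1ℚ; _/_)
open import Relation.Nullary using (does)

filterB : {A : Set} → (A → Bool) → List A → List A
filterB p []       = []
filterB p (a ∷ as) = if p a then a ∷ filterB p as else filterB p as

allB anyB : {A : Set} → (A → Bool) → List A → Bool
allB p []       = true
allB p (a ∷ as) = p a ∧ allB p as
anyB p []       = false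
anyB p (a ∷ as) = p a Data.Bool.∨ anyB p as

∏ : ℕ → (ℕ → ℚ) → ℚ
∏ zero    f = 1ℚ
∏ (suc n) f = ∏ n f ℚ.* f (suc n)

-- the rational a / b for natural numbers (only ever used with b > 0;
-- the value for b = 0 is an irrelevant convention)
ratio : ℕ → ℕ → ℚ
ratio a zero    = 0ℚ
ratio a (suc b) = (+ a) / suc b

poch : ℕ → ℕ → ℕ
poch a zero    = 1
poch a (suc k) = poch a k ℕ.* (a ℕ.+ k)

P : ℕ → ℕ → ℕ → ℚ
P x y z = ∏ x λ i → ∏ y λ j → ∏ z λ k →
  ratio (i ℕ.+ j ℕ.+ k ℕ.∸ 1) (i ℕ.+ j ℕ.+ k ℕ.∸ 2)

-- Triangular lattice.
-- Lattice points are (u , v) ∈ ℤ², standing for u·e₁ + v·e₂ with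
-- e₁ = (1,0), e₂ = (1/2, √3/2).
-- The "up" unit triangle labelled (u , v) has vertices
--   (u,v), (u+1,v), (u,v+1);
-- the "down" unit triangle labelled (u , v) has vertices
--   (u+1,v), (u,v+1), (u+1,v+1).

Cell : Set
Cell = ℤ × ℤ

_==_ : Cell → Cell → Bool
(a , b) == (c , d) = does (a ℤ.≟ c) ∧ does (b ℤ.≟ d)

-- The three down triangles sharing an edge with the up triangle (u,v):
-- direction 0: down (u,v)   (common edge (u+1,v)–(u,v+1))
-- direction 1: down (u-1,v) (common edge (u,v)–(u,v+1))
-- direction 2: down (u,v-1) (common edge (u,v)–(u+1,v))
-- A lozenge is an up triangle together with one of these neighbours.
partner : Cell → Fin 3 → Cell
partner (u , v) zero          = (u , v)
partner (u , v) (suc zero)    = (u ℤ.- + 1 , v)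
partner (u , v) (suc (suc _)) = (u , v ℤ.- + 1)

-- The hexagon H_{x,y,z}: boundary from (0,0) goes x steps along e₁,
-- y along e₂, z along e₂-e₁, x along -e₁, y along -e₂, z along e₁-e₂.
-- As a closed set: 0 ≤ v ≤ y+z, -z ≤ u ≤ x, 0 ≤ u+v ≤ x+y.
-- A unit triangle lies in it iff its three vertices do.

module Region (x y z k : ℕ) where

  X Y Z K : ℤ
  X = + x
  Y = + y
  Z = + z
  K = + k

  inHexUp : Cell → Bool
  inHexUp (u , v) =
    (+ 0 ≤ᵇ v) ∧ (v ℤ.+ + 1 ≤ᵇ Y ℤ.+ Z) ∧ (- Z ≤ᵇ u) ∧ (u ℤ.+ + 1 ≤ᵇ X)
    ∧ (+ 0 ≤ᵇ u ℤ.+ v) ∧ (u ℤ.+ v ℤ.+ + 1 ≤ᵇ X ℤ.+ Y)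

  inHexDown : Cell → Bool
  inHexDown (u , v) =
    (+ 0 ≤ᵇ v) ∧ (v ℤ.+ + 1 ≤ᵇ Y ℤ.+ Z) ∧ (- Z ≤ᵇ u) ∧ (u ℤ.+ + 1 ≤ᵇ X)
    ∧ (+ 0 ≤ᵇ u ℤ.+ v ℤ.+ + 1) ∧ (u ℤ.+ v ℤ.+ + 2 ≤ᵇ X ℤ.+ Y)

  -- Centre of the hexagon: midpoint of (0,0) and (x-z, y+z), i.e.
  -- ((x-z)/2, (y+z)/2); a lattice point when x ≡ z and y ≡ z (mod 2).
  cu cv : ℤ
  cu = + ⌊ x ℕ.+ z /2⌋ ℤ.- Z
  cv = + ⌊ y ℕ.+ z /2⌋

  -- The bowtie: two equilateral triangles of side k meeting at the centre c,
  --   lobe 1 = conv(c, c + k e₁, c + k e₂)   = {du ≥ 0, dv ≥ 0, du+dv ≤ k}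
  --   lobe 2 = conv(c, c - k e₁, c - k e₂)   = {du ≤ 0, dv ≤ 0, du+dv ≥ -k}
  -- (du = u - cu, dv = v - cv).  Their edges not touching c are parallel
  -- to e₂ - e₁, the direction of the sides of length z.
  inBowtieUp : Cell → Bool
  inBowtieUp (u , v) =
    let du = u ℤ.- cu ; dv = v ℤ.- cv in
    ((+ 0 ≤ᵇ du) ∧ (+ 0 ≤ᵇ dv) ∧ (du ℤ.+ dv ℤ.+ + 1 ≤ᵇ K))
    Data.Bool.∨ ((du ℤ.+ + 1 ≤ᵇ + 0) ∧ (dv ℤ.+ + 1 ≤ᵇ + 0) ∧ (- K ≤ᵇ du ℤ.+ dv))

  inBowtieDown : Cell → Bool
  inBowtieDown (u , v) =
    let du = u ℤ.- cu ; dv = v ℤ.- cv in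
    ((+ 0 ≤ᵇ du) ∧ (+ 0 ≤ᵇ dv) ∧ (du ℤ.+ dv ℤ.+ + 2 ≤ᵇ K))
    Data.Bool.∨ ((du ℤ.+ + 1 ≤ᵇ + 0) ∧ (dv ℤ.+ + 1 ≤ᵇ + 0) ∧ (- K ≤ᵇ du ℤ.+ dv ℤ.+ + 1))

  inRegionUp inRegionDown : Cell → Bool
  inRegionUp c   = inHexUp c ∧ not (inBowtieUp c)
  inRegionDown c = inHexDown c ∧ not (inBowtieDown c)

  -- Rotation by 180° about the centre: p ↦ 2c - p.  It sends the up
  -- triangle (u,v) to the down triangle (2cu-u-1, 2cv-v-1) and the down
  -- triangle (u,v) to the up triangle (2cu-u-1, 2cv-v-1).
  rot : Cell → Cell
  rot (u , v) = (cu ℤ.+ cu ℤ.- u ℤ.- + 1 , cv ℤ.+ cv ℤ.- v ℤ.- + 1)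

  range : ℤ → ℕ → List ℤ
  range a zero    = []
  range a (suc n) = a ∷ range (a ℤ.+ + 1) n

  box : List Cell
  box = concatMap (λ u → map (λ v → (u , v)) (range (+ 0) (y ℕ.+ z)))
                  (range (- Z) (x ℕ.+ z))

  upCells downCells : List Cell
  upCells   = filterB inRegionUp box
  downCells = filterB inRegionDown box

  -- A lozenge tiling of the region = a perfect matching of its dual graph:
  -- each up triangle of the region is paired with an adjacent down
  -- triangle of the region, every down triangle of the region being used
  -- exactly once.  It is encoded by the list of directions chosen for the
  -- up triangles (in the fixed order of upCells); this encoding is a
  -- bijection between matchings and valid direction lists.
  assignments : ℕ → List (List (Fin 3))
  assignments zero    = [] ∷ []
  assignments (suc n) =
    concatMap (λ a → map (_∷ a) (zero ∷ suc zero ∷ suc (suc zero) ∷ []))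
              (assignments n)

  count : {A : Set} → (A → Bool) → List A → ℕ
  count p xs = length (filterB p xs)

  pairs : List (Fin 3) → List (Cell × Cell)
  pairs a = map (λ { (c , d) → (c , partner c d) }) (zip upCells a)

  isTiling : List (Fin 3) → Bool
  isTiling a =
    allB (λ p → inRegionDown (proj₂ p)) (pairs a)
    ∧ allB (λ d → does (count (λ p → proj₂ p == d) (pairs a) ℕ.≟ 1)) downCells

  -- the tiling is invariant under the 180° rotation about the centre:
  -- the image {rot(down), rot(up)} of each lozenge {up, down} is a lozenge
  -- of the tiling, i.e. the up triangle rot(down) is matched with rot(up).
  isSymmetric : List (Fin 3) → Bool
  isSymmetric a =
    allB (λ p → anyB (λ q → (proj₁ q == rot (proj₂ p)) ∧ (proj₂ q == rot (proj₁ p)))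
                             (pairs a))
        (pairs a)

  csTilings : ℕ
  csTilings = count (λ a → isTiling a ∧ isSymmetric a)
                    (assignments (length upCells))

M⊙B : ℕ → ℕ → ℕ → ℕ → ℕ
M⊙B x y z k = Region.csTilings x y z k

rhs : ℕ → ℕ → ℕ → ℕ → ℚ
rhs x y z k =
  P ⌊ y ℕ.+ k /2⌋ ⌊ z ℕ.∸ k /2⌋ k
  ℚ.* ∏ ⌊ y ℕ.∸ k /2⌋ (λ i →
        ratio (poch (⌊ x ℕ.∸ k /2⌋ ℕ.+ i) k) (poch i k))
  ℚ.* ∏ ⌊ z ℕ.∸ k /2⌋ (λ i →
        ratio (poch (⌊ x ℕ.+ k /2⌋ ℕ.+ i) ⌊ y ℕ.∸ k /2⌋) (poch (k ℕ.+ i) ⌊ y ℕ.∸ k /2⌋)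
        ℚ.* ratio (poch (⌊ x ℕ.+ k /2⌋ ℕ.+ i) ⌊ y ℕ.+ k /2⌋) (poch (k ℕ.+ i) ⌊ y ℕ.+ k /2⌋))

{-# OPTIONS --safe #-}
module Submission where

-- Rotation identifies the down triangles with the up triangles, so a centrally symmetric tiling is a colouring of the
-- up triangles by directions that is compatible with three involutions. In the upper half of the hexagon the lozenges
-- of directions 0 and 1 form x nonintersecting walks of n = (y + z)/2 steps, from the horizontal through the centre up
-- to the top side, and they determine the tiling. The starting positions are symmetric about the centre, except for the
-- bowtie: they are r₁ > … > r_a ≥ k, the k positions above the left lobe, and the mirror images -1 - rᵢ. With A = (x + z)/2 and B = (x + y)/2, the
-- number of walks from a set T of positions t is a constant times ∏ (tᵢ - tⱼ) ∏ 1/((A + t)! (B - 1 - t)!), and for the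
-- symmetric T this leaves the discrete Selberg sum
--   ∑ ∏_{i<j} (Xᵢ - Xⱼ)² ∏ᵢ (2rᵢ + 1) (rᵢ + k)! / ((rᵢ - k)! (A + rᵢ)! (A - 1 - rᵢ)! (B + rᵢ)! (B - 1 - rᵢ)!),  Xᵢ = rᵢ(rᵢ + 1).
-- One of the two Vandermonde factors is absorbed in the function with parameter A, the other one in that with B.
-- A nearest-neighbour operator that raises A by 1/2 is adjoint to one that raises B by 1/2, and both map these
-- functions to multiples of each other; this moves (A , B) to (A + 1 , B - 1), i.e. (y , z) to (y - 2 , z + 2). For y = k
-- a single term survives. The product in the theorem is P(a+k, b+k, c) P(a, b, c+k) for x = k+2a, y = k+2b, z = k+2c,
-- and both sides are compared in terms of superfactorials.

open import Defs
import Data.Bool as Bool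
open import Data.Bool using (Bool; true; false; _∧_; _∨_; not; if_then_else_)
open import Data.Bool.Properties using (∧-comm; ∧-assoc; ∨-comm)
open import Data.Empty using (⊥; ⊥-elim)
import Data.Fin.Properties as Fin
import Data.Integer as ℤ
open import Data.Integer using (ℤ; +_; -[1+_]; +[1+_])
import Data.Integer.Properties as ℤₚ
open import Data.Integer.Properties
open import Data.Integer.Tactic.RingSolver using (solve-∀)
open import Data.List using (List; []; _∷_; length; _++_; [_]; map; concatMap; zip; filter)
open import Data.List.Membership.Propositional using (_∈_; _∉_)
open import Data.List.Membership.Propositional.Properties using (∈-++⁺ˡ; ∈-++⁺ʳ; ∈-++⁻; ∈-∃++; ∈-map⁺; ∈-map⁻; ∈-filter⁺; ∈-filter⁻)
open import Data.List.Properties using (≡-dec; length-++; ++-assoc; length-map; map-∘; concatMap-map; concatMap-++; ∷-injective; ∷ʳ-injective)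
open import Data.List.Relation.Binary.Pointwise using (Pointwise; []; _∷_; Pointwise-length)
open import Data.List.Relation.Unary.All as All using (All; []; _∷_)
import Data.List.Relation.Unary.All.Properties as Allₚ
open import Data.List.Relation.Unary.AllPairs using ([]; _∷_)
open import Data.List.Relation.Unary.Any as Any using (Any; here; there)
open import Data.List.Relation.Unary.Linked using (Linked; []; [-]; _∷_; linked?)
import Data.List.Relation.Unary.Linked.Properties as Linkedₚ
open import Data.List.Relation.Unary.Unique.Propositional using (Unique)
open import Data.List.Relation.Unary.Unique.Propositional.Properties using (++⁺)
import Data.Nat as ℕ
open import Data.Nat using (ℕ; zero; suc; _!; ⌊_/2⌋)
open import Data.Nat.DivMod using ([m+kn]%n≡m%n)
import Data.Nat.Properties as ℕₚ
import Data.Nat.Tactic.RingSolver as ℕ-Solver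
open import Data.Product using (_×_; _,_; proj₁; proj₂; ∃)
open import Data.Product.Properties using (,-injective)
import Data.Rational as ℚ
open import Data.Rational using (ℚ; 1ℚ; toℚᵘ)
import Data.Rational.Properties as ℚₚ
open import Data.Rational.Unnormalised using (mkℚᵘ; *≡*)
import Data.Rational.Unnormalised.Properties as ℚᵘₚ
open import Data.Sum using (_⊎_; inj₁; inj₂)
open import Data.Unit using (tt)
open import Function using (_∘_; id; case_of_)
open import Relation.Binary.PropositionalEquality hiding ([_])
open import Relation.Nullary using (¬_; Dec; yes; no; does)
open import Relation.Nullary.Decidable using (dec-true; _×-dec_; _→-dec_; ¬?)
open ≡-Reasoning

-- Everything stays in ℤ: identities between quotients are multiplied out by explicit nonzero
-- integers, which are cancelled later, and determinants occur only as signed expansions of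
-- Vandermonde products. Such a product has the same expansion for every choice of Newton nodes, so
-- each operator is given nodes that make it diagonal. The two half steps join different lattices: r
-- stands for the half-integer r + 1/2, while the intermediate sum runs over integers s. That sum is
-- symmetric in its two parameters, so reaching it from either side gives the exchange. The boundary
-- terms of the adjointness vanish at s = 0 because the polynomial carried by s is odd, and at the
-- far end because the binomial weight has run out. On the axis, a lozenge of direction 2 pairs the
-- segment at p with the one at -1 - p. Over the left lobe this partner would belong to the removed
-- right lobe, which is why these k segments are always starting positions. For y = k the weights
-- leave only k ≤ r < k + a, that is, a places for a entries. A second induction, on c, compares
-- this term with the case z = k, where the walk is forced.

-- Vandermonde products, their expansions along a column, and step operators

module Alternants where
  open import Data.Integer using (_+_; _-_; _*_; -_; _^_; _<_; _≤_)

  x≡-x⇒x≡0 : ∀ x → x ≡ - x → x ≡ + 0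
  x≡-x⇒x≡0 (+ zero) _ = refl
  x≡-x⇒x≡0 +[1+ n ] ()
  x≡-x⇒x≡0 -[1+ n ] ()

  ∏< : ℕ → (ℕ → ℤ) → ℤ
  ∏< zero f = + 1
  ∏< (suc n) f = ∏< n f * f n

  -- The Laplace expansion ∑ᵢ (-1)ⁱ f tᵢ · G (t₀ ∷ … without tᵢ) of a determinant along a column.
  expand : ∀ {A : Set} → (A → ℤ) → (List A → ℤ) → List A → ℤ
  expand f G [] = + 0
  expand f G (t ∷ ts) = f t * G ts - expand f (λ us → G (t ∷ us)) ts

  module _ {A : Set} where

    expand-cong : ∀ {f f′ : A → ℤ} {G G′ : List A → ℤ} ts → (∀ t → f t ≡ f′ t) →
      (∀ us → suc (length us) ≡ length ts → G us ≡ G′ us) → expand f G ts ≡ expand f′ G′ ts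
    expand-cong [] _ _ = refl
    expand-cong (t ∷ ts) ef eG =
      cong₂ _-_ (cong₂ _*_ (ef t) (eG ts refl)) (expand-cong ts ef λ us e → eG (t ∷ us) (cong suc e))

    expand-linearʳ : ∀ (f : A → ℤ) (c : ℤ) (G G′ : List A → ℤ) ts →
      expand f (λ us → c * G us + G′ us) ts ≡ c * expand f G ts + expand f G′ ts
    expand-linearʳ f c G G′ [] = solve₀ c
      where solve₀ : ∀ c → + 0 ≡ c * + 0 + + 0
            solve₀ = solve-∀
    expand-linearʳ f c G G′ (t ∷ ts) =
      trans (cong₂ _-_ (refl {x = f t * (c * G ts + G′ ts)}) (expand-linearʳ f c _ _ ts))
            (solve₁ (f t) c (G ts) (G′ ts) _ _)
      where solve₁ : ∀ f c g g′ e e′ → f * (c * g + g′) - (c * e + e′) ≡ c * (f * g - e) + (f * g′ - e′)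
            solve₁ = solve-∀

    expand-linearˡ : ∀ (f f′ : A → ℤ) (c : ℤ) (G : List A → ℤ) ts →
      expand (λ t → c * f t + f′ t) G ts ≡ c * expand f G ts + expand f′ G ts
    expand-linearˡ f f′ c G [] = solve₀ c
      where solve₀ : ∀ c → + 0 ≡ c * + 0 + + 0
            solve₀ = solve-∀
    expand-linearˡ f f′ c G (t ∷ ts) =
      trans (cong₂ _-_ (refl {x = (c * f t + f′ t) * G ts}) (expand-linearˡ f f′ c _ ts))
            (solve₁ (f t) (f′ t) c (G ts) _ _)
      where solve₁ : ∀ f f′ c g e e′ → (c * f + f′) * g - (c * e + e′) ≡ c * (f * g - e) + (f′ * g - e′)
            solve₁ = solve-∀

    expand-zero : ∀ (f : A → ℤ) {G : List A → ℤ} ts →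
      (∀ us → suc (length us) ≡ length ts → G us ≡ + 0) → expand f G ts ≡ + 0
    expand-zero f [] _ = refl
    expand-zero f (t ∷ ts) e
      rewrite e ts refl | expand-zero f ts (λ us q → e (t ∷ us) (cong suc q)) | *-zeroʳ (f t) = refl

    expand-scale : ∀ (f : A → ℤ) (c d : ℤ) (G : List A → ℤ) ts →
      expand (λ t → c * f t) (λ us → d * G us) ts ≡ c * d * expand f G ts
    expand-scale f c d G [] = sym (*-zeroʳ (c * d))
    expand-scale f c d G (t ∷ ts) =
      trans (cong₂ _-_ (refl {x = c * f t * (d * G ts)}) (expand-scale f c d _ ts)) (solve₁ c d (f t) (G ts) _)
      where solve₁ : ∀ c d f g e → c * f * (d * g) - c * d * e ≡ c * d * (f * g - e)
            solve₁ = solve-∀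

    -- This antisymmetry stands in for a theory of determinants: an expansion along the same column
    -- twice equals its own negative. In the induction, `inner` takes the head out of the inner
    -- expansion, and the two resulting terms occur on the two sides with opposite signs.
    expand-swap : ∀ (f g : A → ℤ) (H : List A → ℤ) ts →
      expand f (expand g H) ts ≡ - expand g (expand f H) ts
    expand-swap f g H [] = refl
    expand-swap f g H (t ∷ ts) =
      begin
        f t * expand g H ts - expand f (λ us → expand g H (t ∷ us)) ts
      ≡⟨ cong₂ _-_ (refl {x = f t * expand g H ts}) (inner f g) ⟩
        f t * expand g H ts - (g t * expand f H ts - expand f (expand g Hₜ) ts)
      ≡⟨ cong (λ e → f t * expand g H ts - (g t * expand f H ts - e)) (expand-swap f g Hₜ ts) ⟩
        f t * expand g H ts - (g t * expand f H ts - - expand g (expand f Hₜ) ts)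
      ≡⟨ rearrange (f t * expand g H ts) (g t * expand f H ts) _ ⟩
        - (g t * expand f H ts - (f t * expand g H ts - expand g (expand f Hₜ) ts))
      ≡⟨ cong (λ e → - (g t * expand f H ts - e)) (sym (inner g f)) ⟩
        - (g t * expand f H ts - expand g (λ us → expand f H (t ∷ us)) ts)
      ∎
      where
      Hₜ : List A → ℤ
      Hₜ us = H (t ∷ us)
      rearrange : ∀ x y z → x - (y - - z) ≡ - (y - (x - z))
      rearrange = solve-∀
      split : ∀ x y → x - y ≡ x + - y
      split = solve-∀
      neg : ∀ x → - x ≡ - + 1 * x + + 0
      neg = solve-∀
      fin : ∀ g e e′ → g * e + (- + 1 * e′ + + 0) ≡ g * e - e′
      fin = solve-∀
      inner : ∀ f g → expand f (λ us → expand g H (t ∷ us)) ts ≡ g t * expand f H ts - expand f (expand g Hₜ) ts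
      inner f g =
        trans (expand-linearʳ f (g t) H (λ us → - expand g Hₜ us) ts)
       (trans (cong₂ _+_ (refl {x = g t * expand f H ts})
                (trans (expand-cong ts (λ _ → refl) (λ us _ → neg (expand g Hₜ us)))
                (trans (expand-linearʳ f (- + 1) (expand g Hₜ) (λ _ → + 0) ts)
                       (cong₂ _+_ (refl {x = - + 1 * expand f (expand g Hₜ) ts}) (expand-zero f ts λ _ _ → refl)))))
              (fin (g t) _ _))

  newton : (ℕ → ℤ) → ℕ → ℤ → ℤ
  newton a j x = ∏< j (λ i → x - a i)

  module _ {A : Set} (X : A → ℤ) (h : A → ℤ) where

    diffs : ℤ → List A → ℤ
    diffs c [] = + 1
    diffs c (t ∷ ts) = (c - X t) * diffs c ts

    -- The weighted Vandermonde product ∏_{i<j} (X tᵢ - X tⱼ) ∏ h tᵢ. It is kept as a product; its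
    -- determinantal nature is used only through `expand-top` and `expand-low`.
    alt : List A → ℤ
    alt [] = + 1
    alt (t ∷ ts) = h t * diffs (X t) ts * alt ts

    -- Each term of the expansion lacks exactly one factor c - X t in `diffs c us`, and the column
    -- supplies that factor, so the full product comes out of the sum.
    expand-diffs : ∀ c f (G : List A → ℤ) ts →
      expand (λ t → (c - X t) * f t) (λ us → diffs c us * G us) ts ≡ diffs c ts * expand f G ts
    expand-diffs c f G [] = refl
    expand-diffs c f G (t ∷ ts) =
      trans (cong₂ _-_ (refl {x = (c - X t) * f t * (diffs c ts * G ts)})
              (trans (expand-cong ts (λ _ → refl) (λ us _ → r₁ (c - X t) (diffs c us) (G (t ∷ us))))
              (trans (expand-linearʳ _ (c - X t) (λ us → diffs c us * G (t ∷ us)) (λ _ → + 0) ts)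
                     (cong₂ (λ e e′ → (c - X t) * e + e′) (expand-diffs c f _ ts) (expand-zero _ ts λ _ _ → refl)))))
            (r₂ (c - X t) (f t) (diffs c ts) (G ts) _)
      where
      r₁ : ∀ x d g → x * d * g ≡ x * (d * g) + + 0
      r₁ = solve-∀
      r₂ : ∀ x f d g e → x * f * (d * g) - (x * (d * e) + + 0) ≡ x * d * (f * g - e)
      r₂ = solve-∀

    module _ (a : ℕ → ℤ) where

      column : ℕ → A → ℤ
      column j t = newton a j (X t) * h t

      -- With t the head, X s - a j = (X t - a j) - (X t - X s). The second part vanishes at s = t,
      -- and on the remaining entries it completes the factors that `alt` has for the head, so
      -- `expand-diffs` applies.
      expand-column-suc : ∀ j t ts → expand (column (suc j)) alt (t ∷ ts) ≡
        h t * diffs (X t) ts * expand (column j) alt ts + (X t - a j) * expand (column j) alt (t ∷ ts)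
      expand-column-suc j t ts =
        begin
          expand (column (suc j)) alt (t ∷ ts)
        ≡⟨ expand-cong {f′ = λ s → (X t - a j) * column j s + - + 1 * ((X t - X s) * column j s)} {G′ = alt}
             (t ∷ ts) (λ s → r₁ (newton a j (X s)) (X s) (a j) (h s) (X t)) (λ _ _ → refl) ⟩
          expand (λ s → (X t - a j) * column j s + - + 1 * ((X t - X s) * column j s)) alt (t ∷ ts)
        ≡⟨ expand-linearˡ (column j) (λ s → - + 1 * ((X t - X s) * column j s)) (X t - a j) alt (t ∷ ts) ⟩
          (X t - a j) * expand (column j) alt (t ∷ ts) + expand (λ s → - + 1 * ((X t - X s) * column j s)) alt (t ∷ ts)
        ≡⟨ cong₂ (λ p q → (X t - a j) * expand (column j) alt (t ∷ ts) + (- + 1 * (p * column j t) * alt ts - q))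
             (+-inverseʳ (X t))
             (trans (expand-cong ts (λ _ → refl) (λ us _ → *-assoc (h t) (diffs (X t) us) (alt us)))
             (trans (expand-scale (λ s → (X t - X s) * column j s) (- + 1) (h t) (λ us → diffs (X t) us * alt us) ts)
                    (cong (- + 1 * h t *_) (expand-diffs (X t) (column j) alt ts)))) ⟩
          (X t - a j) * expand (column j) alt (t ∷ ts) +
            (- + 1 * (+ 0 * column j t) * alt ts - - + 1 * h t * (diffs (X t) ts * expand (column j) alt ts))
        ≡⟨ r₂ ((X t - a j) * expand (column j) alt (t ∷ ts)) (column j t) (alt ts) (h t) (diffs (X t) ts) _ ⟩
          h t * diffs (X t) ts * expand (column j) alt ts + (X t - a j) * expand (column j) alt (t ∷ ts)
        ∎
        where
        r₁ : ∀ n x a h y → n * (x - a) * h ≡ (y - a) * (n * h) + - + 1 * ((y - x) * (n * h))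
        r₁ = solve-∀
        r₂ : ∀ e c l h d e′ → e + (- + 1 * (+ 0 * c) * l - - + 1 * h * (d * e′)) ≡ h * d * e′ + e
        r₂ = solve-∀

      private
        -- A constant column occurs twice when n = 1; the swap of the two copies gives x ≡ - x.
        expand-const : ∀ n → (∀ j us → length us ≡ n → n ≡ suc j → expand (column j) alt us ≡ alt us) →
          (∀ us → length us ≡ n → 1 ℕ.< n → expand (column 0) alt us ≡ + 0) →
          ∀ ts → length ts ≡ suc n → 1 ℕ.< suc n → expand (column 0) alt ts ≡ + 0
        expand-const (suc zero) top low ts len _ =
          x≡-x⇒x≡0 _ (trans step (trans (expand-swap _ _ alt ts) (cong -_ (sym step))))
          where
          step : expand (column 0) alt ts ≡ expand (column 0) (expand (column 0) alt) ts
          step = expand-cong ts (λ _ → refl) λ us e → sym (top 0 us (ℕₚ.suc-injective (trans e len)) refl)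
        expand-const (suc (suc m)) top low ts len _ =
          begin
            expand (column 0) alt ts
          ≡⟨ expand-cong ts (λ _ → refl) (λ us e → sym (top (suc m) us (ℕₚ.suc-injective (trans e len)) refl)) ⟩
            expand (column 0) (expand (column (suc m)) alt) ts
          ≡⟨ expand-swap _ _ alt ts ⟩
            - expand (column (suc m)) (expand (column 0) alt) ts
          ≡⟨ cong -_ (expand-zero _ ts λ us e →
               low us (ℕₚ.suc-injective (trans e len)) (ℕ.s≤s (ℕ.s≤s ℕ.z≤n))) ⟩
            + 0
          ∎
        expand-const zero _ _ _ _ (ℕ.s≤s ())

      mutual
        -- A column of degree below n - 1 is dependent on columns already present in the Vandermonde
        -- determinant. Without determinants: `expand-column-suc` reduces column j + 1 to column j
        -- on the same list and on its tail, and both are still of too low degree; `expand-const`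
        -- starts the induction.
        expand-low : ∀ n j ts → length ts ≡ n → suc j ℕ.< n → expand (column j) alt ts ≡ + 0
        expand-low (suc n) zero ts = expand-const n (expand-top n) (expand-low n zero) ts
        expand-low (suc n) (suc j) (t ∷ ts) len (ℕ.s≤s j<n) =
          trans (expand-column-suc j t ts)
            (trans (cong₂ (λ p q → h t * diffs (X t) ts * p + (X t - a j) * q)
                     (expand-low n j ts (ℕₚ.suc-injective len) j<n)
                     (expand-low (suc n) j (t ∷ ts) len (ℕ.s≤s (ℕₚ.<⇒≤ j<n))))
                   (r (h t * diffs (X t) ts) (X t - a j)))
          where
          r : ∀ x y → x * + 0 + y * + 0 ≡ + 0
          r = solve-∀

        -- After lowering the degree by one, the column is again the top one on the tail but too low
        -- on the whole list. Only the tail term survives, and it is the recursive formula for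
        -- `alt`.
        expand-top : ∀ n j ts → length ts ≡ n → n ≡ suc j → expand (column j) alt ts ≡ alt ts
        expand-top _ zero (t ∷ []) _ _ = r (h t)
          where
          r : ∀ x → + 1 * x * + 1 - + 0 ≡ x * + 1 * + 1
          r = solve-∀
        expand-top _ zero (_ ∷ _ ∷ _) refl ()
        expand-top _ zero [] refl ()
        expand-top (suc n) (suc j) (t ∷ ts) len e =
          trans (expand-column-suc j t ts)
            (trans (cong₂ (λ p q → h t * diffs (X t) ts * p + (X t - a j) * q)
                     (expand-top n j ts (ℕₚ.suc-injective len) (ℕₚ.suc-injective e))
                     (expand-low (suc n) j (t ∷ ts) len (ℕₚ.≤-reflexive (sym e))))
                   (r (h t * diffs (X t) ts * alt ts) (X t - a j)))
          where
          r : ∀ x y → x + y * + 0 ≡ x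
          r = solve-∀

  steps : ∀ {A : Set} → (A → A) → (List A → ℤ) → List A → ℤ
  steps δ G [] = G []
  steps δ G (t ∷ ts) = steps δ (λ us → G (t ∷ us)) ts + steps δ (λ us → G (δ t ∷ us)) ts

  module _ {A : Set} (δ : A → A) where

    steps-cong : ∀ {G G′ : List A → ℤ} ts → (∀ us → length us ≡ length ts → G us ≡ G′ us) →
      steps δ G ts ≡ steps δ G′ ts
    steps-cong [] e = e [] refl
    steps-cong (t ∷ ts) e =
      cong₂ _+_ (steps-cong ts λ us q → e (t ∷ us) (cong suc q)) (steps-cong ts λ us q → e (δ t ∷ us) (cong suc q))

    steps-linear : ∀ c (G G′ : List A → ℤ) ts →
      steps δ (λ us → c * G us - G′ us) ts ≡ c * steps δ G ts - steps δ G′ ts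
    steps-linear c G G′ [] = refl
    steps-linear c G G′ (t ∷ ts) =
      trans (cong₂ _+_ (steps-linear c _ _ ts) (steps-linear c _ _ ts)) (r c _ _ _ _)
      where
      r : ∀ c x x′ y y′ → (c * x - x′) + (c * y - y′) ≡ c * (x + y) - (x′ + y′)
      r = solve-∀

    -- Multilinearity: the entries step independently, so the step operator acts on the expanded
    -- column and on the remaining function separately.
    steps-expand : ∀ (f : A → ℤ) (G : List A → ℤ) ts →
      steps δ (expand f G) ts ≡ expand (λ t → f t + f (δ t)) (steps δ G) ts
    steps-expand f G [] = refl
    steps-expand f G (t ∷ ts) =
      begin
        steps δ (λ us → f t * G us - expand f (Gₜ t) us) ts + steps δ (λ us → f (δ t) * G us - expand f (Gₜ (δ t)) us) ts
      ≡⟨ cong₂ _+_ (half t) (half (δ t)) ⟩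
        (f t * steps δ G ts - expand f₂ (steps δ (Gₜ t)) ts) + (f (δ t) * steps δ G ts - expand f₂ (steps δ (Gₜ (δ t))) ts)
      ≡⟨ r (f t) (f (δ t)) (steps δ G ts) _ _ ⟩
        (f t + f (δ t)) * steps δ G ts - (+ 1 * expand f₂ (steps δ (Gₜ t)) ts + expand f₂ (steps δ (Gₜ (δ t))) ts)
      ≡⟨ cong₂ _-_ (refl {x = (f t + f (δ t)) * steps δ G ts})
           (trans (sym (expand-linearʳ f₂ (+ 1) (steps δ (Gₜ t)) (steps δ (Gₜ (δ t))) ts))
                  (expand-cong ts (λ _ → refl) (λ us _ → cong (_+ steps δ (Gₜ (δ t)) us) (*-identityˡ (steps δ (Gₜ t) us))))) ⟩
        (f t + f (δ t)) * steps δ G ts - expand f₂ (λ us → steps δ G (t ∷ us)) ts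
      ∎
      where
      f₂ : A → ℤ
      f₂ s = f s + f (δ s)
      Gₜ : A → List A → ℤ
      Gₜ s us = G (s ∷ us)
      half : ∀ s → steps δ (λ us → f s * G us - expand f (Gₜ s) us) ts ≡ f s * steps δ G ts - expand f₂ (steps δ (Gₜ s)) ts
      half s = trans (steps-linear (f s) G (expand f (Gₜ s)) ts)
                     (cong₂ _-_ (refl {x = f s * steps δ G ts}) (steps-expand f (Gₜ s) ts))
      r : ∀ f f′ s e e′ → (f * s - e) + (f′ * s - e′) ≡ (f + f′) * s - (+ 1 * e + e′)
      r = solve-∀

  -- alt is the determinant with columns newton a j (X t) * h t for every choice of nodes a. Nodes a, a′ for which the
  -- one-variable operator is diagonal therefore turn the sum over all steps into a product of eigenvalues.
  module _ {A : Set} (δ : A → A) {X X′ h h′ : A → ℤ} {a a′ : ℕ → ℤ} (μ : ℤ) (c : ℕ → ℤ)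
    (eigen : ∀ j t → μ * (column X h a j t + column X h a j (δ t)) ≡ c j * column X′ h′ a′ j t) where

    steps-alt : ∀ n ts → length ts ≡ n → μ ^ n * steps δ (alt X h) ts ≡ ∏< n c * alt X′ h′ ts
    steps-alt zero [] _ = refl
    steps-alt (suc n) ts len =
      begin
        μ ^ suc n * steps δ (alt X h) ts
      ≡⟨ cong (μ ^ suc n *_) (trans (steps-cong δ ts λ us e → sym (expand-top X h a (suc n) n us (trans e len) refl))
                                     (steps-expand δ (column X h a n) (alt X h) ts)) ⟩
        μ ^ suc n * expand (λ t → column X h a n t + column X h a n (δ t)) (steps δ (alt X h)) ts
      ≡⟨ sym (expand-scale _ μ (μ ^ n) _ ts) ⟩
        expand (λ t → μ * (column X h a n t + column X h a n (δ t))) (λ us → μ ^ n * steps δ (alt X h) us) ts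
      ≡⟨ expand-cong ts (eigen n) (λ us e → steps-alt n us (ℕₚ.suc-injective (trans e len))) ⟩
        expand (λ t → c n * column X′ h′ a′ n t) (λ us → ∏< n c * alt X′ h′ us) ts
      ≡⟨ expand-scale _ (c n) (∏< n c) _ ts ⟩
        c n * ∏< n c * expand (column X′ h′ a′ n) (alt X′ h′) ts
      ≡⟨ cong₂ _*_ (*-comm (c n) _) (expand-top X′ h′ a′ (suc n) n ts len refl) ⟩
        ∏< n c * c n * alt X′ h′ ts
      ∎

-- Binomial weights and the operators that are diagonal on them

module Weights where
  open import Data.Integer using (_+_; _-_; _*_; -_; _^_; _<_; _≤_)
  open Alternants

  -- Pascal's recursion over all integers t, so that the value is 0 off 0 ≤ t ≤ l. Positions that a
  -- walk cannot use thereby acquire weight zero instead of side conditions.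
  bin : ℕ → ℤ → ℤ
  bin zero (+ zero) = + 1
  bin zero _ = + 0
  bin (suc l) t = bin l t + bin l (t - + 1)

  private
    bin-zero-* : ∀ t → t * bin 0 t ≡ + 0
    bin-zero-* (+ zero) = refl
    bin-zero-* +[1+ n ] = *-zeroʳ +[1+ n ]
    bin-zero-* -[1+ n ] = *-zeroʳ -[1+ n ]

    +suc : ∀ n → + suc n ≡ + n + + 1
    +suc n = cong +_ (ℕₚ.+-comm 1 n)

  bin-absorb : ∀ l t → t * bin (suc l) t ≡ + suc l * bin l (t - + 1)
  bin-absorb zero t =
    begin
      t * (bin 0 t + bin 0 (t - + 1))                            ≡⟨ r t (bin 0 t) (bin 0 (t - + 1)) ⟩
      t * bin 0 t + (t - + 1) * bin 0 (t - + 1) + bin 0 (t - + 1) ≡⟨ cong₂ (λ p q → p + q + bin 0 (t - + 1)) (bin-zero-* t) (bin-zero-* (t - + 1)) ⟩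
      + 0 + + 0 + bin 0 (t - + 1)                                ≡⟨ r′ (bin 0 (t - + 1)) ⟩
      + 1 * bin 0 (t - + 1)                                      ∎
    where
    r : ∀ t x y → t * (x + y) ≡ t * x + (t - + 1) * y + y
    r = solve-∀
    r′ : ∀ y → + 0 + + 0 + y ≡ + 1 * y
    r′ = solve-∀
  bin-absorb (suc l) t =
    begin
      t * (bin (suc l) t + bin (suc l) (t - + 1))
    ≡⟨ r t _ _ ⟩
      t * bin (suc l) t + (t - + 1) * bin (suc l) (t - + 1) + bin (suc l) (t - + 1)
    ≡⟨ cong₂ (λ p q → p + q + bin (suc l) (t - + 1)) (bin-absorb l t) (bin-absorb l (t - + 1)) ⟩
      + suc l * bin l (t - + 1) + + suc l * bin l (t - + 1 - + 1) + bin (suc l) (t - + 1)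
    ≡⟨ r′ (+ suc l) (bin l (t - + 1)) (bin l (t - + 1 - + 1)) ⟩
      (+ suc l + + 1) * bin (suc l) (t - + 1)
    ≡⟨ cong (_* bin (suc l) (t - + 1)) (sym (+suc (suc l))) ⟩
      + suc (suc l) * bin (suc l) (t - + 1)
    ∎
    where
    r : ∀ t x y → t * (x + y) ≡ t * x + (t - + 1) * y + y
    r = solve-∀
    r′ : ∀ n y z → n * y + n * z + (y + z) ≡ (n + + 1) * (y + z)
    r′ = solve-∀

  bin-absorb′ : ∀ l t → (+ suc l - t) * bin (suc l) t ≡ + suc l * bin l t
  bin-absorb′ l t =
    begin
      (+ suc l - t) * bin (suc l) t                            ≡⟨ r (+ suc l) t (bin l t) (bin l (t - + 1)) ⟩
      + suc l * bin l t + (+ suc l * bin l (t - + 1) - t * bin (suc l) t)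
        ≡⟨ cong (λ p → + suc l * bin l t + (+ suc l * bin l (t - + 1) - p)) (bin-absorb l t) ⟩
      + suc l * bin l t + (+ suc l * bin l (t - + 1) - + suc l * bin l (t - + 1)) ≡⟨ r′ (+ suc l * bin l t) (+ suc l * bin l (t - + 1)) ⟩
      + suc l * bin l t                                        ∎
    where
    r : ∀ s t x y → (s - t) * (x + y) ≡ s * x + (s * y - t * (x + y))
    r = solve-∀
    r′ : ∀ x y → x + (y - y) ≡ x
    r′ = solve-∀

  bin-neg : ∀ l n → bin l -[1+ n ] ≡ + 0
  bin-neg zero n = refl
  bin-neg (suc l) n = cong₂ _+_ (bin-neg l n) (bin-neg l _)

  bin-big : ∀ l n → l ℕ.< n → bin l (+ n) ≡ + 0
  bin-big zero (suc n) _ = refl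
  bin-big (suc l) (suc n) (ℕ.s≤s l<n) = cong₂ _+_ (bin-big l (suc n) (ℕₚ.m<n⇒m<1+n l<n)) (bin-big l n l<n)

  bin-pos : ∀ l n → n ℕ.≤ l → + 0 < bin l (+ n)
  bin-pos zero zero _ = ℤ.+<+ (ℕ.s≤s ℕ.z≤n)
  bin-pos (suc l) zero _ = subst (+ 0 <_) (sym (trans (cong₂ _+_ (refl {x = bin l (+ 0)}) (bin-neg l 0)) (+-identityʳ _))) (bin-pos l 0 ℕ.z≤n)
  bin-pos (suc l) (suc n) (ℕ.s≤s n≤l) = +-mono-≤-< (nonneg l (suc n)) (bin-pos l n n≤l)
    where
    nonneg : ∀ l n → + 0 ≤ bin l (+ n)
    nonneg zero zero = ℤ.+≤+ ℕ.z≤n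
    nonneg zero (suc n) = ℤ.+≤+ ℕ.z≤n
    nonneg (suc l) zero = +-mono-≤ (nonneg l zero) (≤-reflexive (sym (bin-neg l 0)))
    nonneg (suc l) (suc n) = +-mono-≤ (nonneg l (suc n)) (nonneg l n)

  pre suc′ : ℤ → ℤ
  pre t = t - + 1
  suc′ t = t + + 1

  module Row (l : ℕ) (A : ℤ) where

    private
      node : ℕ → ℤ
      node i = + i - A
      -- With these nodes `newton node j t` is the falling factorial (A + t)(A + t - 1)...(A + t - j
      -- + 1), and both sides are the falling factorial with j + 1 factors.
      shift : ∀ j t → (A + t) * newton node j (pre t) ≡ newton node j t * (A + t - + j)
      shift zero t = r (A + t)
        where
        r : ∀ x → x * + 1 ≡ + 1 * (x - + 0)
        r = solve-∀
      shift (suc j) t =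
        trans (sym (*-assoc (A + t) (newton node j (pre t)) _))
       (trans (cong (_* (pre t - (+ j - A))) (shift j t))
       (trans (r (newton node j t) A t (+ j)) (cong (λ s → newton node j t * (t - (+ j - A)) * (A + t - s)) (sym (+suc j)))))
        where
        r : ∀ n a t j → n * (a + t - j) * (t - + 1 - (j - a)) ≡ n * (t - (j - a)) * (a + t - (j + + 1))
        r = solve-∀

    weight weight⁺ : ℤ → ℤ
    weight t = bin l (A + t)
    weight⁺ t = bin (suc l) (A + t)

    -- Absorption multiplies the two binomials by l + 1 - (A + t) and A + t; after `shift` the
    -- latter becomes A + t - j. The sum l + 1 - j is free of t, so column j is an eigenvector.
    steps-row : ∀ n ts → length ts ≡ n → (+ suc l) ^ n * steps pre (alt (λ t → t) weight) ts ≡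
      ∏< n (λ j → + suc l - + j) * alt (λ t → t) weight⁺ ts
    steps-row = steps-alt pre {a = node} {a′ = node} (+ suc l) (λ j → + suc l - + j) eigen
      where
      r : ∀ s n w n′ w′ → s * (n * w + n′ * w′) ≡ n * (s * w) + n′ * (s * w′)
      r = solve-∀
      r′ : ∀ n s x w n′ → n * ((s - x) * w) + n′ * (x * w) ≡ n * ((s - x) * w) + (x * n′) * w
      r′ = solve-∀
      r″ : ∀ n s x w j → n * ((s - x) * w) + n * (x - j) * w ≡ (s - j) * (n * w)
      r″ = solve-∀
      eigen : ∀ j t → + suc l * (newton node j t * weight t + newton node j (pre t) * weight (pre t)) ≡
        (+ suc l - + j) * (newton node j t * weight⁺ t)
      eigen j t =
        begin
          + suc l * (newton node j t * weight t + newton node j (pre t) * weight (pre t))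
        ≡⟨ r (+ suc l) (newton node j t) (weight t) (newton node j (pre t)) (weight (pre t)) ⟩
          newton node j t * (+ suc l * weight t) + newton node j (pre t) * (+ suc l * weight (pre t))
        ≡⟨ cong₂ (λ p q → newton node j t * p + newton node j (pre t) * q) (sym (bin-absorb′ l (A + t)))
             (trans (cong (λ s → + suc l * bin l s) (sym (+-assoc A t (- + 1)))) (sym (bin-absorb l (A + t)))) ⟩
          newton node j t * ((+ suc l - (A + t)) * weight⁺ t) + newton node j (pre t) * ((A + t) * weight⁺ t)
        ≡⟨ r′ (newton node j t) (+ suc l) (A + t) (weight⁺ t) (newton node j (pre t)) ⟩
          newton node j t * ((+ suc l - (A + t)) * weight⁺ t) + (A + t) * newton node j (pre t) * weight⁺ t
        ≡⟨ cong (λ p → newton node j t * ((+ suc l - (A + t)) * weight⁺ t) + p * weight⁺ t) (shift j t) ⟩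
          newton node j t * ((+ suc l - (A + t)) * weight⁺ t) + newton node j t * (A + t - + j) * weight⁺ t
        ≡⟨ r″ (newton node j t) (+ suc l) (A + t) (weight⁺ t) (+ j) ⟩
          (+ suc l - + j) * (newton node j t * weight⁺ t)
        ∎

  module HalfStep (k : ℕ) where

    -- `core r` is a polynomial in r (r + 1), equal to (r + k)!/(r - k)! for r ≥ k. `coreσ s` is the
    -- product (s - k)(s - k + 1)...(s + k), an odd polynomial in s; its zero at 0 provides a
    -- boundary condition for the adjointness.
    core coreσ : ℤ → ℤ
    core r = ∏< k (λ j → (r - + j) * (r + + j + + 1))
    coreσ s = (s - + k) * core s

    private
      core-suc′ : ∀ k r → (r + + 1 - + k) * ∏< k (λ j → (r + + 1 - + j) * (r + + 1 + + j + + 1)) ≡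
        (r + + 1 + + k) * ∏< k (λ j → (r - + j) * (r + + j + + 1))
      core-suc′ zero r = refl
      core-suc′ (suc k) r =
        trans (cong (λ s → (r + + 1 - s) * (p⁺ * ((r + + 1 - + k) * (r + + 1 + + k + + 1)))) (+suc k))
       (trans (q (r + + 1 - (+ k + + 1)) p⁺ (r + + 1 - + k) (r + + 1 + + k + + 1))
       (trans (cong (λ s → (r + + 1 - (+ k + + 1)) * (s * (r + + 1 + + k + + 1))) (core-suc′ k r))
       (trans (q′ r (+ k) p) (cong (λ s → (r + + 1 + s) * (p * ((r - + k) * (r + + k + + 1)))) (sym (+suc k))))))
        where
        p p⁺ : ℤ
        p = ∏< k (λ j → (r - + j) * (r + + j + + 1))
        p⁺ = ∏< k (λ j → (r + + 1 - + j) * (r + + 1 + + j + + 1))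
        q : ∀ x p y z → x * (p * (y * z)) ≡ x * (y * p * z)
        q = solve-∀
        q′ : ∀ r k p → (r + + 1 - (k + + 1)) * ((r + + 1 + k) * p * (r + + 1 + k + + 1)) ≡
          (r + + 1 + (k + + 1)) * (p * ((r - k) * (r + k + + 1)))
        q′ = solve-∀

    coreσ-suc : ∀ r → coreσ (suc′ r) ≡ (r + + 1 + + k) * core r
    coreσ-suc r = core-suc′ k r

    coreσ-zero : coreσ (+ 0) ≡ + 0
    coreσ-zero = go k
      where
      go : ∀ k → (+ 0 - + k) * ∏< k (λ j → (+ 0 - + j) * (+ 0 + + j + + 1)) ≡ + 0
      go zero = refl
      go (suc k) = trans (cong (λ p → (+ 0 - + suc k) * p) (p₀ k)) (*-zeroʳ (+ 0 - + suc k))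
        where
        p₀ : ∀ k → ∏< (suc k) (λ j → (+ 0 - + j) * (+ 0 + + j + + 1)) ≡ + 0
        p₀ zero = refl
        p₀ (suc k) = trans (cong (_* ((+ 0 - + suc k) * (+ 0 + + suc k + + 1))) (p₀ k)) (*-zeroˡ ((+ 0 - + suc k) * (+ 0 + + suc k + + 1)))

    -- Positions r stand for the half-integers ρ = r + 1/2, positions s for integers; X r = ρ² - 1/4 and Xσ s = s².
    X Xσ : ℤ → ℤ
    X r = r * (r + + 1)
    Xσ s = s * s

    module Down (l : ℕ) (A : ℤ) (l≡ : + suc l ≡ A + A) where

      weight weightσ : ℤ → ℤ
      weight r = bin l (A + r)
      weightσ s = bin (suc l) (A + s)

      private
        node nodeσ : ℕ → ℤ
        node i = (A - + 1 - + i) * (A - + i)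
        nodeσ i = (A - + i) * (A - + i)

        -- The nodes are the values of X and Xσ at positions counted inwards from the end of the
        -- support. X s - node i = (s - (A - 1 - i))(s + A - i) and s² - (A - i)² = (s - (A - i))(s
        -- + A - i) share a factor, and the other factors telescope over i.
        stay : ∀ j s → (A - s) * newton node j (X s) ≡ (A - + j - s) * newton nodeσ j (Xσ s)
        stay zero s = cong (λ a → (a - s) * + 1) (sym (+-identityʳ A))
        stay (suc j) s =
          trans (q (A - s) (newton node j (X s)) (X s - node j))
         (trans (cong (_* (X s - node j)) (stay j s))
         (trans (q′ A s (+ j) (newton nodeσ j (Xσ s)))
                (cong (λ i → (A - i - s) * (newton nodeσ j (Xσ s) * (Xσ s - nodeσ j))) (sym (+suc j)))))
          where
          q : ∀ x p y → x * (p * y) ≡ x * p * y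
          q = solve-∀
          q′ : ∀ A s j p → (A - j - s) * p * (s * (s + + 1) - (A - + 1 - j) * (A - j)) ≡
            (A - (j + + 1) - s) * (p * (s * s - (A - j) * (A - j)))
          q′ = solve-∀

        -- This is `stay` with s replaced by -s, because X (s - 1) = X (-s).
        move : ∀ j s → (A + s) * newton node j (X (pre s)) ≡ (A - + j + s) * newton nodeσ j (Xσ s)
        move zero s = cong (λ a → (a + s) * + 1) (sym (+-identityʳ A))
        move (suc j) s =
          trans (q (A + s) (newton node j (X (pre s))) (X (pre s) - node j))
         (trans (cong (_* (X (pre s) - node j)) (move j s))
         (trans (q′ A s (+ j) (newton nodeσ j (Xσ s)))
                (cong (λ i → (A - i + s) * (newton nodeσ j (Xσ s) * (Xσ s - nodeσ j))) (sym (+suc j)))))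
          where
          q : ∀ x p y → x * (p * y) ≡ x * p * y
          q = solve-∀
          q′ : ∀ A s j p → (A - j + s) * p * ((s - + 1) * (s - + 1 + + 1) - (A - + 1 - j) * (A - j)) ≡
            (A - (j + + 1) + s) * (p * (s * s - (A - j) * (A - j)))
          q′ = solve-∀

        eigen : ∀ j s → + suc l * (newton node j (X s) * weight s + newton node j (X (pre s)) * weight (pre s)) ≡
          + 2 * (A - + j) * (newton nodeσ j (Xσ s) * weightσ s)
        eigen j s =
          begin
            + suc l * (n₀ * weight s + n₁ * weight (pre s))
          ≡⟨ q (+ suc l) n₀ (weight s) n₁ (weight (pre s)) ⟩
            n₀ * (+ suc l * weight s) + n₁ * (+ suc l * weight (pre s))
          ≡⟨ cong₂ (λ p q → n₀ * p + n₁ * q)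
               (trans (sym (bin-absorb′ l (A + s))) (cong (λ m → (m - (A + s)) * weightσ s) l≡))
               (trans (cong (λ s → + suc l * bin l s) (sym (+-assoc A s (- + 1)))) (sym (bin-absorb l (A + s)))) ⟩
            n₀ * ((A + A - (A + s)) * weightσ s) + n₁ * ((A + s) * weightσ s)
          ≡⟨ q′ A s n₀ n₁ (weightσ s) ⟩
            ((A - s) * n₀ + (A + s) * n₁) * weightσ s
          ≡⟨ cong₂ (λ p q → (p + q) * weightσ s) (stay j s) (move j s) ⟩
            ((A - + j - s) * nσ + (A - + j + s) * nσ) * weightσ s
          -- The coefficients A - j - s and A - j + s add up to 2 (A - j), which is free of s: here
          -- the operator becomes diagonal.
          ≡⟨ q″ A s (+ j) nσ (weightσ s) ⟩
            + 2 * (A - + j) * (nσ * weightσ s)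
          ∎
          where
          n₀ n₁ nσ : ℤ
          n₀ = newton node j (X s)
          n₁ = newton node j (X (pre s))
          nσ = newton nodeσ j (Xσ s)
          q : ∀ s n w n′ w′ → s * (n * w + n′ * w′) ≡ n * (s * w) + n′ * (s * w′)
          q = solve-∀
          q′ : ∀ A s n n′ w → n * ((A + A - (A + s)) * w) + n′ * ((A + s) * w) ≡ ((A - s) * n + (A + s) * n′) * w
          q′ = solve-∀
          q″ : ∀ A s j n w → ((A - j - s) * n + (A - j + s) * n) * w ≡ + 2 * (A - j) * (n * w)
          q″ = solve-∀

      steps-down : ∀ n ts → length ts ≡ n → (+ suc l) ^ n * steps pre (alt X weight) ts ≡
        ∏< n (λ j → + 2 * (A - + j)) * alt Xσ weightσ ts
      steps-down = steps-alt pre {a = node} {a′ = nodeσ} (+ suc l) (λ j → + 2 * (A - + j)) eigen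

    module Up (l : ℕ) (B : ℤ) (l≡ : + l ≡ B + B) where

      weightσ weight : ℤ → ℤ
      weightσ s = coreσ s * bin l (B + s)
      weight r = (+ 2 * r + + 1) * core r * bin (suc l) (B + + 1 + r)

      private
        node nodeσ : ℕ → ℤ
        node i = (B - + i) * (B - + i + + 1)
        nodeσ i = (B - + i) * (B - + i)

        stay : ∀ j r → (B + + 1 + r) * newton nodeσ j (Xσ r) ≡ (B + + 1 - + j + r) * newton node j (X r)
        stay zero r = cong (λ a → (a + r) * + 1) (sym (+-identityʳ (B + + 1)))
        stay (suc j) r =
          trans (q (B + + 1 + r) (newton nodeσ j (Xσ r)) (Xσ r - nodeσ j))
         (trans (cong (_* (Xσ r - nodeσ j)) (stay j r))
         (trans (q′ B r (+ j) (newton node j (X r)))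
                (cong (λ i → (B + + 1 - i + r) * (newton node j (X r) * (X r - node j))) (sym (+suc j)))))
          where
          q : ∀ x p y → x * (p * y) ≡ x * p * y
          q = solve-∀
          q′ : ∀ B r j p → (B + + 1 - j + r) * p * (r * r - (B - j) * (B - j)) ≡
            (B + + 1 - (j + + 1) + r) * (p * (r * (r + + 1) - (B - j) * (B - j + + 1)))
          q′ = solve-∀

        -- This is `stay` under the reflection r ↦ -1 - r, which fixes X r and turns r² into (r +
        -- 1)².
        move : ∀ j r → (B - r) * newton nodeσ j (Xσ (suc′ r)) ≡ (B - + j - r) * newton node j (X r)
        move zero r = cong (λ a → (a - r) * + 1) (sym (+-identityʳ B))
        move (suc j) r =
          trans (q (B - r) (newton nodeσ j (Xσ (suc′ r))) (Xσ (suc′ r) - nodeσ j))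
         (trans (cong (_* (Xσ (suc′ r) - nodeσ j)) (move j r))
         (trans (q′ B r (+ j) (newton node j (X r)))
                (cong (λ i → (B - i - r) * (newton node j (X r) * (X r - node j))) (sym (+suc j)))))
          where
          q : ∀ x p y → x * (p * y) ≡ x * p * y
          q = solve-∀
          q′ : ∀ B r j p → (B - j - r) * p * ((r + + 1) * (r + + 1) - (B - j) * (B - j)) ≡
            (B - (j + + 1) - r) * (p * (r * (r + + 1) - (B - j) * (B - j + + 1)))
          q′ = solve-∀

        eigen : ∀ j r → + suc l * (newton nodeσ j (Xσ r) * weightσ r + newton nodeσ j (Xσ (suc′ r)) * weightσ (suc′ r)) ≡
          (B - + j - + k) * (newton node j (X r) * weight r)
        eigen j r =
          begin
            + suc l * (n₀ * weightσ r + n₁ * weightσ (suc′ r))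
          ≡⟨ q (+ suc l) n₀ (coreσ r) (bin l (B + r)) n₁ (coreσ (suc′ r)) (bin l (B + suc′ r)) ⟩
            n₀ * coreσ r * (+ suc l * bin l (B + r)) + n₁ * coreσ (suc′ r) * (+ suc l * bin l (B + suc′ r))
          ≡⟨ cong₂ (λ p q → n₀ * coreσ r * p + n₁ * coreσ (suc′ r) * q) eq₀ eq₁ ⟩
            n₀ * coreσ r * ((B + + 1 + r) * b) + n₁ * coreσ (suc′ r) * ((B - r) * b)
          ≡⟨ cong (λ c → n₀ * coreσ r * ((B + + 1 + r) * b) + n₁ * c * ((B - r) * b)) (coreσ-suc r) ⟩
            n₀ * coreσ r * ((B + + 1 + r) * b) + n₁ * ((r + + 1 + + k) * core r) * ((B - r) * b)
          ≡⟨ q′ B r (+ k) n₀ n₁ (core r) b ⟩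
            ((r - + k) * ((B + + 1 + r) * n₀) + (r + + 1 + + k) * ((B - r) * n₁)) * (core r * b)
          ≡⟨ cong₂ (λ p q → ((r - + k) * p + (r + + 1 + + k) * q) * (core r * b)) (stay j r) (move j r) ⟩
            ((r - + k) * ((B + + 1 - + j + r) * n) + (r + + 1 + + k) * ((B - + j - r) * n)) * (core r * b)
          -- The terms quadratic in r cancel and the bracket becomes (2 r + 1)(B - j - k). The
          -- factor 2 r + 1 in `weight` originates here.
          ≡⟨ q″ B r (+ j) (+ k) n (core r) b ⟩
            (B - + j - + k) * (n * weight r)
          ∎
          where
          n₀ n₁ n b : ℤ
          n₀ = newton nodeσ j (Xσ r)
          n₁ = newton nodeσ j (Xσ (suc′ r))
          n = newton node j (X r)
          b = bin (suc l) (B + + 1 + r)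
          q : ∀ s n c w n′ c′ w′ → s * (n * (c * w) + n′ * (c′ * w′)) ≡ n * c * (s * w) + n′ * c′ * (s * w′)
          q = solve-∀
          q′ : ∀ B r k n n′ c b → n * ((r - k) * c) * ((B + + 1 + r) * b) + n′ * ((r + + 1 + k) * c) * ((B - r) * b) ≡
            ((r - k) * ((B + + 1 + r) * n) + (r + + 1 + k) * ((B - r) * n′)) * (c * b)
          q′ = solve-∀
          q″ : ∀ B r j k n c b → ((r - k) * ((B + + 1 - j + r) * n) + (r + + 1 + k) * ((B - j - r) * n)) * (c * b) ≡
            (B - j - k) * (n * ((+ 2 * r + + 1) * c * b))
          q″ = solve-∀
          e₀ : ∀ B r → B + r ≡ B + + 1 + r - + 1
          e₀ = solve-∀
          e₁ : ∀ B r → B + (r + + 1) ≡ B + + 1 + r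
          e₁ = solve-∀
          e₂ : ∀ B r → B + B + + 1 - (B + + 1 + r) ≡ B - r
          e₂ = solve-∀
          eq₀ : + suc l * bin l (B + r) ≡ (B + + 1 + r) * b
          eq₀ = trans (cong (λ t → + suc l * bin l t) (e₀ B r)) (sym (bin-absorb l (B + + 1 + r)))
          eq₁ : + suc l * bin l (B + suc′ r) ≡ (B - r) * b
          eq₁ = trans (cong (λ t → + suc l * bin l t) (e₁ B r))
               (trans (sym (bin-absorb′ l (B + + 1 + r)))
                      (cong (_* b) (trans (cong (_- (B + + 1 + r)) (trans (+suc l) (cong (_+ + 1) l≡))) (e₂ B r))))

      steps-up : ∀ n ts → length ts ≡ n → (+ suc l) ^ n * steps suc′ (alt Xσ weightσ) ts ≡
        ∏< n (λ j → B - + j - + k) * alt X weight ts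
      steps-up = steps-alt suc′ {a = nodeσ} {a′ = node} (+ suc l) (λ j → B - + j - + k) eigen

-- Strict configurations, sums over tuples, and summation by parts

module TupleSums where
  open import Data.Integer using (_+_; _-_; _*_; -_; _^_; _<_; _≤_)
  open Alternants
  open Weights

  -- The device for linear inequalities throughout: the goal has the same slack as a known
  -- inequality, or a sum of known ones, and the equality of slacks is left to the ring solver.
  lin : ∀ {a b c d} → a ≤ b → d - c ≡ b - a → c ≤ d
  lin a≤b e = 0≤i-j⇒j≤i (subst (+ 0 ≤_) (sym e) (i≤j⇒0≤j-i a≤b))

  <⇒+1≤ : ∀ {i j} → i < j → i + + 1 ≤ j
  <⇒+1≤ {i} {j} p = subst (_≤ j) (+-comm (+ 1) i) (i<j⇒suc[i]≤j p)

  +1≤⇒< : ∀ {i j} → i + + 1 ≤ j → i < j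
  +1≤⇒< {i} {j} p = suc[i]≤j⇒i<j (subst (_≤ j) (+-comm i (+ 1)) p)

  Strict Weak : List ℤ → Set
  Strict = Linked (λ x y → y < x)
  Weak = Linked (λ x y → y ≤ x)

  strict? : ∀ ts → Dec (Strict ts)
  strict? = linked? (λ x y → y <? x)

  ind : List ℤ → ℤ
  ind ts = if does (strict? ts) then + 1 else + 0

  ind-yes : ∀ {ts} → Strict ts → ind ts ≡ + 1
  ind-yes {ts} s with strict? ts
  ... | yes _ = refl
  ... | no ¬s = ⊥-elim (¬s s)

  ind-no : ∀ {ts} → ¬ Strict ts → ind ts ≡ + 0
  ind-no {ts} ¬s with strict? ts
  ... | yes s = ⊥-elim (¬s s)
  ... | no _ = refl

  alt-zero : ∀ {A : Set} (X h : A → ℤ) {ts} → Any (λ t → h t ≡ + 0) ts → alt X h ts ≡ + 0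
  alt-zero X h {t ∷ ts} (here e) = trans (cong (λ z → z * diffs X h (X t) ts * alt X h ts) e) refl
  alt-zero X h {t ∷ ts} (there a) =
    trans (cong (h t * diffs X h (X t) ts *_) (alt-zero X h a)) (*-zeroʳ (h t * diffs X h (X t) ts))

  weak-strict : ∀ {ts} → Weak ts → Strict ts ⊎ (∀ X h → alt X h ts ≡ + 0)
  weak-strict [] = inj₁ []
  weak-strict [-] = inj₁ [-]
  weak-strict {t ∷ u ∷ ts} (u≤t ∷ w) with weak-strict w
  ... | inj₂ z = inj₂ λ X h → trans (cong (h t * diffs X h (X t) (u ∷ ts) *_) (z X h)) (*-zeroʳ (h t * diffs X h (X t) (u ∷ ts)))
  ... | inj₁ s with u ≟ t
  ... | no u≢t = inj₁ (≤∧≢⇒< u≤t u≢t ∷ s)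
  ... | yes refl = inj₂ λ X h →
    trans (cong (λ z → h t * (z * diffs X h (X t) ts) * alt X h (t ∷ ts)) (+-inverseʳ (X t)))
          (r (h t) (diffs X h (X t) ts) (alt X h (t ∷ ts)))
    where
    r : ∀ x y z → x * (+ 0 * y) * z ≡ + 0
    r = solve-∀

  ind-alt : ∀ X h {ts} → Weak ts → ind ts * alt X h ts ≡ alt X h ts
  ind-alt X h {ts} w with weak-strict w
  ... | inj₁ s = trans (cong (_* alt X h ts) (ind-yes s)) (*-identityˡ _)
  ... | inj₂ z = trans (cong (ind ts *_) (z X h)) (trans (*-zeroʳ (ind ts)) (sym (z X h)))

  Stepped : (ℤ → ℤ) → List ℤ → List ℤ → Set
  Stepped δ = Pointwise (λ t u → u ≡ t ⊎ u ≡ δ t)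

  steps-cong-stepped : ∀ δ {G G′ : List ℤ → ℤ} ts → (∀ us → Stepped δ ts us → G us ≡ G′ us) →
    steps δ G ts ≡ steps δ G′ ts
  steps-cong-stepped δ [] e = e [] []
  steps-cong-stepped δ (t ∷ ts) e =
    cong₂ _+_ (steps-cong-stepped δ ts λ us q → e (t ∷ us) (inj₁ refl ∷ q))
              (steps-cong-stepped δ ts λ us q → e (δ t ∷ us) (inj₂ refl ∷ q))

  steps-scale : ∀ δ c (G : List ℤ → ℤ) ts → steps δ (λ us → c * G us) ts ≡ c * steps δ G ts
  steps-scale δ c G [] = refl
  steps-scale δ c G (t ∷ ts) =
    trans (cong₂ _+_ (steps-scale δ c _ ts) (steps-scale δ c _ ts)) (sym (*-distribˡ-+ c _ _))

  -- Particles at distinct integers that each move by at most one unit in a common direction may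
  -- collide but cannot cross.
  Ordered : (ℤ → ℤ) → Set
  Ordered δ = ∀ {t t′ u u′} → t′ < t → u ≡ t ⊎ u ≡ δ t → u′ ≡ t′ ⊎ u′ ≡ δ t′ → u′ ≤ u

  pre-ordered : Ordered pre
  pre-ordered {t} {t′} lt p q = ≤-trans (upper q) (≤-trans (lin (<⇒+1≤ lt) (e t t′)) (lower p))
    where
    e : ∀ t t′ → (t - + 1) - t′ ≡ t - (t′ + + 1)
    e = solve-∀
    e′ : ∀ t → t - (t - + 1) ≡ + 1 - + 0
    e′ = solve-∀
    upper : ∀ {u} → u ≡ t′ ⊎ u ≡ pre t′ → u ≤ t′
    upper (inj₁ refl) = ≤-refl
    upper (inj₂ refl) = lin (ℤ.+≤+ ℕ.z≤n) (e′ t′)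
    lower : ∀ {u} → u ≡ t ⊎ u ≡ pre t → pre t ≤ u
    lower (inj₁ refl) = lin (ℤ.+≤+ ℕ.z≤n) (e′ t)
    lower (inj₂ refl) = ≤-refl

  suc′-ordered : Ordered suc′
  suc′-ordered {t} {t′} lt p q = ≤-trans (upper q) (≤-trans (<⇒+1≤ lt) (lower p))
    where
    e′ : ∀ t → (t + + 1) - t ≡ + 1 - + 0
    e′ = solve-∀
    upper : ∀ {u} → u ≡ t′ ⊎ u ≡ suc′ t′ → u ≤ suc′ t′
    upper (inj₁ refl) = lin (ℤ.+≤+ ℕ.z≤n) (e′ t′)
    upper (inj₂ refl) = ≤-refl
    lower : ∀ {u} → u ≡ t ⊎ u ≡ suc′ t → t ≤ u
    lower (inj₁ refl) = ≤-refl
    lower (inj₂ refl) = lin (ℤ.+≤+ ℕ.z≤n) (e′ t)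

  stepped-weak : ∀ {δ} → Ordered δ → ∀ {ts us} → Strict ts → Stepped δ ts us → Weak us
  stepped-weak o [] [] = []
  stepped-weak o [-] (_ ∷ []) = [-]
  stepped-weak o (lt ∷ s) (p ∷ q ∷ ps) = o lt p q ∷ stepped-weak o s (q ∷ ps)

  -- A step from a strict configuration that ends in a nonstrict one creates two equal neighbours, where alt vanishes.
  ind-steps : ∀ {δ} → Ordered δ → ∀ X h ts →
    ind ts * steps δ (λ us → ind us * alt X h us) ts ≡ ind ts * steps δ (alt X h) ts
  ind-steps {δ} o X h ts with strict? ts
  ... | yes s = cong (+ 1 *_) (steps-cong-stepped δ ts λ us p → ind-alt X h (stepped-weak o s p))
  ... | no _ = refl

  Σ< : ℕ → (ℤ → ℤ) → ℤ
  Σ< zero f = + 0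
  Σ< (suc n) f = Σ< n f + f (+ n)

  Σ<-cong : ∀ n {f g : ℤ → ℤ} → (∀ t → f t ≡ g t) → Σ< n f ≡ Σ< n g
  Σ<-cong zero e = refl
  Σ<-cong (suc n) e = cong₂ _+_ (Σ<-cong n e) (e (+ n))

  Σ<-scale : ∀ n c (f : ℤ → ℤ) → Σ< n (λ t → c * f t) ≡ c * Σ< n f
  Σ<-scale zero c f = sym (*-zeroʳ c)
  Σ<-scale (suc n) c f = trans (cong (_+ c * f (+ n)) (Σ<-scale n c f)) (sym (*-distribˡ-+ c _ _))

  Σ<-add : ∀ n (f g : ℤ → ℤ) → Σ< n (λ t → f t + g t) ≡ Σ< n f + Σ< n g
  Σ<-add zero f g = refl
  Σ<-add (suc n) f g = trans (cong (_+ (f (+ n) + g (+ n))) (Σ<-add n f g)) (r (Σ< n f) (Σ< n g) (f (+ n)) (g (+ n)))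
    where
    r : ∀ x y z w → x + y + (z + w) ≡ x + z + (y + w)
    r = solve-∀

  Σᵗ : ℕ → ℕ → (List ℤ → ℤ) → ℤ
  Σᵗ zero M G = G []
  Σᵗ (suc m) M G = Σ< M (λ t → Σᵗ m M (λ ts → G (t ∷ ts)))

  Σᵗ-cong : ∀ m M {G G′ : List ℤ → ℤ} → (∀ ts → length ts ≡ m → G ts ≡ G′ ts) → Σᵗ m M G ≡ Σᵗ m M G′
  Σᵗ-cong zero M e = e [] refl
  Σᵗ-cong (suc m) M e = Σ<-cong M λ t → Σᵗ-cong m M λ ts q → e (t ∷ ts) (cong suc q)

  Σᵗ-scale : ∀ m M c (G : List ℤ → ℤ) → Σᵗ m M (λ ts → c * G ts) ≡ c * Σᵗ m M G
  Σᵗ-scale zero M c G = refl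
  Σᵗ-scale (suc m) M c G = trans (Σ<-cong M λ t → Σᵗ-scale m M c _) (Σ<-scale M c _)

  Σᵗ-add : ∀ m M (G G′ : List ℤ → ℤ) → Σᵗ m M (λ ts → G ts + G′ ts) ≡ Σᵗ m M G + Σᵗ m M G′
  Σᵗ-add zero M G G′ = refl
  Σᵗ-add (suc m) M G G′ = trans (Σ<-cong M λ t → Σᵗ-add m M _ _) (Σ<-add M _ _)

  -- Both sides sum k over pairs of equal or adjacent positions. They differ only in the terms at (M
  -- , M) and (0 , -1), which the two hypotheses annihilate.
  Σ<-adjoint : ∀ M (k : ℤ → ℤ → ℤ) → (∀ r → k (+ 0) r ≡ + 0) → (∀ s → k s (+ M) ≡ + 0) →
    Σ< (suc M) (λ s → k s s + k s (pre s)) ≡ Σ< M (λ r → k r r + k (suc′ r) r)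
  Σ<-adjoint M k k₀ kM =
    trans (go M) (trans (cong₂ (λ x y → Σ< M (λ r → k r r + k (suc′ r) r) + x + y) (kM (+ M)) (k₀ -[1+ 0 ]))
                        (r (Σ< M (λ r → k r r + k (suc′ r) r))))
    where
    r : ∀ x → x + + 0 + + 0 ≡ x
    r = solve-∀
    q : ∀ a b c x y → a + b + c + (x + y) ≡ a + (b + y) + x + c
    q = solve-∀
    q₀ : ∀ x y → + 0 + (x + y) ≡ + 0 + x + y
    q₀ = solve-∀
    go : ∀ M → Σ< (suc M) (λ s → k s s + k s (pre s)) ≡ Σ< M (λ r → k r r + k (suc′ r) r) + k (+ M) (+ M) + k (+ 0) -[1+ 0 ]
    go zero = q₀ (k (+ 0) (+ 0)) (k (+ 0) -[1+ 0 ])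
    go (suc M) =
      trans (cong (_+ (k (+ suc M) (+ suc M) + k (+ suc M) (+ M))) (go M))
     (trans (cong (λ s → Σ< M (λ r → k r r + k (suc′ r) r) + k (+ M) (+ M) + k (+ 0) -[1+ 0 ] + (k (+ suc M) (+ suc M) + k s (+ M)))
                  (cong +_ (ℕₚ.+-comm 1 M)))
            (q (Σ< M (λ r → k r r + k (suc′ r) r)) (k (+ M) (+ M)) (k (+ 0) -[1+ 0 ]) (k (+ suc M) (+ suc M)) (k (suc′ (+ M)) (+ M))))

  -- The coordinates move independently, so the one-variable identity is applied to the first
  -- coordinate while the induction, with the two heads fixed, handles the others.
  steps-adjoint : ∀ m M (K : List ℤ → List ℤ → ℤ) →
    (∀ ss rs → Any (_≡ + 0) ss → K ss rs ≡ + 0) → (∀ ss rs → Any (_≡ + M) rs → K ss rs ≡ + 0) →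
    Σᵗ m (suc M) (λ ss → steps pre (λ rs → K ss rs) ss) ≡ Σᵗ m M (λ rs → steps suc′ (λ ss → K ss rs) rs)
  steps-adjoint zero M K K₀ KM = refl
  steps-adjoint (suc m) M K K₀ KM =
    begin
      Σ< (suc M) (λ s → Σᵗ m (suc M) (λ ss → steps pre (λ rs → K (s ∷ ss) (s ∷ rs)) ss + steps pre (λ rs → K (s ∷ ss) (pre s ∷ rs)) ss))
    ≡⟨ Σ<-cong (suc M) (λ s → trans (Σᵗ-add m (suc M) _ _) (cong₂ _+_ (inner s s) (inner s (pre s)))) ⟩
      Σ< (suc M) (λ s → k s s + k s (pre s))
    ≡⟨ Σ<-adjoint M k (λ r → zeros (λ ss rs → K₀ (+ 0 ∷ ss) (r ∷ rs) (here refl))) (λ s → zeros (λ ss rs → KM (s ∷ ss) (+ M ∷ rs) (here refl))) ⟩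
      Σ< M (λ r → k r r + k (suc′ r) r)
    ≡⟨ Σ<-cong M (λ r → sym (Σᵗ-add m M _ _)) ⟩
      Σ< M (λ r → Σᵗ m M (λ rs → steps suc′ (λ ss → K (r ∷ ss) (r ∷ rs)) rs + steps suc′ (λ ss → K (suc′ r ∷ ss) (r ∷ rs)) rs))
    ∎
    where
    k : ℤ → ℤ → ℤ
    k s r = Σᵗ m M (λ rs → steps suc′ (λ ss → K (s ∷ ss) (r ∷ rs)) rs)
    inner : ∀ s r → Σᵗ m (suc M) (λ ss → steps pre (λ rs → K (s ∷ ss) (r ∷ rs)) ss) ≡ k s r
    inner s r = steps-adjoint m M (λ ss rs → K (s ∷ ss) (r ∷ rs)) (λ ss rs a → K₀ _ _ (there a)) (λ ss rs a → KM _ _ (there a))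
    zeros : ∀ {s r} → (∀ ss rs → K (s ∷ ss) (r ∷ rs) ≡ + 0) → k s r ≡ + 0
    zeros {s} {r} z = trans (Σᵗ-cong m M {G′ = λ rs → + 0 * steps suc′ (λ _ → + 0) rs} λ rs _ →
                              trans (steps-cong-stepped suc′ rs λ ss _ → z ss rs) (steps-scale suc′ (+ 0) (λ _ → + 0) rs))
                            (Σᵗ-scale m M (+ 0) (λ rs → steps suc′ (λ _ → + 0) rs))

  -- The kernel `K` carries the strictness indicators of both configurations. On either side
  -- `ind-steps` removes the inner one, so that the operators act on plain alternants, where they
  -- are diagonal.
  ind-adjoint : ∀ m M X Xσ f g → f (+ M) ≡ + 0 → g (+ 0) ≡ + 0 →
    Σᵗ m M (λ rs → ind rs * (alt X f rs * steps suc′ (alt Xσ g) rs)) ≡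
    Σᵗ m (suc M) (λ ss → ind ss * (alt Xσ g ss * steps pre (alt X f) ss))
  ind-adjoint m M X Xσ f g fM g₀ =
    begin
      Σᵗ m M (λ rs → ind rs * (alt X f rs * steps suc′ (alt Xσ g) rs))
    ≡⟨ Σᵗ-cong m M (λ rs _ → sym (trans (steps-scale suc′ (ind rs * alt X f rs) _ rs)
         (trans (p (ind rs) (alt X f rs) _) (trans (cong (alt X f rs *_) (ind-steps suc′-ordered Xσ g rs)) (p′ (ind rs) (alt X f rs) _))))) ⟩
      Σᵗ m M (λ rs → steps suc′ (λ ss → K ss rs) rs)
    ≡⟨ sym (steps-adjoint m M K
         (λ ss rs a → trans (cong (λ z → ind rs * alt X f rs * (ind ss * z)) (alt-zero Xσ g (Any.map (λ {refl → g₀}) a)))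
                            (z₁ (ind rs * alt X f rs) (ind ss)))
         (λ ss rs a → trans (cong (λ z → ind rs * z * (ind ss * alt Xσ g ss)) (alt-zero X f (Any.map (λ {refl → fM}) a)))
                            (z₂ (ind rs) (ind ss * alt Xσ g ss)))) ⟩
      Σᵗ m (suc M) (λ ss → steps pre (λ rs → K ss rs) ss)
    ≡⟨ Σᵗ-cong m (suc M) (λ ss _ → trans (steps-cong pre ss λ rs _ → *-comm (ind rs * alt X f rs) _)
         (trans (steps-scale pre (ind ss * alt Xσ g ss) _ ss)
         (trans (p (ind ss) (alt Xσ g ss) _) (trans (cong (alt Xσ g ss *_) (ind-steps pre-ordered X f ss)) (p′ (ind ss) (alt Xσ g ss) _))))) ⟩
      Σᵗ m (suc M) (λ ss → ind ss * (alt Xσ g ss * steps pre (alt X f) ss))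
    ∎
    where
    K : List ℤ → List ℤ → ℤ
    K ss rs = ind rs * alt X f rs * (ind ss * alt Xσ g ss)
    p : ∀ x y z → x * y * z ≡ y * (x * z)
    p = solve-∀
    p′ : ∀ x y z → y * (x * z) ≡ x * (y * z)
    p′ = solve-∀
    z₁ : ∀ x y → x * (y * + 0) ≡ + 0
    z₁ = solve-∀
    z₂ : ∀ x y → x * + 0 * y ≡ + 0
    z₂ = solve-∀

-- The discrete Selberg sums and the half step

module Evaluation where
  open import Data.Integer using (_+_; _-_; _*_; -_; _^_; _<_; _≤_)
  open Alternants
  open Weights
  open TupleSums

  +suc : ∀ n → + suc n ≡ + n + + 1
  +suc n = cong +_ (ℕₚ.+-comm 1 n)

  Σᵗ-cong-range : ∀ m M {G G′ : List ℤ → ℤ} →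
    (∀ ts → length ts ≡ m → All (λ t → ∃ λ n → t ≡ + n × n ℕ.< M) ts → G ts ≡ G′ ts) → Σᵗ m M G ≡ Σᵗ m M G′
  Σᵗ-cong-range zero M e = e [] refl []
  Σᵗ-cong-range (suc m) M {G} {G′} e = go M ℕₚ.≤-refl
    where
    go : ∀ N → N ℕ.≤ M → Σ< N (λ t → Σᵗ m M (λ ts → G (t ∷ ts))) ≡ Σ< N (λ t → Σᵗ m M (λ ts → G′ (t ∷ ts)))
    go zero _ = refl
    go (suc N) N<M = cong₂ _+_ (go N (ℕₚ.<⇒≤ N<M)) (Σᵗ-cong-range m M λ ts q a → e (+ N ∷ ts) (cong suc q) ((N , refl , N<M) ∷ a))

  -- The Vandermonde factors do not involve the weights, so a weight may be moved from one alternant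
  -- to the other. This lets the parameters A and B change roles.
  alt-* : ∀ {A : Set} (X f g f′ g′ : A → ℤ) → (∀ t → f t * g t ≡ f′ t * g′ t) → ∀ ts →
    alt X f ts * alt X g ts ≡ alt X f′ ts * alt X g′ ts
  alt-* X f g f′ g′ e [] = refl
  alt-* X f g f′ g′ e (t ∷ ts) =
    trans (r (f t) (g t) (d f) (d g) (alt X f ts) (alt X g ts))
   (trans (cong₂ (λ p q → p * q * (d f * d g)) (e t) (alt-* X f g f′ g′ e ts))
   (trans (cong₂ (λ p q → f′ t * g′ t * (alt X f′ ts * alt X g′ ts) * (p * q)) (dd f f′ ts) (dd g g′ ts))
          (sym (r (f′ t) (g′ t) (d f′) (d g′) (alt X f′ ts) (alt X g′ ts)))))
    where
    d : (_ → ℤ) → ℤ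
    d h = diffs X h (X t) ts
    dd : ∀ h h′ us → diffs X h (X t) us ≡ diffs X h′ (X t) us
    dd h h′ [] = refl
    dd h h′ (u ∷ us) = cong ((X t - X u) *_) (dd h h′ us)
    r : ∀ f g d d′ x y → f * d * x * (g * d′ * y) ≡ f * g * (x * y) * (d * d′)
    r = solve-∀

  -- (2A - 1)! and (2A)! times 1/(A-1/2+ρ)!(A-1/2-ρ)! resp. 1/(A+s)!(A-s)!, for A = α + 1 and ρ = r + 1/2.
  halfBin halfBinσ : ℕ → ℤ → ℤ
  halfBin α r = bin (suc (α ℕ.+ α)) (+ suc α + r)
  halfBinσ α s = bin (suc (suc (α ℕ.+ α))) (+ suc α + s)

  module Pairing (k m M : ℕ) where
    open HalfStep k

    Fc Fcσ : ℕ → ℤ → ℤ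
    Fc β r = (+ 2 * r + + 1) * core r * halfBin β r
    Fcσ β s = coreσ s * halfBinσ β s

    -- `Z` sums over half-integer positions and `Zσ` over integer ones. The range of `Zσ` is longer
    -- by one because a step up from M - 1 reaches M.
    Z Zσ : ℕ → ℕ → ℤ
    Z α β = Σᵗ m M (λ rs → ind rs * (alt X (halfBin α) rs * alt X (Fc β) rs))
    Zσ α β = Σᵗ m (suc M) (λ ss → ind ss * (alt Xσ (halfBinσ α) ss * alt Xσ (Fcσ β) ss))

    Z-sym : ∀ α β → Z α β ≡ Z β α
    Z-sym α β = Σᵗ-cong m M λ rs _ → cong (ind rs *_)
      (alt-* X (halfBin α) (Fc β) (halfBin β) (Fc α) (λ r → q (halfBin α r) ((+ 2 * r + + 1) * core r) (halfBin β r)) rs)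
      where
      q : ∀ x c y → x * (c * y) ≡ y * (c * x)
      q = solve-∀

    Zσ-sym : ∀ α β → Zσ α β ≡ Zσ β α
    Zσ-sym α β = Σᵗ-cong m (suc M) λ ss _ → cong (ind ss *_)
      (alt-* Xσ (halfBinσ α) (Fcσ β) (halfBinσ β) (Fcσ α) (λ s → q (halfBinσ α s) (coreσ s) (halfBinσ β s)) ss)
      where
      q : ∀ x c y → x * (c * y) ≡ y * (c * x)
      q = solve-∀

    lift : ℕ → ℕ → ℤ
    lift α c = ∏< m (λ j → + suc α - + j - + c)

    twos : ℕ → ℤ
    twos α = ∏< m (λ j → + 2 * (+ suc α - + j))

    private
      double : ∀ α → suc (suc (α ℕ.+ α)) ≡ suc α ℕ.+ suc α
      double α = cong suc (sym (ℕₚ.+-suc α α))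

    -- `Up` turns the alternant for β + 1 into steps of one on the integer positions, adjointness
    -- transfers the steps to the alternant for α, and `Down` evaluates them there. The bound α < M
    -- makes the weight for α vanish at M.
    half-step : ∀ α β → α ℕ.< M →
      lift β k * (+ suc (suc (α ℕ.+ α))) ^ m * Z α (suc β) ≡ (+ suc (suc (suc (β ℕ.+ β)))) ^ m * twos α * Zσ α β
    half-step α β α<M =
      begin
        lift β k * u * Z α (suc β)
      ≡⟨ q₁ (lift β k) u (Z α (suc β)) ⟩
        u * (lift β k * Z α (suc β))
      ≡⟨ cong (u *_) (sym (Σᵗ-scale m M (lift β k) _)) ⟩
        u * Σᵗ m M (λ rs → lift β k * (ind rs * (alt X (halfBin α) rs * alt X (Fc (suc β)) rs)))
      ≡⟨ cong (u *_) (Σᵗ-cong m M λ rs e →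
           trans (q₂ (lift β k) (ind rs) (alt X (halfBin α) rs) (alt X (Fc (suc β)) rs))
          (trans (cong (λ z → ind rs * (alt X (halfBin α) rs * z)) (sym (up rs e)))
                 (q₃ (ind rs) (alt X (halfBin α) rs) v (steps suc′ (alt Xσ (Fcσ β)) rs)))) ⟩
        u * Σᵗ m M (λ rs → v * (ind rs * (alt X (halfBin α) rs * steps suc′ (alt Xσ (Fcσ β)) rs)))
      ≡⟨ cong (u *_) (trans (Σᵗ-scale m M v _) (cong (v *_)
           (ind-adjoint m M X Xσ (halfBin α) (Fcσ β) (bin-big (suc (α ℕ.+ α)) (suc α ℕ.+ M) (ℕ.s≤s (ℕₚ.+-monoʳ-< α α<M)))
             (trans (cong (_* halfBinσ β (+ 0)) coreσ-zero) (*-zeroˡ (halfBinσ β (+ 0))))))) ⟩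
        u * (v * Σᵗ m (suc M) (λ ss → ind ss * (alt Xσ (Fcσ β) ss * steps pre (alt X (halfBin α)) ss)))
      ≡⟨ q₄ u v _ ⟩
        v * (u * Σᵗ m (suc M) (λ ss → ind ss * (alt Xσ (Fcσ β) ss * steps pre (alt X (halfBin α)) ss)))
      ≡⟨ cong (v *_) (trans (sym (Σᵗ-scale m (suc M) u _)) (Σᵗ-cong m (suc M) λ ss e →
           trans (q₅ u (ind ss) (alt Xσ (Fcσ β) ss) (steps pre (alt X (halfBin α)) ss))
          (trans (cong (λ z → ind ss * (z * alt Xσ (Fcσ β) ss)) (down ss e))
                 (q₆ (ind ss) (twos α) (alt Xσ (halfBinσ α) ss) (alt Xσ (Fcσ β) ss))))) ⟩
        v * Σᵗ m (suc M) (λ ss → twos α * (ind ss * (alt Xσ (halfBinσ α) ss * alt Xσ (Fcσ β) ss)))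
      ≡⟨ cong (v *_) (Σᵗ-scale m (suc M) (twos α) _) ⟩
        v * (twos α * Zσ α β)
      ≡⟨ sym (*-assoc v (twos α) (Zσ α β)) ⟩
        v * twos α * Zσ α β
      ∎
      where
      u v : ℤ
      u = (+ suc (suc (α ℕ.+ α))) ^ m
      v = (+ suc (suc (suc (β ℕ.+ β)))) ^ m
      module D = Down (suc (α ℕ.+ α)) (+ suc α) (cong +_ (double α))
      module U = Up (suc (suc (β ℕ.+ β))) (+ suc β) (cong +_ (double β))
      down : ∀ ss → length ss ≡ m → u * steps pre (alt X (halfBin α)) ss ≡ twos α * alt Xσ (halfBinσ α) ss
      down = D.steps-down m
      alt-cong : ∀ {f g : ℤ → ℤ} → (∀ t → f t ≡ g t) → ∀ ts → alt X f ts ≡ alt X g ts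
      alt-cong e [] = refl
      alt-cong {f} {g} e (t ∷ ts) = cong₂ _*_ (cong₂ _*_ (e t) (dd ts)) (alt-cong e ts)
        where
        dd : ∀ us → diffs X f (X t) us ≡ diffs X g (X t) us
        dd [] = refl
        dd (u ∷ us) = cong ((X t - X u) *_) (dd us)
      up : ∀ rs → length rs ≡ m → v * steps suc′ (alt Xσ (Fcσ β)) rs ≡ lift β k * alt X (Fc (suc β)) rs
      up rs e = trans (U.steps-up m rs e) (cong (lift β k *_) (alt-cong (λ r → cong ((+ 2 * r + + 1) * core r *_)
        (cong₂ (λ l B → bin (suc l) (B + r)) (double β) (cong +_ (ℕₚ.+-comm (suc β) 1)))) rs))
      q₁ : ∀ l u z → l * u * z ≡ u * (l * z)
      q₁ = solve-∀
      q₂ : ∀ l i f g → l * (i * (f * g)) ≡ i * (f * (l * g))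
      q₂ = solve-∀
      q₃ : ∀ i f v s → i * (f * (v * s)) ≡ v * (i * (f * s))
      q₃ = solve-∀
      q₄ : ∀ u v z → u * (v * z) ≡ v * (u * z)
      q₄ = solve-∀
      q₅ : ∀ u i g s → u * (i * (g * s)) ≡ i * (u * s * g)
      q₅ = solve-∀
      q₆ : ∀ i t f g → i * (t * f * g) ≡ t * (i * (f * g))
      q₆ = solve-∀

  factℤ : ℕ → ℤ
  factℤ n = + (n !)

  bin-fact : ∀ i j → bin (i ℕ.+ j) (+ i) * (factℤ i * factℤ j) ≡ factℤ (i ℕ.+ j)
  bin-fact zero j = trans (cong (_* (+ 1 * factℤ j)) (b₀ j)) (trans (*-identityˡ _) (*-identityˡ (factℤ j)))
    where
    b₀ : ∀ j → bin j (+ 0) ≡ + 1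
    b₀ zero = refl
    b₀ (suc j) = cong₂ _+_ (b₀ j) (bin-neg j 0)
  bin-fact (suc i) j =
    begin
      b * (factℤ (suc i) * factℤ j)                 ≡⟨ cong (λ z → b * (z * factℤ j)) (pos-* (suc i) (i !)) ⟩
      b * (+ suc i * factℤ i * factℤ j)             ≡⟨ q b (+ suc i) (factℤ i) (factℤ j) ⟩
      + suc i * b * (factℤ i * factℤ j)             ≡⟨ cong (_* (factℤ i * factℤ j)) (bin-absorb (i ℕ.+ j) (+ suc i)) ⟩
      + suc (i ℕ.+ j) * bin (i ℕ.+ j) (+ i) * (factℤ i * factℤ j) ≡⟨ *-assoc (+ suc (i ℕ.+ j)) (bin (i ℕ.+ j) (+ i)) _ ⟩
      + suc (i ℕ.+ j) * (bin (i ℕ.+ j) (+ i) * (factℤ i * factℤ j)) ≡⟨ cong (+ suc (i ℕ.+ j) *_) (bin-fact i j) ⟩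
      + suc (i ℕ.+ j) * factℤ (i ℕ.+ j)             ≡⟨ sym (pos-* (suc (i ℕ.+ j)) ((i ℕ.+ j) !)) ⟩
      factℤ (suc i ℕ.+ j)                           ∎
    where
    b : ℤ
    b = bin (suc i ℕ.+ j) (+ suc i)
    q : ∀ b s f g → b * (s * f * g) ≡ s * b * (f * g)
    q = solve-∀

  factℤ≢0 : ∀ n → factℤ n ≢ + 0
  factℤ≢0 n e = ℕ.≢-nonZero⁻¹ (n !) {{ℕₚ._!≢0 n}} (+-injective e)

  cancel : ∀ (x y d : ℤ) → d ≢ + 0 → x * d ≡ y * d → x ≡ y
  cancel x y d d≢0 = *-cancelʳ-≡ x y d {{ℤ.≢-nonZero d≢0}}

  mirror : ℤ → ℤ
  mirror r = -[1+ 0 ] - r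

  *-≢0 : ∀ {x y : ℤ} → x ≢ + 0 → y ≢ + 0 → x * y ≢ + 0
  *-≢0 {x} x≢0 y≢0 e with i*j≡0⇒i≡0∨j≡0 x e
  ... | inj₁ p = x≢0 p
  ... | inj₂ p = y≢0 p

  -- In terms of A = α + 1 and B = β + 1 the two binomials on the left contain 1/((A + n)! (B - 1 -
  -- n)!) and 1/((A - 1 - n)! (B + n)!). Regrouping the four factorials by A and by B gives the
  -- right side; for n > α or n > β a binomial vanishes on each side.
  mirror-pair : ∀ α β n → let l = suc (α ℕ.+ β) in
    factℤ (suc (α ℕ.+ α)) * factℤ (suc (β ℕ.+ β)) * (bin l (+ suc α + + n) * bin l (+ suc α + mirror (+ n))) ≡
    factℤ l * factℤ l * (halfBin α (+ n) * halfBin β (+ n))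
  mirror-pair α β n with n ℕ.≤? α | n ℕ.≤? β
  ... | no n≰α | _ =
    trans (cong (λ z → factℤ (suc (α ℕ.+ α)) * factℤ (suc (β ℕ.+ β)) * (bin l (+ suc α + + n) * z)) (b₁ n (ℕₚ.≰⇒> n≰α)))
   (trans (q₁ (factℤ (suc (α ℕ.+ α)) * factℤ (suc (β ℕ.+ β))) (bin l (+ suc α + + n)) (factℤ l * factℤ l) (halfBin β (+ n)))
          (cong (λ z → factℤ l * factℤ l * (z * halfBin β (+ n))) (sym (bin-big (suc (α ℕ.+ α)) (suc α ℕ.+ n) (ℕ.s≤s (ℕₚ.+-monoʳ-< α (ℕₚ.≰⇒> n≰α)))))))
    where
    l : ℕ
    l = suc (α ℕ.+ β)
    q₁ : ∀ x y z w → x * (y * + 0) ≡ z * (+ 0 * w)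
    q₁ = solve-∀
    b₁ : ∀ n → α ℕ.< n → bin l (+ suc α + mirror (+ n)) ≡ + 0
    b₁ (suc n) (ℕ.s≤s α≤n) with ℕₚ.m≤n⇒∃[o]m+o≡n α≤n
    ... | o , refl = trans (cong (bin l) (trans (cong (λ z → + suc α + (-[1+ 0 ] - (+ 1 + z))) (pos-+ α o)) (q (+ α) (+ o)))) (bin-neg l o)
      where
      q : ∀ a o → + 1 + a + (- + 1 - (+ 1 + (a + o))) ≡ - (+ 1 + o)
      q = solve-∀
  ... | yes _ | no n≰β =
    trans (cong (λ z → factℤ (suc (α ℕ.+ α)) * factℤ (suc (β ℕ.+ β)) * (z * bin l (+ suc α + mirror (+ n))))
                (bin-big l (suc α ℕ.+ n) (ℕ.s≤s (ℕₚ.+-monoʳ-< α (ℕₚ.≰⇒> n≰β)))))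
   (trans (q₁ (factℤ (suc (α ℕ.+ α)) * factℤ (suc (β ℕ.+ β))) (bin l (+ suc α + mirror (+ n))) (factℤ l * factℤ l) (halfBin α (+ n)))
          (cong (λ z → factℤ l * factℤ l * (halfBin α (+ n) * z)) (sym (bin-big (suc (β ℕ.+ β)) (suc β ℕ.+ n) (ℕ.s≤s (ℕₚ.+-monoʳ-< β (ℕₚ.≰⇒> n≰β)))))))
    where
    l : ℕ
    l = suc (α ℕ.+ β)
    q₁ : ∀ x y z w → x * (+ 0 * y) ≡ z * (w * + 0)
    q₁ = solve-∀
  ... | yes n≤α | yes n≤β with ℕₚ.m≤n⇒∃[o]m+o≡n n≤α | ℕₚ.m≤n⇒∃[o]m+o≡n n≤β
  ... | i , refl | j , refl = cancel _ _ (p * factℤ j * (factℤ i * q)) (*-≢0 (*-≢0 (factℤ≢0 (suc α ℕ.+ n)) (factℤ≢0 j)) (*-≢0 (factℤ≢0 i) (factℤ≢0 (suc β ℕ.+ n))))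
      (trans (r₁ (factℤ (suc (α ℕ.+ α))) (factℤ (suc (β ℕ.+ β))) (bin l (+ suc α + + n)) (bin l (+ suc α + mirror (+ n))) p (factℤ j) (factℤ i) q)
      (trans (cong₂ (λ x y → factℤ (suc (α ℕ.+ α)) * factℤ (suc (β ℕ.+ β)) * (x * y)) e₁ e₂)
      (trans (cong₂ (λ x y → x * y * (factℤ l * factℤ l)) (sym e₃) (sym e₄))
             (r₂ (factℤ l * factℤ l) (halfBin α (+ n)) (halfBin β (+ n)) p (factℤ j) (factℤ i) q))))
    where
    l : ℕ
    l = suc (α ℕ.+ β)
    p q : ℤ
    p = factℤ (suc α ℕ.+ n)
    q = factℤ (suc β ℕ.+ n)
    r₁ : ∀ a b x y p j i q → a * b * (x * y) * (p * j * (i * q)) ≡ a * b * ((x * (p * j)) * (y * (i * q)))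
    r₁ = solve-∀
    r₂ : ∀ l f g p j i q → (f * (p * i)) * (g * (q * j)) * l ≡ l * (f * g) * (p * j * (i * q))
    r₂ = solve-∀
    by : ∀ l′ i′ j′ {t} → l′ ≡ i′ ℕ.+ j′ → t ≡ + i′ → bin l′ t * (factℤ i′ * factℤ j′) ≡ factℤ l′
    by l′ i′ j′ refl refl = bin-fact i′ j′
    e₁ : bin l (+ suc α + + n) * (p * factℤ j) ≡ factℤ l
    e₁ = by l (suc α ℕ.+ n) j (cong suc (sym (ℕₚ.+-assoc α n j))) refl
    e₂ : bin l (+ suc α + mirror (+ n)) * (factℤ i * q) ≡ factℤ l
    e₂ = by l i (suc β ℕ.+ n) (trans (cong suc (trans (cong (ℕ._+ β) (ℕₚ.+-comm n i)) (trans (ℕₚ.+-assoc i n β) (cong (i ℕ.+_) (ℕₚ.+-comm n β))))) (sym (ℕₚ.+-suc i (β ℕ.+ n))))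
      (trans (cong (λ z → + 1 + z + mirror (+ n)) (pos-+ n i)) (z (+ n) (+ i)))
      where
      z : ∀ n i → + 1 + (n + i) + (- + 1 - n) ≡ i
      z = solve-∀
    dbl : ∀ n i → suc ((n ℕ.+ i) ℕ.+ (n ℕ.+ i)) ≡ suc (n ℕ.+ i) ℕ.+ n ℕ.+ i
    dbl n i = cong suc (sym (ℕₚ.+-assoc (n ℕ.+ i) n i))
    e₃ : halfBin α (+ n) * (p * factℤ i) ≡ factℤ (suc (α ℕ.+ α))
    e₃ = by (suc (α ℕ.+ α)) (suc α ℕ.+ n) i (dbl n i) refl
    e₄ : halfBin β (+ n) * (q * factℤ j) ≡ factℤ (suc (β ℕ.+ β))
    e₄ = by (suc (β ℕ.+ β)) (suc β ℕ.+ n) j (dbl n j) refl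

-- Counting nonintersecting walks from a given configuration

module Configurations where
  open import Data.Integer using (_+_; _-_; _*_; -_; _^_; _<_; _≤_)
  open Alternants
  open Weights
  open TupleSums
  open Evaluation

  all-or-any : ∀ {A : Set} {P Q : A → Set} → (∀ a → P a ⊎ Q a) → ∀ as → All P as ⊎ Any Q as
  all-or-any f [] = inj₁ []
  all-or-any f (a ∷ as) with f a | all-or-any f as
  ... | inj₂ q | _ = inj₂ (here q)
  ... | inj₁ _ | inj₂ q = inj₂ (there q)
  ... | inj₁ p | inj₁ ps = inj₁ (p ∷ ps)

  strict-head : ∀ {t ts} → Strict (t ∷ ts) → All (_< t) ts
  strict-head [-] = []
  strict-head (u<t ∷ s) = u<t ∷ All.map (λ v<u → <-trans v<u u<t) (strict-head s)

  strict-tail : ∀ {t ts} → Strict (t ∷ ts) → Strict ts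
  strict-tail [-] = []
  strict-tail (_ ∷ s) = s

  strict-cons : ∀ {t ts} → All (_< t) ts → Strict ts → Strict (t ∷ ts)
  strict-cons [] _ = [-]
  strict-cons (p ∷ _) s = p ∷ s

  strict-snoc : ∀ {t ts} → All (t <_) ts → Strict ts → Strict (ts ++ [ t ])
  strict-snoc [] _ = [-]
  strict-snoc (p ∷ []) _ = p ∷ [-]
  strict-snoc (_ ∷ q ∷ ps) (lt ∷ s) = lt ∷ strict-snoc (q ∷ ps) s

  strict-init : ∀ {t} ts → Strict (ts ++ [ t ]) → Strict ts
  strict-init [] _ = []
  strict-init (_ ∷ []) _ = [-]
  strict-init (_ ∷ u ∷ ts) (lt ∷ s) = lt ∷ strict-init (u ∷ ts) s

  desc : ℤ → ℕ → List ℤ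
  desc s zero = []
  desc s (suc x) = s + + x ∷ desc s x

  length-desc : ∀ s x → length (desc s x) ≡ x
  length-desc s zero = refl
  length-desc s (suc x) = cong suc (length-desc s x)

  Between : ℤ → ℕ → ℤ → Set
  Between s x t = s ≤ t × t < s + + x

  +suc-assoc : ∀ s x → s + + suc x ≡ s + + x + + 1
  +suc-assoc s x = trans (cong (λ z → s + z) (+suc x)) (sym (+-assoc s (+ x) (+ 1)))

  <-suc : ∀ s x → s + + x < s + + suc x
  <-suc s x = +1≤⇒< (≤-reflexive (sym (+suc-assoc s x)))

  <suc⇒≤ : ∀ {s x t} → t < s + + suc x → t ≤ s + + x
  <suc⇒≤ {s} {x} {t} p = lin (<⇒+1≤ p) (trans (e s (+ x) t) (cong (_- (t + + 1)) (sym (+suc-assoc s x))))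
    where
    e : ∀ s x t → s + x - t ≡ s + x + + 1 - (t + + 1)
    e = solve-∀

  desc-between : ∀ s x → All (Between s x) (desc s x)
  desc-between s zero = []
  desc-between s (suc x) =
    (subst (_≤ s + + x) (+-identityʳ s) (+-monoʳ-≤ s (ℤ.+≤+ ℕ.z≤n)) , <-suc s x) ∷
    All.map (λ (p , q) → p , <-trans q (<-suc s x)) (desc-between s x)

  desc-strict : ∀ s x → Strict (desc s x)
  desc-strict s zero = []
  desc-strict s (suc x) = strict-cons (All.map proj₂ (desc-between s x)) (desc-strict s x)

  -- Pigeonhole: x strictly decreasing integers in an interval of x integers must fill it.
  desc-unique : ∀ s x ts → length ts ≡ x → Strict ts → All (Between s x) ts → ts ≡ desc s x
  desc-unique s zero [] _ _ _ = refl
  desc-unique s (suc x) (t ∷ ts) len st ((s≤t , t<) ∷ bs) = cong₂ _∷_ (≤-antisym (<suc⇒≤ {s} {x} t<) (t≥ x rest)) rest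
    where
    rest : ts ≡ desc s x
    rest = desc-unique s x ts (ℕₚ.suc-injective len) (strict-tail st)
      (All.zipWith (λ ((p , _) , q) → p , <-≤-trans q (<suc⇒≤ {s} {x} t<)) (bs , strict-head st))
    t≥ : ∀ x → ts ≡ desc s x → s + + x ≤ t
    t≥ zero _ = subst (_≤ t) (sym (+-identityʳ s)) s≤t
    t≥ (suc x) e = subst (_≤ t) (sym (+suc-assoc s x))
      (<⇒+1≤ (All.head (strict-head (subst (λ us → Strict (t ∷ us)) e st))))

  alt-≢0 : ∀ {h : ℤ → ℤ} ts → Strict ts → All (λ t → h t ≢ + 0) ts → alt id h ts ≢ + 0
  alt-≢0 [] _ _ ()
  alt-≢0 {h} (t ∷ ts) st (p ∷ ps) = *-≢0 (*-≢0 p (dd ts (strict-head st))) (alt-≢0 ts (strict-tail st) ps)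
    where
    dd : ∀ us → All (_< t) us → diffs id h t us ≢ + 0
    dd [] [] ()
    dd (u ∷ us) (lt ∷ lts) = *-≢0 (λ e → <-irrefl (sym (i-j≡0⇒i≡j t u e)) lt) (dd us lts)

  module Walks (A : ℤ) (x : ℕ) where

    top : List ℤ
    top = desc (- A) x

    _≟ᴸ_ : (S T : List ℤ) → Dec (S ≡ T)
    _≟ᴸ_ = ≡-dec _≟_

    walks# : ℕ → List ℤ → ℤ
    walks# zero T = if does (T ≟ᴸ top) then + 1 else + 0
    walks# (suc n) T = ind T * steps pre (walks# n) T

    size : ℕ → ℕ
    size n = n ℕ.+ ℕ.pred x

    -- For x > 0 the support consists of the n + x positions from which n steps, each staying or
    -- moving down by one, can end in `top`.
    wt : ℕ → ℤ → ℤ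
    wt n t = bin (size n) (A + t)

    -- Accumulated factors of the two sides of `steps-row`; they keep the product formula for walk
    -- counts in ℤ, and `κ≢0` allows division afterwards.
    κ μ : ℕ → ℤ
    κ zero = alt id (wt 0) top
    κ (suc n) = (+ suc (size n)) ^ x * κ n
    μ zero = + 1
    μ (suc n) = ∏< x (λ j → + suc (size n) - + j) * μ n

    fits : 0 ℕ.< x → ∀ n t → Between (- A) (n ℕ.+ x) t ⊎ wt n t ≡ + 0
    fits 0<x n t with A + t in eq
    ... | -[1+ i ] = inj₂ (bin-neg (size n) i)
    ... | + i with i ℕ.<? n ℕ.+ x
    ... | no i≮ = inj₂ (bin-big (size n) i (ℕₚ.<-≤-trans size< (ℕₚ.≮⇒≥ i≮)))
      where
      size< : size n ℕ.< n ℕ.+ x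
      size< = ℕₚ.+-monoʳ-< n (ℕₚ.≤-reflexive (ℕₚ.suc-pred x {{ℕ.>-nonZero 0<x}}))
    ... | yes i< = inj₁ (subst (- A ≤_) at (subst (_≤ - A + + i) (+-identityʳ (- A)) (+-monoʳ-≤ (- A) (ℤ.+≤+ ℕ.z≤n))) ,
                         subst (_< - A + + (n ℕ.+ x)) at (+-monoʳ-< (- A) (ℤ.+<+ i<)))
      where
      e : ∀ A t → - A + (A + t) ≡ t
      e = solve-∀
      at : - A + + i ≡ t
      at = trans (cong (λ z → - A + z) (sym eq)) (e A t)

    private
      -- The weight at level 0 is supported on exactly x positions, so a strict configuration of
      -- nonzero weight must be `top` by `desc-unique`.
      off-top : ∀ T → length T ≡ x → T ≢ top → ind T * alt id (wt 0) T ≡ + 0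
      off-top [] refl T≢top = ⊥-elim (T≢top refl)
      off-top T@(_ ∷ _) len T≢top with all-or-any (fits (subst (0 ℕ.<_) len (ℕ.s≤s ℕ.z≤n)) 0) T
      ... | inj₂ any = trans (cong (ind T *_) (alt-zero id (wt 0) any)) (*-zeroʳ (ind T))
      ... | inj₁ all = cong (_* alt id (wt 0) T) (ind-no λ st → T≢top (desc-unique (- A) x T len st all))

      walks#-base : ∀ T → length T ≡ x → κ 0 * walks# 0 T ≡ + 1 * (ind T * alt id (wt 0) T)
      walks#-base T len with T ≟ᴸ top
      ... | yes refl = trans (*-comm (alt id (wt 0) top) (+ 1)) (cong (+ 1 *_)
              (sym (trans (cong (_* alt id (wt 0) top) (ind-yes (desc-strict (- A) x))) (*-identityˡ _))))
      ... | no T≢top = trans (*-zeroʳ (κ 0)) (cong (+ 1 *_) (sym (off-top T len T≢top)))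

    -- This takes the place of a Lindström-Gessel-Viennot determinant. One row is peeled off at a
    -- time: `ind-steps` discards the inner indicator, and `steps-row` evaluates the operator on the
    -- alternant.
    walks#-alt : ∀ n T → length T ≡ x → κ n * walks# n T ≡ μ n * (ind T * alt id (wt n) T)
    walks#-alt zero T len = walks#-base T len
    walks#-alt (suc n) T len =
      begin
        s * κ n * (ind T * steps pre (walks# n) T)
      ≡⟨ q₁ s (κ n) (ind T) (steps pre (walks# n) T) ⟩
        s * (ind T * (κ n * steps pre (walks# n) T))
      ≡⟨ cong (λ z → s * (ind T * z)) (trans (sym (steps-scale pre (κ n) (walks# n) T))
           (trans (steps-cong pre T λ us e → walks#-alt n us (trans e len))
                  (steps-scale pre (μ n) (λ us → ind us * alt id (wt n) us) T))) ⟩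
        s * (ind T * (μ n * steps pre (λ us → ind us * alt id (wt n) us) T))
      ≡⟨ q₂ s (ind T) (μ n) (steps pre (λ us → ind us * alt id (wt n) us) T) ⟩
        s * μ n * (ind T * steps pre (λ us → ind us * alt id (wt n) us) T)
      ≡⟨ cong (s * μ n *_) (ind-steps pre-ordered id (wt n) T) ⟩
        s * μ n * (ind T * steps pre (alt id (wt n)) T)
      ≡⟨ q₃ s (μ n) (ind T) (steps pre (alt id (wt n)) T) ⟩
        μ n * ind T * (s * steps pre (alt id (wt n)) T)
      ≡⟨ cong (μ n * ind T *_) (Row.steps-row (size n) A x T len) ⟩
        μ n * ind T * (c * alt id (wt (suc n)) T)
      ≡⟨ q₄ (μ n) (ind T) c (alt id (wt (suc n)) T) ⟩
        c * μ n * (ind T * alt id (wt (suc n)) T)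
      ∎
      where
      s c : ℤ
      s = (+ suc (size n)) ^ x
      c = ∏< x (λ j → + suc (size n) - + j)
      q₁ : ∀ s k i w → s * k * (i * w) ≡ s * (i * (k * w))
      q₁ = solve-∀
      q₂ : ∀ s i m w → s * (i * (m * w)) ≡ s * m * (i * w)
      q₂ = solve-∀
      q₃ : ∀ s m i w → s * m * (i * w) ≡ m * i * (s * w)
      q₃ = solve-∀
      q₄ : ∀ m i c w → m * i * (c * w) ≡ c * m * (i * w)
      q₄ = solve-∀

    ^-≢0 : ∀ n m → (+ suc n) ^ m ≢ + 0
    ^-≢0 n zero ()
    ^-≢0 n (suc m) = *-≢0 {+ suc n} (λ ()) (^-≢0 n m)

    κ≢0 : ∀ n → κ n ≢ + 0
    κ≢0 zero = alt-≢0 top (desc-strict (- A) x) (go x (desc-between (- A) x))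
      where
      go : ∀ y {ts} → All (Between (- A) y) ts → All (λ t → bin (ℕ.pred y) (A + t) ≢ + 0) ts
      go y [] = []
      go y {t ∷ _} ((p , q) ∷ ps) = ne ∷ go y ps
        where
        e₁ : ∀ A t → A + t - + 0 ≡ t - - A
        e₁ = solve-∀
        e₂ : ∀ A t y → y - (A + t + + 1) ≡ - A + y - (t + + 1)
        e₂ = solve-∀
        lo : + 0 ≤ A + t
        lo = lin p (e₁ A t)
        hi : A + t < + y
        hi = +1≤⇒< (lin (<⇒+1≤ q) (e₂ A t (+ y)))
        ne : bin (ℕ.pred y) (A + t) ≢ + 0
        ne with A + t | lo | hi
        ... | + n | _ | ℤ.+<+ n<y = λ e → <-irrefl (sym e) (bin-pos (ℕ.pred y) n (ℕₚ.<⇒≤pred n<y))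
    κ≢0 (suc n) = *-≢0 (^-≢0 (size n) x) (κ≢0 n)

  block : ℕ → List ℤ
  block zero = []
  block (suc k) = block k ++ [ -[1+ k ] ]

  -- The starting configuration r₁ > … > r_m, -1, …, -k, -1 - r_m, …, -1 - r₁ on the horizontal through the centre.
  symm : ℕ → List ℤ → List ℤ
  symm k [] = block k
  symm k (r ∷ rs) = r ∷ symm k rs ++ [ mirror r ]

  length-snoc : ∀ (ts : List ℤ) t → length (ts ++ [ t ]) ≡ suc (length ts)
  length-snoc ts t = trans (length-++ ts) (ℕₚ.+-comm (length ts) 1)

  length-block : ∀ k → length (block k) ≡ k
  length-block zero = refl
  length-block (suc k) = trans (length-snoc (block k) -[1+ k ]) (cong suc (length-block k))

  length-symm : ∀ k rs → length (symm k rs) ≡ k ℕ.+ (length rs ℕ.+ length rs)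
  length-symm k [] = trans (length-block k) (sym (ℕₚ.+-identityʳ k))
  length-symm k (r ∷ rs) =
    trans (cong suc (trans (length-snoc (symm k rs) (mirror r)) (cong suc (length-symm k rs))))
          (trans (cong suc (sym (ℕₚ.+-suc k _))) (trans (sym (ℕₚ.+-suc k _)) (cong (λ n → k ℕ.+ suc n) (sym (ℕₚ.+-suc (length rs) (length rs))))))

  module _ (h : ℤ → ℤ) where

    ends : ℤ → List ℤ → ℤ
    ends v [] = + 1
    ends v (u ∷ us) = (u - v) * ends v us

    diffs-snoc : ∀ c us v → diffs id h c (us ++ [ v ]) ≡ diffs id h c us * (c - v)
    diffs-snoc c [] v = *-comm (c - v) (+ 1)
    diffs-snoc c (u ∷ us) v = trans (cong ((c - u) *_) (diffs-snoc c us v)) (sym (*-assoc (c - u) (diffs id h c us) (c - v)))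

    ends-snoc : ∀ c us v → ends c (us ++ [ v ]) ≡ ends c us * (v - c)
    ends-snoc c [] v = *-comm (v - c) (+ 1)
    ends-snoc c (u ∷ us) v = trans (cong ((u - c) *_) (ends-snoc c us v)) (sym (*-assoc (u - c) (ends c us) (v - c)))

    alt-snoc : ∀ us v → alt id h (us ++ [ v ]) ≡ alt id h us * ends v us * h v
    alt-snoc [] v = e (h v)
      where
      e : ∀ x → x * + 1 * + 1 ≡ + 1 * + 1 * x
      e = solve-∀
    alt-snoc (u ∷ us) v =
      trans (cong₂ (λ p q → h u * p * q) (diffs-snoc u us v) (alt-snoc us v))
            (e (h u) (diffs id h u us) (u - v) (alt id h us) (ends v us) (h v))
      where
      e : ∀ x d w a s y → x * (d * w) * (a * s * y) ≡ x * d * a * (w * s) * y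
      e = solve-∀

    module _ (k : ℕ) where
      open HalfStep k

      cross : ℤ → List ℤ → ℤ
      cross r us = diffs id h r us * ends (mirror r) us

      cross-snoc : ∀ r us v → cross r (us ++ [ v ]) ≡ cross r us * ((r - v) * (v - mirror r))
      cross-snoc r us v =
        trans (cong₂ _*_ (diffs-snoc r us v) (ends-snoc (mirror r) us v))
              (e (diffs id h r us) (r - v) (ends (mirror r) us) (v - mirror r))
        where
        e : ∀ d x s y → d * x * (s * y) ≡ d * s * (x * y)
        e = solve-∀

      -- The origin of `core`: seen from r and from its mirror image, the block position -1 - j
      -- contributes (r + j + 1)(r - j).
      cross-block : ∀ r → cross r (block k) ≡ core r
      cross-block r = go k
        where
        e : ∀ r j → (r - - (+ 1 + j)) * (- (+ 1 + j) - (- + 1 - r)) ≡ (r - j) * (r + j + + 1)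
        e = solve-∀
        go : ∀ k → cross r (block k) ≡ ∏< k (λ j → (r - + j) * (r + + j + + 1))
        go zero = refl
        go (suc k) = trans (cross-snoc r (block k) -[1+ k ]) (cong₂ _*_ (go k) (e r (+ k)))

      -- The four differences between the pairs r, -1 - r and s, -1 - s multiply to the square of (r
      -- - s)(r + s + 1) = X r - X s. This is where the squared Vandermonde product comes from.
      cross-symm : ∀ (f : ℤ → ℤ) r rs → cross r (symm k rs) ≡ core r * (diffs X f (X r) rs * diffs X f (X r) rs)
      cross-symm f r [] = trans (cross-block r) (sym (*-identityʳ (core r)))
      cross-symm f r (s ∷ rs) =
        begin
          (r - s) * diffs id h r (symm k rs ++ [ mirror s ]) * ((s - mirror r) * ends (mirror r) (symm k rs ++ [ mirror s ]))
        ≡⟨ q₁ (r - s) (diffs id h r (symm k rs ++ [ mirror s ])) (s - mirror r) (ends (mirror r) (symm k rs ++ [ mirror s ])) ⟩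
          (r - s) * (s - mirror r) * cross r (symm k rs ++ [ mirror s ])
        ≡⟨ cong ((r - s) * (s - mirror r) *_) (trans (cross-snoc r (symm k rs) (mirror s)) (cong (_* ((r - mirror s) * (mirror s - mirror r))) (cross-symm f r rs))) ⟩
          (r - s) * (s - mirror r) * (core r * (d * d) * ((r - mirror s) * (mirror s - mirror r)))
        ≡⟨ q₂ r s (core r) d ⟩
          core r * ((X r - X s) * d * ((X r - X s) * d))
        ∎
        where
        d : ℤ
        d = diffs X f (X r) rs
        q₁ : ∀ a b c e → a * b * (c * e) ≡ a * c * (b * e)
        q₁ = solve-∀
        q₂ : ∀ r s c d → (r - s) * (s - (- + 1 - r)) * (c * (d * d) * ((r - (- + 1 - s)) * (- + 1 - s - (- + 1 - r)))) ≡
          c * ((r * (r + + 1) - s * (s + + 1)) * d * ((r * (r + + 1) - s * (s + + 1)) * d))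
        q₂ = solve-∀

      -- A pair contributes 2 r + 1 from its own difference, `core r` from the block and squared
      -- differences from the inner pairs. The square is divided between the alternants of `f` and
      -- `g`; c and c′ carry the denominators of the pairwise regrouping of weights.
      alt-symm : ∀ (f g : ℤ → ℤ) c c′ rs →
        All (λ r → c * (h r * h (mirror r)) ≡ c′ * (f r * g r)) rs →
        c ^ length rs * alt id h (symm k rs) ≡
        c′ ^ length rs * (alt id h (block k) * (alt X f rs * alt X (λ r → (+ 2 * r + + 1) * core r * g r) rs))
      alt-symm f g c c′ [] [] = cong (+ 1 *_) (sym (*-identityʳ (alt id h (block k))))
      alt-symm f g c c′ (r ∷ rs) (e ∷ es) =
        begin
          c * C * (h r * diffs id h r (symm k rs ++ [ mirror r ]) * alt id h (symm k rs ++ [ mirror r ]))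
        ≡⟨ cong₂ (λ p q → c * C * (h r * p * q)) (diffs-snoc r (symm k rs) (mirror r)) (alt-snoc (symm k rs) (mirror r)) ⟩
          c * C * (h r * (diffs id h r (symm k rs) * (r - mirror r)) * (alt id h (symm k rs) * ends (mirror r) (symm k rs) * h (mirror r)))
        ≡⟨ q₁ c C (h r) (diffs id h r (symm k rs)) r (alt id h (symm k rs)) (ends (mirror r) (symm k rs)) (h (mirror r)) ⟩
          c * (h r * h (mirror r)) * ((+ 2 * r + + 1) * cross r (symm k rs)) * (C * alt id h (symm k rs))
        ≡⟨ cong (λ z → c * (h r * h (mirror r)) * ((+ 2 * r + + 1) * z) * (C * alt id h (symm k rs))) (cross-symm f r rs) ⟩
          c * (h r * h (mirror r)) * ((+ 2 * r + + 1) * (core r * (d * d))) * (C * alt id h (symm k rs))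
        ≡⟨ cong₂ (λ p q → p * ((+ 2 * r + + 1) * (core r * (d * d))) * q) e (alt-symm f g c c′ rs es) ⟩
          c′ * (f r * g r) * ((+ 2 * r + + 1) * (core r * (d * d))) * (C′ * (B * (alt X f rs * alt X g′ rs)))
        ≡⟨ q₂ c′ (f r) (g r) r (core r) d C′ B (alt X f rs) (alt X g′ rs) ⟩
          c′ * C′ * (B * (f r * d * alt X f rs * (g′ r * d * alt X g′ rs)))
        ≡⟨ cong (λ z → c′ * C′ * (B * (f r * d * alt X f rs * (g′ r * z * alt X g′ rs)))) (dd rs) ⟩
          c′ * C′ * (B * (f r * d * alt X f rs * (g′ r * diffs X g′ (X r) rs * alt X g′ rs)))
        ∎
        where
        g′ : ℤ → ℤ
        g′ r = (+ 2 * r + + 1) * core r * g r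
        d C C′ B : ℤ
        d = diffs X f (X r) rs
        C = c ^ length rs
        C′ = c′ ^ length rs
        B = alt id h (block k)
        dd : ∀ us → diffs X f (X r) us ≡ diffs X g′ (X r) us
        dd [] = refl
        dd (u ∷ us) = cong ((X r - X u) *_) (dd us)
        q₁ : ∀ c C h d r a s h′ → c * C * (h * (d * (r - (- + 1 - r))) * (a * s * h′)) ≡ c * (h * h′) * ((+ 2 * r + + 1) * (d * s)) * (C * a)
        q₁ = solve-∀
        q₂ : ∀ c f g r o d C B x y → c * (f * g) * ((+ 2 * r + + 1) * (o * (d * d))) * (C * (B * (x * y))) ≡
          c * C * (B * (f * d * x * ((+ 2 * r + + 1) * o * g * d * y)))
        q₂ = solve-∀

-- Summing over symmetric starting configurations, and the exchange relation

module Totals where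
  open import Data.Integer using (_+_; _-_; _*_; -_; _^_; _<_; _≤_)
  open Alternants
  open Weights
  open TupleSums
  open Evaluation
  open Configurations

  ^-* : ∀ x y m → (x * y) ^ m ≡ x ^ m * y ^ m
  ^-* x y zero = refl
  ^-* x y (suc m) = trans (cong (x * y *_) (^-* x y m)) (q x y (x ^ m) (y ^ m))
    where
    q : ∀ x y p r → x * y * (p * r) ≡ x * p * (y * r)
    q = solve-∀

  ∏<-zero : ∀ {n k} f → n ℕ.< k → f n ≡ + 0 → ∏< k f ≡ + 0
  ∏<-zero {n} {suc k} f (ℕ.s≤s n≤k) e with ℕₚ.m≤n⇒m<n∨m≡n n≤k
  ... | inj₁ n<k = cong (_* f k) (∏<-zero f n<k e)
  ... | inj₂ refl = trans (cong (∏< k f *_) e) (*-zeroʳ (∏< k f))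

  ∏<-cong : ∀ k {f g : ℕ → ℤ} → (∀ j → f j ≡ g j) → ∏< k f ≡ ∏< k g
  ∏<-cong zero e = refl
  ∏<-cong (suc k) e = cong₂ _*_ (∏<-cong k e) (e k)

  factℤ-suc : ∀ n → factℤ (suc n) ≡ + suc n * factℤ n
  factℤ-suc n = pos-* (suc n) (n !)

  falling : ∀ m {c N} → N ≡ m ℕ.+ c → ∏< m (λ j → + N - + j) * factℤ c ≡ factℤ N
  falling zero refl = *-identityˡ _
  falling (suc m) {c} {N} e =
    trans (*-assoc (∏< m (λ j → + N - + j)) (+ N - + m) (factℤ c))
   (trans (cong (λ z → ∏< m (λ j → + N - + j) * (z * factℤ c)) last)
   (trans (cong (∏< m (λ j → + N - + j) *_) (sym (factℤ-suc c))) (falling m (trans e (sym (ℕₚ.+-suc m c))))))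
    where
    q : ∀ m c → + 1 + (m + c) - m ≡ + 1 + c
    q = solve-∀
    last : + N - + m ≡ + suc c
    last = trans (cong (λ z → + z - + m) e) (trans (cong (λ z → + 1 + z - + m) (pos-+ m c)) (q (+ m) (+ c)))

  rising : ∀ k N → ∏< k (λ j → + suc N + + j) * factℤ N ≡ factℤ (N ℕ.+ k)
  rising zero N = trans (*-identityˡ _) (cong factℤ (sym (ℕₚ.+-identityʳ N)))
  rising (suc k) N =
    trans (q (∏< k (λ j → + suc N + + j)) (+ suc (N ℕ.+ k)) (factℤ N))
   (trans (cong (+ suc (N ℕ.+ k) *_) (rising k N))
   (trans (sym (factℤ-suc (N ℕ.+ k))) (cong factℤ (sym (ℕₚ.+-suc N k)))))
    where
    q : ∀ p s f → p * s * f ≡ s * (p * f)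
    q = solve-∀

  Πᴸ : (ℤ → ℤ) → List ℤ → ℤ
  Πᴸ g [] = + 1
  Πᴸ g (t ∷ ts) = g t * Πᴸ g ts

  Πᴸ-++ : ∀ g ts us → Πᴸ g (ts ++ us) ≡ Πᴸ g ts * Πᴸ g us
  Πᴸ-++ g [] us = sym (*-identityˡ _)
  Πᴸ-++ g (t ∷ ts) us = trans (cong (g t *_) (Πᴸ-++ g ts us)) (sym (*-assoc (g t) (Πᴸ g ts) (Πᴸ g us)))

  alt-weights : ∀ (h g h′ g′ : ℤ → ℤ) → (∀ t → h t * g t ≡ h′ t * g′ t) → ∀ ts →
    alt id h ts * Πᴸ g ts ≡ alt id h′ ts * Πᴸ g′ ts
  alt-weights h g h′ g′ e [] = refl
  alt-weights h g h′ g′ e (t ∷ ts) =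
    trans (q (h t) (diffs id h t ts) (alt id h ts) (g t) (Πᴸ g ts))
   (trans (cong₂ _*_ (cong₂ _*_ (e t) (dd ts)) (alt-weights h g h′ g′ e ts))
          (sym (q (h′ t) (diffs id h′ t ts) (alt id h′ ts) (g′ t) (Πᴸ g′ ts))))
    where
    q : ∀ h d a g p → h * d * a * (g * p) ≡ h * g * d * (a * p)
    q = solve-∀
    dd : ∀ us → diffs id h t us ≡ diffs id h′ t us
    dd [] = refl
    dd (u ∷ us) = cong ((t - u) *_) (dd us)

  Πᴸ-block : ∀ g k → Πᴸ g (block k) ≡ ∏< k (λ j → g -[1+ j ])
  Πᴸ-block g zero = refl
  Πᴸ-block g (suc k) = trans (Πᴸ-++ g (block k) _) (cong₂ _*_ (Πᴸ-block g k) (*-identityʳ (g -[1+ k ])))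

  symm-strict⁻ : ∀ k rs → Strict (symm k rs) → Strict rs
  symm-strict⁻ k [] _ = []
  symm-strict⁻ k (r ∷ []) _ = [-]
  symm-strict⁻ k (r ∷ s ∷ rs) (lt ∷ st) = lt ∷ symm-strict⁻ k (s ∷ rs) (strict-init (symm k (s ∷ rs)) st)

  block-bounds : ∀ k → All (λ t → - + k ≤ t × t < + 0) (block k)
  block-bounds zero = []
  block-bounds (suc k) = Allₚ.++⁺
    (All.map (λ (p , q) → ≤-trans (lin (ℤ.+≤+ (ℕ.z≤n {1})) (e (+ k))) p , q) (block-bounds k))
    ((≤-refl , ℤ.-<+) ∷ [])
    where
    e : ∀ k → - k - - (+ 1 + k) ≡ + 1 - + 0
    e = solve-∀

  block-strict : ∀ k → Strict (block k)
  block-strict zero = []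
  block-strict (suc k) = strict-snoc (All.map (λ (p , _) → <-≤-trans (+1≤⇒< (≤-reflexive (e (+ k)))) p) (block-bounds k)) (block-strict k)
    where
    e : ∀ k → - (+ 1 + k) + + 1 ≡ - k
    e = solve-∀

  mirror-< : ∀ {s r} → s < r → mirror r < mirror s
  mirror-< {s} {r} lt = +1≤⇒< (lin (<⇒+1≤ lt) (e s r))
    where
    e : ∀ s r → - + 1 - s - (- + 1 - r + + 1) ≡ r - (s + + 1)
    e = solve-∀

  mirror-neg : ∀ {r} → + 0 ≤ r → mirror r < + 0
  mirror-neg {r} 0≤r = +1≤⇒< (lin 0≤r (e r))
    where
    e : ∀ r → + 0 - (- + 1 - r + + 1) ≡ r - + 0
    e = solve-∀

  0≤+ : ∀ {k r} → + k ≤ r → + 0 ≤ r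
  0≤+ = ≤-trans (ℤ.+≤+ ℕ.z≤n)

  symm-between : ∀ k b rs → + k ≤ b → All (λ r → + k ≤ r × r < b) rs → All (λ t → mirror b < t × t < b) (symm k rs)
  symm-between k b [] k≤b _ = All.map (λ (p , q) → <-≤-trans (+1≤⇒< (lin k≤b (e b (+ k)))) p , <-≤-trans q (0≤+ k≤b)) (block-bounds k)
    where
    e : ∀ b k → - k - (- + 1 - b + + 1) ≡ b - k
    e = solve-∀
  symm-between k b (r ∷ rs) k≤b ((k≤r , r<b) ∷ ps) =
    (<-≤-trans (mirror-neg (0≤+ k≤b)) (0≤+ k≤r) , r<b) ∷
    Allₚ.++⁺ (symm-between k b rs k≤b ps) ((mirror-< r<b , <-≤-trans (mirror-neg (0≤+ k≤r)) (0≤+ k≤b)) ∷ [])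

  symm-strict : ∀ k rs → All (λ r → + k ≤ r) rs → Strict rs → Strict (symm k rs)
  symm-strict k [] _ _ = block-strict k
  symm-strict k (r ∷ rs) (k≤r ∷ ps) st =
    strict-cons (Allₚ.++⁺ (All.map proj₂ between) (<-≤-trans (mirror-neg (0≤+ k≤r)) (0≤+ k≤r) ∷ []))
      (strict-snoc (All.map proj₁ between) (symm-strict k rs ps (strict-tail st)))
    where
    between : All (λ t → mirror r < t × t < r) (symm k rs)
    between = symm-between k r rs k≤r (All.zip (ps , strict-head st))

  InRange : ℕ → ℤ → Set
  InRange M t = ∃ λ n → t ≡ + n × n ℕ.< M

  ^≢0 : ∀ {x} m → x ≢ + 0 → x ^ m ≢ + 0
  ^≢0 zero _ ()
  ^≢0 (suc m) x≢0 = *-≢0 x≢0 (^≢0 m x≢0)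

  *-cancel-0 : ∀ {c x} → c ≢ + 0 → c * x ≡ + 0 → x ≡ + 0
  *-cancel-0 {c} c≢0 e with i*j≡0⇒i≡0∨j≡0 c e
  ... | inj₁ p = ⊥-elim (c≢0 p)
  ... | inj₂ p = p

  -- Configurations on the axis and their path counts, for A = α + 1, B = β + 1 and A + B = n + x.
  module Axis (k m n α β : ℕ) (size≡ : n ℕ.+ ℕ.pred (k ℕ.+ (m ℕ.+ m)) ≡ suc (α ℕ.+ β)) where
    open Walks (+ suc α) (k ℕ.+ (m ℕ.+ m)) public
    open HalfStep k

    c₁ c₂ b : ℤ
    c₁ = factℤ (suc (α ℕ.+ α)) * factℤ (suc (β ℕ.+ β))
    c₂ = factℤ (suc (α ℕ.+ β)) * factℤ (suc (α ℕ.+ β))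
    b = alt id (wt n) (block k)

    F Fc : ℤ → ℤ
    F = halfBin α
    Fc = Pairing.Fc k m 0 β

    alt-axis : ∀ {M} rs → All (InRange M) rs →
      c₁ ^ length rs * alt id (wt n) (symm k rs) ≡ c₂ ^ length rs * (b * (alt X F rs * alt X Fc rs))
    alt-axis rs ps = alt-symm (wt n) k F (halfBin β) c₁ c₂ rs (All.map pair ps)
      where
      pair : ∀ {M r} → InRange M r → c₁ * (wt n r * wt n (mirror r)) ≡ c₂ * (F r * halfBin β r)
      pair (i , refl , _) =
        trans (cong (λ l → c₁ * (bin l (+ suc α + + i) * bin l (+ suc α + mirror (+ i)))) size≡) (mirror-pair α β i)

    c₁≢0 : c₁ ≢ + 0
    c₁≢0 = *-≢0 (factℤ≢0 (suc (α ℕ.+ α))) (factℤ≢0 (suc (β ℕ.+ β)))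

    core-small : ∀ {i} → i ℕ.< k → core (+ i) ≡ + 0
    core-small {i} i<k = ∏<-zero _ i<k (trans (cong (_* (+ i + + i + + 1)) (+-inverseʳ (+ i))) refl)

    Fc-small : ∀ {i} → i ℕ.< k → Fc (+ i) ≡ + 0
    Fc-small {i} i<k =
      trans (cong (λ z → (+ 2 * + i + + 1) * z * halfBin β (+ i)) (core-small i<k))
            (cong (_* halfBin β (+ i)) (*-zeroʳ (+ 2 * + i + + 1)))

    Fc-zero⇒ : ∀ {M} rs → All (InRange M) rs → Any (λ r → Fc r ≡ + 0) rs → alt id (wt n) (symm k rs) ≡ + 0
    Fc-zero⇒ rs ps any = *-cancel-0 (^≢0 (length rs) c₁≢0)
      (trans (alt-axis rs ps) (trans (cong (λ z → c₂ ^ length rs * (b * (alt X F rs * z))) (alt-zero X Fc any))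
        (q (c₂ ^ length rs) b (alt X F rs))))
      where
      q : ∀ x y z → x * (y * (z * + 0)) ≡ + 0
      q = solve-∀

    small? : ∀ {M r} → InRange M r → + k ≤ r ⊎ Fc r ≡ + 0
    small? (i , refl , _) with i ℕ.<? k
    ... | yes i<k = inj₂ (Fc-small i<k)
    ... | no i≮k = inj₁ (ℤ.+≤+ (ℕₚ.≮⇒≥ i≮k))

    all-or-any′ : ∀ {P Q R : ℤ → Set} → (∀ {r} → P r → Q r ⊎ R r) → ∀ {rs} → All P rs → All Q rs ⊎ Any R rs
    all-or-any′ f [] = inj₁ []
    all-or-any′ f (p ∷ ps) with f p | all-or-any′ f ps
    ... | inj₂ r | _ = inj₂ (here r)
    ... | inj₁ _ | inj₂ r = inj₂ (there r)
    ... | inj₁ q | inj₁ qs = inj₁ (q ∷ qs)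

    -- The indicators can differ only if `rs` is strict and has an entry r < k. Then -1 - r already
    -- lies in the block and the alternant vanishes. Hence the sum may run over all entries from 0
    -- instead of from k.
    ind-axis : ∀ {M} rs → All (InRange M) rs →
      ind (symm k rs) * alt id (wt n) (symm k rs) ≡ ind rs * alt id (wt n) (symm k rs)
    ind-axis rs ps with strict? rs
    ... | no ¬st = cong (_* alt id (wt n) (symm k rs)) (ind-no (¬st ∘ symm-strict⁻ k rs))
    ... | yes st with all-or-any′ small? ps
    ... | inj₁ all = cong (_* alt id (wt n) (symm k rs)) (ind-yes (symm-strict k rs all st))
    ... | inj₂ any = trans (cong (ind (symm k rs) *_) z) (trans (*-zeroʳ (ind (symm k rs))) (sym (cong (+ 1 *_) z)))
      where
      z : alt id (wt n) (symm k rs) ≡ + 0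
      z = Fc-zero⇒ rs ps any

    length-axis : ∀ {rs} → length rs ≡ m → length (symm k rs) ≡ k ℕ.+ (m ℕ.+ m)
    length-axis {rs} e = trans (length-symm k rs) (cong (λ l → k ℕ.+ (l ℕ.+ l)) e)

    total : ℕ → ℤ
    total M = Σᵗ m M (λ rs → walks# n (symm k rs))

    total-Z : ∀ M → c₁ ^ m * κ n * total M ≡ μ n * c₂ ^ m * b * Pairing.Z k m M α β
    total-Z M =
      begin
        c₁ ^ m * κ n * total M
      ≡⟨ sym (Σᵗ-scale m M (c₁ ^ m * κ n) _) ⟩
        Σᵗ m M (λ rs → c₁ ^ m * κ n * walks# n (symm k rs))
      ≡⟨ Σᵗ-cong-range m M term ⟩
        Σᵗ m M (λ rs → μ n * c₂ ^ m * b * (ind rs * (alt X F rs * alt X Fc rs)))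
      ≡⟨ Σᵗ-scale m M (μ n * c₂ ^ m * b) _ ⟩
        μ n * c₂ ^ m * b * Pairing.Z k m M α β
      ∎
      where
      q₁ : ∀ c i a → c * (i * a) ≡ i * (c * a)
      q₁ = solve-∀
      q₂ : ∀ μ i c b x → μ * (i * (c * (b * x))) ≡ μ * c * b * (i * x)
      q₂ = solve-∀
      q₃ : ∀ c μ i → c * (μ * i) ≡ μ * (c * i)
      q₃ = solve-∀
      term : ∀ rs → length rs ≡ m → All (InRange M) rs →
        c₁ ^ m * κ n * walks# n (symm k rs) ≡ μ n * c₂ ^ m * b * (ind rs * (alt X F rs * alt X Fc rs))
      term rs refl ps =
        begin
          c₁ ^ m * κ n * walks# n (symm k rs)
        ≡⟨ *-assoc (c₁ ^ m) (κ n) (walks# n (symm k rs)) ⟩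
          c₁ ^ m * (κ n * walks# n (symm k rs))
        ≡⟨ cong (c₁ ^ m *_) (trans (walks#-alt n (symm k rs) (length-axis {rs} refl)) (cong (μ n *_) (ind-axis rs ps))) ⟩
          c₁ ^ m * (μ n * (ind rs * alt id (wt n) (symm k rs)))
        ≡⟨ trans (q₃ (c₁ ^ m) (μ n) (ind rs * alt id (wt n) (symm k rs))) (cong (μ n *_) (q₁ (c₁ ^ m) (ind rs) (alt id (wt n) (symm k rs)))) ⟩
          μ n * (ind rs * (c₁ ^ m * alt id (wt n) (symm k rs)))
        ≡⟨ cong (λ z → μ n * (ind rs * z)) (alt-axis rs ps) ⟩
          μ n * (ind rs * (c₂ ^ m * (b * (alt X F rs * alt X Fc rs))))
        ≡⟨ q₂ (μ n) (ind rs) (c₂ ^ m) b (alt X F rs * alt X Fc rs) ⟩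
          μ n * c₂ ^ m * b * (ind rs * (alt X F rs * alt X Fc rs))
        ∎

  module _ (x : ℕ) where

    alt-shift : ∀ (h : ℤ → ℤ) A y → alt id (λ t → h (A + t)) (desc (- A) y) ≡ alt id h (desc (+ 0) y)
    alt-shift h A zero = refl
    alt-shift h A (suc y) = cong₂ _*_ (cong₂ _*_ (cong h (e A (+ y))) (dd y)) (alt-shift h A y)
      where
      e : ∀ A y → A + (- A + y) ≡ + 0 + y
      e = solve-∀
      e′ : ∀ A y j → - A + y - (- A + j) ≡ + 0 + y - (+ 0 + j)
      e′ = solve-∀
      dd : ∀ j → diffs id (λ t → h (A + t)) (- A + + y) (desc (- A) j) ≡ diffs id h (+ 0 + + y) (desc (+ 0) j)
      dd zero = refl
      dd (suc j) = cong₂ _*_ (e′ A (+ y) (+ j)) (dd j)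

    -- The weights depend on A + t and the Vandermonde product on differences, so changing A merely
    -- translates `top`. Thus the two sides of the exchange, which share n and x, have the same
    -- constants.
    κ-shift : ∀ A A′ n → Walks.κ A x n ≡ Walks.κ A′ x n
    κ-shift A A′ zero = trans (alt-shift (bin (ℕ.pred x)) A x) (sym (alt-shift (bin (ℕ.pred x)) A′ x))
    κ-shift A A′ (suc n) = cong ((+ suc (n ℕ.+ ℕ.pred x)) ^ x *_) (κ-shift A A′ n)

    μ-shift : ∀ A A′ n → Walks.μ A x n ≡ Walks.μ A′ x n
    μ-shift A A′ zero = refl
    μ-shift A A′ (suc n) = cong (∏< x (λ j → + suc (n ℕ.+ ℕ.pred x) - + j) *_) (μ-shift A A′ n)

  ∏<-scale : ∀ m c f → ∏< m (λ j → c * f j) ≡ c ^ m * ∏< m f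
  ∏<-scale zero c f = refl
  ∏<-scale (suc m) c f = trans (cong (_* (c * f m)) (∏<-scale m c f)) (q (c ^ m) (∏< m f) c (f m))
    where
    q : ∀ p f c g → p * f * (c * g) ≡ c * p * (f * g)
    q = solve-∀

  bin-neighbour : ∀ l s → bin l (s - + 1) * (+ suc l - s) ≡ bin l s * s
  bin-neighbour l s = cancel _ _ (+ suc l) (λ ())
    (trans (q₁ (bin l (s - + 1)) (+ suc l - s) (+ suc l))
    (trans (cong (_* (+ suc l - s)) (sym (bin-absorb l s)))
    (trans (q₂ s (bin (suc l) s) (+ suc l))
    (trans (cong (s *_) (bin-absorb′ l s)) (q₃ s (+ suc l) (bin l s))))))
    where
    q₁ : ∀ b d l → b * d * l ≡ l * b * d
    q₁ = solve-∀
    q₂ : ∀ s b l → s * b * (l - s) ≡ s * ((l - s) * b)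
    q₂ = solve-∀
    q₃ : ∀ s l b → s * (l * b) ≡ b * s * l
    q₃ = solve-∀

  -- On the block the binomials for A and A + 1 are neighbours in one row, so `bin-neighbour` gives
  -- their ratio at each position, while the Vandermonde part is common to both.
  block-shift : ∀ k l α β → l ≡ suc (α ℕ.+ suc β) →
    alt id (λ t → bin l (+ suc α + t)) (block k) * ∏< k (λ j → + suc (suc β) + + j) ≡
    alt id (λ t → bin l (+ suc (suc α) + t)) (block k) * ∏< k (λ j → + suc α - + j)
  block-shift k l α β l≡ =
    trans (cong (alt id (λ t → bin l (+ suc α + t)) (block k) *_) (trans (∏<-cong k left) (sym (Πᴸ-block g k))))
   (trans (alt-weights _ g _ g′ weights (block k))
          (cong (alt id (λ t → bin l (+ suc (suc α) + t)) (block k) *_) (trans (Πᴸ-block g′ k) (∏<-cong k λ j → e₃ (+ α) (+ j)))))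
    where
    g g′ : ℤ → ℤ
    g t = + suc l - (+ suc (suc α) + t)
    g′ t = + suc (suc α) + t
    e₁ : ∀ α t → + 1 + α + t ≡ + 2 + α + t - + 1
    e₁ = solve-∀
    e₂ : ∀ α β j → + 2 + β + j ≡ + 1 + (+ 1 + (α + (+ 1 + β))) - (+ 2 + α + - (+ 1 + j))
    e₂ = solve-∀
    e₃ : ∀ α j → + 2 + α + - (+ 1 + j) ≡ + 1 + α - j
    e₃ = solve-∀
    left : ∀ j → + suc (suc β) + + j ≡ g -[1+ j ]
    left j = trans (e₂ (+ α) (+ β) (+ j)) (sym (cong (λ z → z - (+ suc (suc α) + -[1+ j ]))
      (trans (cong (λ z → + suc z) l≡) (cong (λ z → + 1 + (+ 1 + z)) (pos-+ α (suc β))))))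
    weights : ∀ t → bin l (+ suc α + t) * g t ≡ bin l (+ suc (suc α) + t) * g′ t
    weights t = trans (cong (λ z → bin l z * g t) (e₁ (+ α) t)) (bin-neighbour l (+ suc (suc α) + t))

  module Exchange (k m n α β M : ℕ) (size-l : n ℕ.+ ℕ.pred (k ℕ.+ (m ℕ.+ m)) ≡ suc (α ℕ.+ suc β))
    (size-r : n ℕ.+ ℕ.pred (k ℕ.+ (m ℕ.+ m)) ≡ suc (suc α ℕ.+ β)) (α<M : α ℕ.< M) (β<M : β ℕ.< M) where
    private
      module L = Axis k m n α (suc β) size-l
      module R = Axis k m n (suc α) β size-r
      module Pₖ = Pairing k m M
      open Pₖ using (lift; twos; Z; Zσ)

      fα fβ u v : ℤ
      fα = factℤ (suc (α ℕ.+ α))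
      fβ = factℤ (suc (β ℕ.+ β))
      u = + suc (suc (α ℕ.+ α)) * + suc (suc (suc (α ℕ.+ α)))
      v = + suc (suc (β ℕ.+ β)) * + suc (suc (suc (β ℕ.+ β)))
      u₀ u₁ v₀ v₁ φ μc κn : ℤ
      u₀ = (+ suc (suc (α ℕ.+ α))) ^ m
      u₁ = (+ suc (suc (suc (α ℕ.+ α)))) ^ m
      v₀ = (+ suc (suc (β ℕ.+ β))) ^ m
      v₁ = (+ suc (suc (suc (β ℕ.+ β)))) ^ m
      φ = (fα * fβ) ^ m
      κn = L.κ n
      μc = L.μ n * L.c₂ ^ m

      fact-double : ∀ γ → factℤ (suc (suc γ ℕ.+ suc γ)) ≡ factℤ (suc (γ ℕ.+ γ)) * (+ suc (suc (γ ℕ.+ γ)) * + suc (suc (suc (γ ℕ.+ γ))))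
      fact-double γ = trans (cong (λ z → factℤ (suc (suc z))) (ℕₚ.+-suc γ γ))
        (trans (factℤ-suc (suc (suc (γ ℕ.+ γ)))) (trans (cong (+ suc (suc (suc (γ ℕ.+ γ))) *_) (factℤ-suc (suc (γ ℕ.+ γ))))
          (q (+ suc (suc (suc (γ ℕ.+ γ)))) (+ suc (suc (γ ℕ.+ γ))) (factℤ (suc (γ ℕ.+ γ))))))
        where
        q : ∀ x y f → x * (y * f) ≡ f * (y * x)
        q = solve-∀

      c₁-l : L.c₁ ^ m ≡ φ * (v₀ * v₁)
      c₁-l = trans (cong (_^ m) (trans (cong (fα *_) (fact-double β)) (sym (*-assoc fα fβ v))))
        (trans (^-* (fα * fβ) v m) (cong (φ *_) (^-* (+ suc (suc (β ℕ.+ β))) (+ suc (suc (suc (β ℕ.+ β)))) m)))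

      c₁-r : R.c₁ ^ m ≡ φ * (u₀ * u₁)
      c₁-r = trans (cong (_^ m) (trans (cong (_* fβ) (fact-double α)) (q fα u fβ)))
        (trans (^-* (fα * fβ) u m) (cong (φ *_) (^-* (+ suc (suc (α ℕ.+ α))) (+ suc (suc (suc (α ℕ.+ α)))) m)))
        where
        q : ∀ x y f → x * y * f ≡ x * f * y
        q = solve-∀

      total-l : φ * (v₀ * v₁) * κn * L.total M ≡ μc * L.b * Z α (suc β)
      total-l = trans (cong (λ z → z * κn * L.total M) (sym c₁-l)) (L.total-Z M)

      total-r : φ * (u₀ * u₁) * κn * R.total M ≡ μc * R.b * Z β (suc α)
      total-r =
        trans (cong₂ (λ z w → z * w * R.total M) (sym c₁-r) (κ-shift (k ℕ.+ (m ℕ.+ m)) (+ suc α) (+ suc (suc α)) n))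
       (trans (R.total-Z M) (cong₂ (λ z w → z * R.b * w)
         (cong₂ (λ z w → z * w ^ m) (μ-shift (k ℕ.+ (m ℕ.+ m)) (+ suc (suc α)) (+ suc α) n)
           (cong (λ z → factℤ z * factℤ z) (trans (sym size-r) size-l)))
         (Pₖ.Z-sym (suc α) β)))

      βs αs : ℤ
      βs = ∏< k (λ j → + suc (suc β) + + j)
      αs = ∏< k (λ j → + suc α - + j)

      block-l-r : L.b * βs ≡ R.b * αs
      block-l-r = block-shift k (n ℕ.+ ℕ.pred (k ℕ.+ (m ℕ.+ m))) α β size-l

      half-l : lift β k * u₀ * Z α (suc β) ≡ v₁ * twos α * Zσ α β
      half-l = Pₖ.half-step α β α<M

      -- The half step with the roles of α and β exchanged. By the symmetry of `Zσ` it ends in the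
      -- same intermediate sum as `half-l`.
      half-r : lift α k * v₀ * Z β (suc α) ≡ u₁ * twos β * Zσ α β
      half-r = trans (Pₖ.half-step β α β<M) (cong (u₁ * twos β *_) (Pₖ.Zσ-sym β α))

      pos≢0 : ∀ {n} → + suc n ≢ + 0
      pos≢0 ()

    -- Two half steps move (A , B) to (A + 1 , B - 1), with n and x fixed.
    exchange : L.total M * (lift β k * twos β * βs) ≡ R.total M * (lift α k * twos α * αs)
    exchange = cancel _ _ (φ * (v₀ * v₁) * κn * (u₀ * u₁))
      (*-≢0 (*-≢0 (*-≢0 (^≢0 m (*-≢0 (factℤ≢0 (suc (α ℕ.+ α))) (factℤ≢0 (suc (β ℕ.+ β))))) (*-≢0 (^≢0 m pos≢0) (^≢0 m pos≢0))) (L.κ≢0 n))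
            (*-≢0 (^≢0 m pos≢0) (^≢0 m pos≢0)))
      (begin
        L.total M * (lift β k * twos β * βs) * (φ * (v₀ * v₁) * κn * (u₀ * u₁))
      ≡⟨ q₁ (L.total M) (lift β k) (twos β) βs φ (v₀ * v₁) κn u₀ u₁ ⟩
        φ * (v₀ * v₁) * κn * L.total M * (lift β k * u₀ * twos β * βs * u₁)
      ≡⟨ cong (_* (lift β k * u₀ * twos β * βs * u₁)) total-l ⟩
        μc * L.b * Z α (suc β) * (lift β k * u₀ * twos β * βs * u₁)
      ≡⟨ q₂ μc L.b (Z α (suc β)) (lift β k) u₀ (twos β) βs u₁ ⟩
        μc * (L.b * βs) * (lift β k * u₀ * Z α (suc β)) * (twos β * u₁)
      ≡⟨ cong₂ (λ y z → μc * y * z * (twos β * u₁)) block-l-r half-l ⟩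
        μc * (R.b * αs) * (v₁ * twos α * Zσ α β) * (twos β * u₁)
      ≡⟨ q₃ μc R.b αs v₁ (twos α) (Zσ α β) (twos β) u₁ ⟩
        μc * R.b * (u₁ * twos β * Zσ α β) * (αs * v₁ * twos α)
      ≡⟨ cong (λ z → μc * R.b * z * (αs * v₁ * twos α)) (sym half-r) ⟩
        μc * R.b * (lift α k * v₀ * Z β (suc α)) * (αs * v₁ * twos α)
      ≡⟨ q₄ μc R.b (lift α k) v₀ (Z β (suc α)) αs v₁ (twos α) ⟩
        μc * R.b * Z β (suc α) * (lift α k * v₀ * αs * v₁ * twos α)
      ≡⟨ cong (_* (lift α k * v₀ * αs * v₁ * twos α)) (sym total-r) ⟩
        φ * (u₀ * u₁) * κn * R.total M * (lift α k * v₀ * αs * v₁ * twos α)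
      ≡⟨ q₅ φ (u₀ * u₁) κn (R.total M) (lift α k) v₀ αs v₁ (twos α) ⟩
        R.total M * (lift α k * twos α * αs) * (φ * (v₀ * v₁) * κn * (u₀ * u₁))
      ∎)
      where
      q₁ : ∀ t l w s f v k u u′ → t * (l * w * s) * (f * v * k * (u * u′)) ≡ f * v * k * t * (l * u * w * s * u′)
      q₁ = solve-∀
      q₂ : ∀ m b z l u w s u′ → m * b * z * (l * u * w * s * u′) ≡ m * (b * s) * (l * u * z) * (w * u′)
      q₂ = solve-∀
      q₃ : ∀ m b a v t z w u → m * (b * a) * (v * t * z) * (w * u) ≡ m * b * (u * w * z) * (a * v * t)
      q₃ = solve-∀
      q₄ : ∀ m b l v z a v′ t → m * b * (l * v * z) * (a * v′ * t) ≡ m * b * z * (l * v * a * v′ * t)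
      q₄ = solve-∀
      q₅ : ∀ f u k t l v a v′ w → f * u * k * t * (l * v * a * v′ * w) ≡ t * (l * w * a) * (f * (v * v′) * k * u)
      q₅ = solve-∀

    -- The side lengths enter through A = k + m + c and B - 1 = k + m + b.
    exchange-fact : ∀ b c → suc α ≡ k ℕ.+ (m ℕ.+ c) → suc β ≡ k ℕ.+ (m ℕ.+ b) →
      L.total M * (factℤ (m ℕ.+ b) * factℤ (suc β ℕ.+ k) * factℤ c * factℤ (k ℕ.+ c)) ≡
      R.total M * (factℤ (suc α) * factℤ (suc α) * factℤ b * factℤ (k ℕ.+ b))
    exchange-fact b c α≡ β≡ = cancel _ _ (t * sβ * factℤ (m ℕ.+ c))
      (*-≢0 (*-≢0 (^≢0 m λ ()) (factℤ≢0 (suc β))) (factℤ≢0 (m ℕ.+ c)))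
      (begin
        L.total M * (factℤ (m ℕ.+ b) * factℤ (suc β ℕ.+ k) * factℤ c * factℤ (k ℕ.+ c)) * (t * sβ * factℤ (m ℕ.+ c))
      ≡⟨ q₁ (L.total M) (factℤ (m ℕ.+ b)) (factℤ (suc β ℕ.+ k)) (factℤ c) (factℤ (k ℕ.+ c)) t sβ (factℤ (m ℕ.+ c)) ⟩
        L.total M * (factℤ (m ℕ.+ b) * (t * sβ) * factℤ (suc β ℕ.+ k)) * (factℤ c * factℤ (k ℕ.+ c) * factℤ (m ℕ.+ c))
      ≡⟨ cong (λ z → L.total M * z * (factℤ c * factℤ (k ℕ.+ c) * factℤ (m ℕ.+ c)))
           (sym (cong₂ _*_ (cong₂ _*_ (lift-fact β b β≡) (twos-fact β b β≡)) (rising k (suc β)))) ⟩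
        L.total M * (lift β k * factℤ b * (twos β * factℤ (k ℕ.+ b)) * (βs * sβ)) * (factℤ c * factℤ (k ℕ.+ c) * factℤ (m ℕ.+ c))
      ≡⟨ q₂ (L.total M) (lift β k) (factℤ b) (twos β) (factℤ (k ℕ.+ b)) βs sβ (factℤ c) (factℤ (k ℕ.+ c)) (factℤ (m ℕ.+ c)) ⟩
        L.total M * (lift β k * twos β * βs) * (factℤ b * factℤ (k ℕ.+ b) * sβ) * (factℤ c * factℤ (k ℕ.+ c) * factℤ (m ℕ.+ c))
      ≡⟨ cong (λ z → z * (factℤ b * factℤ (k ℕ.+ b) * sβ) * (factℤ c * factℤ (k ℕ.+ c) * factℤ (m ℕ.+ c))) exchange ⟩
        R.total M * (lift α k * twos α * αs) * (factℤ b * factℤ (k ℕ.+ b) * sβ) * (factℤ c * factℤ (k ℕ.+ c) * factℤ (m ℕ.+ c))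
      ≡⟨ q₃ (R.total M) (lift α k) (factℤ c) (twos α) (factℤ (k ℕ.+ c)) αs (factℤ (m ℕ.+ c)) (factℤ b) (factℤ (k ℕ.+ b)) sβ ⟩
        R.total M * (lift α k * factℤ c * (twos α * factℤ (k ℕ.+ c)) * (αs * factℤ (m ℕ.+ c))) * (factℤ b * factℤ (k ℕ.+ b) * sβ)
      ≡⟨ cong (λ z → R.total M * z * (factℤ b * factℤ (k ℕ.+ b) * sβ))
           (cong₂ _*_ (cong₂ _*_ (lift-fact α c α≡) (twos-fact α c α≡)) (falling k α≡)) ⟩
        R.total M * (factℤ (m ℕ.+ c) * (t * sα) * sα) * (factℤ b * factℤ (k ℕ.+ b) * sβ)
      ≡⟨ q₄ (R.total M) (factℤ (m ℕ.+ c)) t sα (factℤ b) (factℤ (k ℕ.+ b)) sβ ⟩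
        R.total M * (sα * sα * factℤ b * factℤ (k ℕ.+ b)) * (t * sβ * factℤ (m ℕ.+ c))
      ∎)
      where
      t sα sβ : ℤ
      t = (+ 2) ^ m
      sα = factℤ (suc α)
      sβ = factℤ (suc β)
      lift-fact : ∀ γ c → suc γ ≡ k ℕ.+ (m ℕ.+ c) → lift γ k * factℤ c ≡ factℤ (m ℕ.+ c)
      lift-fact γ c e = trans (cong (_* factℤ c) (∏<-cong m λ j →
          trans (cong (λ z → + z - + j - + k) e) (trans (cong (λ z → z - + j - + k) (pos-+ k (m ℕ.+ c))) (q (+ k) (+ (m ℕ.+ c)) (+ j)))))
        (falling m refl)
        where
        q : ∀ k x j → k + x - j - k ≡ x - j
        q = solve-∀
      twos-fact : ∀ γ c → suc γ ≡ k ℕ.+ (m ℕ.+ c) → twos γ * factℤ (k ℕ.+ c) ≡ t * factℤ (suc γ)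
      twos-fact γ c e = trans (cong (_* factℤ (k ℕ.+ c)) (∏<-scale m (+ 2) (λ j → + suc γ - + j)))
        (trans (*-assoc t _ _) (cong (t *_) (falling m (trans e (ℕ+-swap k m c)))))
        where
        ℕ+-swap : ∀ k m c → k ℕ.+ (m ℕ.+ c) ≡ m ℕ.+ (k ℕ.+ c)
        ℕ+-swap = ℕ-Solver.solve-∀
      q₁ : ∀ T mb sk c kc t s mc → T * (mb * sk * c * kc) * (t * s * mc) ≡ T * (mb * (t * s) * sk) * (c * kc * mc)
      q₁ = solve-∀
      q₂ : ∀ T l b w kb s sβ c kc mc → T * (l * b * (w * kb) * (s * sβ)) * (c * kc * mc) ≡ T * (l * w * s) * (b * kb * sβ) * (c * kc * mc)
      q₂ = solve-∀
      q₃ : ∀ T l c w kc a mc b kb s → T * (l * w * a) * (b * kb * s) * (c * kc * mc) ≡ T * (l * c * (w * kc) * (a * mc)) * (b * kb * s)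
      q₃ = solve-∀
      q₄ : ∀ T mc t s b kb sβ → T * (mc * (t * s) * s) * (b * kb * sβ) ≡ T * (s * s * b * kb) * (t * sβ * mc)
      q₄ = solve-∀

-- The single surviving configuration for y = k, and its dependence on c

module BaseCase where
  open import Data.Integer using (_+_; _-_; _*_; -_; _^_; _<_; _≤_)
  open Alternants
  open Weights
  open TupleSums
  open Evaluation
  open Configurations
  open Totals

  Σ<-zero : ∀ N (f : ℤ → ℤ) → (∀ j → j ℕ.< N → f (+ j) ≡ + 0) → Σ< N f ≡ + 0
  Σ<-zero zero f z = refl
  Σ<-zero (suc N) f z = cong₂ _+_ (Σ<-zero N f λ j j<N → z j (ℕₚ.m<n⇒m<1+n j<N)) (z N ℕₚ.≤-refl)

  Σ<-single : ∀ N (f : ℤ → ℤ) i → i ℕ.< N → (∀ j → j ℕ.< N → j ≢ i → f (+ j) ≡ + 0) → Σ< N f ≡ f (+ i)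
  Σ<-single (suc N) f i (ℕ.s≤s i≤N) z with ℕₚ.m≤n⇒m<n∨m≡n i≤N
  ... | inj₁ i<N = trans (cong₂ _+_ (Σ<-single N f i i<N λ j j<N → z j (ℕₚ.m<n⇒m<1+n j<N)) (z N ℕₚ.≤-refl (ℕₚ.>⇒≢ i<N)))
                         (+-identityʳ (f (+ i)))
  ... | inj₂ refl = trans (cong (_+ f (+ i)) (Σ<-zero N f λ j j<N → z j (ℕₚ.m<n⇒m<1+n j<N) (ℕₚ.<⇒≢ j<N)))
                          (+-identityˡ (f (+ i)))

  Σᵗ-single : ∀ m M (G : List ℤ → ℤ) ρ → length ρ ≡ m → All (InRange M) ρ →
    (∀ ts → length ts ≡ m → All (InRange M) ts → ts ≢ ρ → G ts ≡ + 0) → Σᵗ m M G ≡ G ρ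
  Σᵗ-single zero M G [] _ _ _ = refl
  Σᵗ-single (suc m) M G (_ ∷ ρ) len ((i , refl , i<M) ∷ ps) z =
    trans (Σ<-single M _ i i<M λ j j<M j≢i →
            trans (Σᵗ-cong-range m M λ ts e as → z (+ j ∷ ts) (cong suc e) ((j , refl , j<M) ∷ as) λ {refl → j≢i refl})
                  (zeros m))
          (Σᵗ-single m M (λ ts → G (+ i ∷ ts)) ρ (ℕₚ.suc-injective len) ps
            λ ts e as ts≢ρ → z (+ i ∷ ts) (cong suc e) ((i , refl , i<M) ∷ as) λ {refl → ts≢ρ refl})
    where
    zeros : ∀ m → Σᵗ m M (λ _ → + 0) ≡ + 0
    zeros zero = refl
    zeros (suc m) = Σ<-zero M _ λ _ _ → zeros m

  module _ (k m n α β : ℕ) (size≡ : n ℕ.+ ℕ.pred (k ℕ.+ (m ℕ.+ m)) ≡ suc (α ℕ.+ β)) (β≡ : suc β ≡ k ℕ.+ m) where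
    open Axis k m n α β size≡

    -- For B = k + m, `core` forces r ≥ k and the binomial forces r < k + m, which leaves m places
    -- for the m entries.
    total-single : ∀ M → k ℕ.+ m ℕ.≤ M → total M ≡ walks# n (symm k (desc (+ k) m))
    total-single M k+m≤M = Σᵗ-single m M _ (desc (+ k) m) (length-desc (+ k) m)
      (All.map range (desc-between (+ k) m)) vanish
      where
      range : ∀ {t} → Between (+ k) m t → InRange M t
      range {+ i} (_ , ℤ.+<+ i<) = i , refl , ℕₚ.<-≤-trans i< k+m≤M
      range { -[1+ i ]} (() , _)
      between? : ∀ {r} → InRange M r → Between (+ k) m r ⊎ Fc r ≡ + 0
      between? p@(i , refl , _) with small? p
      ... | inj₂ z = inj₂ z
      ... | inj₁ k≤i with i ℕ.<? k ℕ.+ m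
      ... | yes i< = inj₁ (k≤i , ℤ.+<+ i<)
      ... | no i≮ = inj₂ (trans (cong ((+ 2 * + i + + 1) * HalfStep.core k (+ i) *_)
              (bin-big (suc (β ℕ.+ β)) (suc β ℕ.+ i) (ℕ.s≤s (ℕₚ.+-monoʳ-< β (subst (ℕ._≤ i) (sym β≡) (ℕₚ.≮⇒≥ i≮))))))
              (*-zeroʳ ((+ 2 * + i + + 1) * HalfStep.core k (+ i))))
      vanish : ∀ rs → length rs ≡ m → All (InRange M) rs → rs ≢ desc (+ k) m → walks# n (symm k rs) ≡ + 0
      vanish rs len ps rs≢ = *-cancel-0 (κ≢0 n)
        (trans (walks#-alt n (symm k rs) (length-axis {rs} len))
        (trans (cong (μ n *_) (trans (ind-axis rs ps) z)) (*-zeroʳ (μ n))))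
        where
        z : ind rs * alt id (wt n) (symm k rs) ≡ + 0
        z with all-or-any′ between? ps
        ... | inj₁ all = cong (_* alt id (wt n) (symm k rs)) (ind-no λ st → rs≢ (desc-unique (+ k) m rs len st all))
        ... | inj₂ any = trans (cong (ind rs *_) (Fc-zero⇒ rs ps any)) (*-zeroʳ (ind rs))

  Πᴸ-const : ∀ c ts → Πᴸ (λ _ → c) ts ≡ c ^ length ts
  Πᴸ-const c [] = refl
  Πᴸ-const c (t ∷ ts) = cong (c *_) (Πᴸ-const c ts)

  Πᴸ-symm : ∀ g k rs → Πᴸ g (symm k rs) ≡ Πᴸ (λ r → g r * g (mirror r)) rs * Πᴸ g (block k)
  Πᴸ-symm g k [] = sym (*-identityˡ _)
  Πᴸ-symm g k (r ∷ rs) =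
    trans (cong (g r *_) (trans (Πᴸ-++ g (symm k rs) _) (cong (_* (g (mirror r) * + 1)) (Πᴸ-symm g k rs))))
          (q (g r) (Πᴸ (λ r → g r * g (mirror r)) rs) (Πᴸ g (block k)) (g (mirror r)))
    where
    q : ∀ x p b y → x * (p * b * (y * + 1)) ≡ x * y * p * b
    q = solve-∀

  Πᴸ-desc : ∀ f s m → Πᴸ f (desc s m) ≡ ∏< m (λ i → f (s + + i))
  Πᴸ-desc f s zero = refl
  Πᴸ-desc f s (suc m) = trans (cong (f (s + + m) *_) (Πᴸ-desc f s m)) (*-comm (f (s + + m)) _)

  ∏<-* : ∀ m f g → ∏< m (λ j → f j * g j) ≡ ∏< m f * ∏< m g
  ∏<-* zero f g = refl
  ∏<-* (suc m) f g = trans (cong (_* (f m * g m)) (∏<-* m f g)) (q (∏< m f) (∏< m g) (f m) (g m))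
    where
    q : ∀ a b c d → a * b * (c * d) ≡ a * c * (b * d)
    q = solve-∀

  -- Raising A and the number of steps together multiplies the weight at t by (l + 1)/(A + 1 + t)
  -- and leaves the Vandermonde product alone, so both counts are compared position by position.
  widen : ∀ A x n T → length T ≡ x →
    Walks.walks# (+ 1 + A) x (suc n) T * Πᴸ (λ t → + 1 + A + t) T ≡
    Walks.walks# A x n T * ∏< x (λ j → + suc (n ℕ.+ ℕ.pred x) - + j)
  widen A x n T len = cancel _ _ (sˣ * W.κ n) (*-≢0 (^≢0 x λ ()) (W.κ≢0 n))
    (begin
      w′ * Π * (sˣ * W.κ n)
    ≡⟨ q₁ w′ Π sˣ (W.κ n) ⟩
      sˣ * W.κ n * w′ * Π
    ≡⟨ cong (λ z → sˣ * z * w′ * Π) (κ-shift x A (+ 1 + A) n) ⟩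
      W′.κ (suc n) * w′ * Π
    ≡⟨ cong (_* Π) (W′.walks#-alt (suc n) T len) ⟩
      c * W′.μ n * (ind T * alt id (W′.wt (suc n)) T) * Π
    ≡⟨ trans (cong (λ z → c * z * (ind T * alt id (W′.wt (suc n)) T) * Π) (μ-shift x (+ 1 + A) A n)) (q₂ c (W.μ n) (ind T) (alt id (W′.wt (suc n)) T) Π) ⟩
      c * W.μ n * ind T * (alt id (W′.wt (suc n)) T * Π)
    ≡⟨ cong (c * W.μ n * ind T *_) (trans (alt-weights (W′.wt (suc n)) _ (W.wt n) (λ _ → + suc l) weights T)
         (cong (alt id (W.wt n) T *_) (trans (Πᴸ-const (+ suc l) T) (cong ((+ suc l) ^_) len)))) ⟩
      c * W.μ n * ind T * (alt id (W.wt n) T * sˣ)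
    ≡⟨ q₃ c (W.μ n) (ind T) (alt id (W.wt n) T) sˣ ⟩
      W.μ n * (ind T * alt id (W.wt n) T) * (c * sˣ)
    ≡⟨ cong (_* (c * sˣ)) (sym (W.walks#-alt n T len)) ⟩
      W.κ n * w * (c * sˣ)
    ≡⟨ q₄ (W.κ n) w c sˣ ⟩
      w * c * (sˣ * W.κ n)
    ∎)
    where
    module W = Walks A x
    module W′ = Walks (+ 1 + A) x
    l : ℕ
    l = n ℕ.+ ℕ.pred x
    w w′ Π sˣ c : ℤ
    w = W.walks# n T
    w′ = W′.walks# (suc n) T
    Π = Πᴸ (λ t → + 1 + A + t) T
    sˣ = (+ suc l) ^ x
    c = ∏< x (λ j → + suc l - + j)
    e : ∀ A t → + 1 + A + t - + 1 ≡ A + t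
    e = solve-∀
    weights : ∀ t → bin (suc l) (+ 1 + A + t) * (+ 1 + A + t) ≡ bin l (A + t) * + suc l
    weights t = trans (*-comm (bin (suc l) (+ 1 + A + t)) (+ 1 + A + t)) (trans (bin-absorb l (+ 1 + A + t)) (trans (cong (λ z → + suc l * bin l z) (e A t)) (*-comm (+ suc l) (bin l (A + t)))))
    q₁ : ∀ w p s k → w * p * (s * k) ≡ s * k * w * p
    q₁ = solve-∀
    q₂ : ∀ c m i a p → c * m * (i * a) * p ≡ c * m * i * (a * p)
    q₂ = solve-∀
    q₃ : ∀ c m i a s → c * m * i * (a * s) ≡ m * (i * a) * (c * s)
    q₃ = solve-∀
    q₄ : ∀ k w c s → k * w * (c * s) ≡ w * c * (s * k)
    q₄ = solve-∀

  core-walks : ℕ → ℕ → ℕ → ℤ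
  core-walks k m c = Walks.walks# (+ (k ℕ.+ (m ℕ.+ c))) (k ℕ.+ (m ℕ.+ m)) (k ℕ.+ c) (symm k (desc (+ k) m))

  -- An instance of `widen`. The product over the configuration splits into the entries k, ..., k +
  -- m - 1, their mirror images and the block; each is a run of consecutive integers and hence a
  -- quotient of factorials.
  core-walks-suc : ∀ k m c → 0 ℕ.< k ℕ.+ (m ℕ.+ m) →
    core-walks k m (suc c) * (factℤ (k ℕ.+ (m ℕ.+ c)) * factℤ (k ℕ.+ c)) ≡
    core-walks k m c * (factℤ c * factℤ (k ℕ.+ (m ℕ.+ c) ℕ.+ k))
  core-walks-suc k m c 0<x = cancel _ _ (factℤ (N ℕ.+ k ℕ.+ m)) (factℤ≢0 (N ℕ.+ k ℕ.+ m))
    (begin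
      core-walks k m (suc c) * (factℤ N * factℤ (k ℕ.+ c)) * factℤ (N ℕ.+ k ℕ.+ m)
    ≡⟨ q₁ (core-walks k m (suc c)) (factℤ N) (factℤ (k ℕ.+ c)) (factℤ (N ℕ.+ k ℕ.+ m)) ⟩
      core-walks k m (suc c) * (factℤ N * factℤ (N ℕ.+ k ℕ.+ m)) * factℤ (k ℕ.+ c)
    ≡⟨ cong (λ z → core-walks k m (suc c) * z * factℤ (k ℕ.+ c)) (sym product) ⟩
      core-walks k m (suc c) * (Π * (factℤ c * factℤ (N ℕ.+ k))) * factℤ (k ℕ.+ c)
    ≡⟨ q₂ (core-walks k m (suc c)) Π (factℤ c * factℤ (N ℕ.+ k)) (factℤ (k ℕ.+ c)) ⟩
      core-walks k m (suc c) * Π * (factℤ c * factℤ (N ℕ.+ k) * factℤ (k ℕ.+ c))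
    ≡⟨ cong (_* (factℤ c * factℤ (N ℕ.+ k) * factℤ (k ℕ.+ c))) widened ⟩
      core-walks k m c * p * (factℤ c * factℤ (N ℕ.+ k) * factℤ (k ℕ.+ c))
    ≡⟨ q₃ (core-walks k m c) p (factℤ c * factℤ (N ℕ.+ k)) (factℤ (k ℕ.+ c)) ⟩
      core-walks k m c * (factℤ c * factℤ (N ℕ.+ k)) * (p * factℤ (k ℕ.+ c))
    ≡⟨ cong (core-walks k m c * (factℤ c * factℤ (N ℕ.+ k)) *_)
         (trans (falling x (trans size-suc (ℕₚ.+-comm (k ℕ.+ c) x))) (cong factℤ (trans size-suc (reorder k m c)))) ⟩
      core-walks k m c * (factℤ c * factℤ (N ℕ.+ k)) * factℤ (N ℕ.+ k ℕ.+ m)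
    ∎)
    where
    N x : ℕ
    N = k ℕ.+ (m ℕ.+ c)
    x = k ℕ.+ (m ℕ.+ m)
    T : List ℤ
    T = symm k (desc (+ k) m)
    Π p : ℤ
    Π = Πᴸ (λ t → + 1 + + N + t) T
    p = ∏< x (λ j → + suc (k ℕ.+ c ℕ.+ ℕ.pred x) - + j)
    size-suc : suc (k ℕ.+ c ℕ.+ ℕ.pred x) ≡ k ℕ.+ c ℕ.+ x
    size-suc = trans (sym (ℕₚ.+-suc (k ℕ.+ c) (ℕ.pred x))) (cong (k ℕ.+ c ℕ.+_) (ℕₚ.suc-pred x {{ℕ.>-nonZero 0<x}}))
    reorder : ∀ k m c → k ℕ.+ c ℕ.+ (k ℕ.+ (m ℕ.+ m)) ≡ k ℕ.+ (m ℕ.+ c) ℕ.+ k ℕ.+ m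
    reorder = ℕ-Solver.solve-∀
    len : length T ≡ x
    len = trans (length-symm k (desc (+ k) m)) (cong (λ l → k ℕ.+ (l ℕ.+ l)) (length-desc (+ k) m))
    widened : core-walks k m (suc c) * Π ≡ core-walks k m c * p
    widened = trans (cong₂ (λ A n → Walks.walks# A x n T * Π)
        (cong +_ (trans (cong (k ℕ.+_) (ℕₚ.+-suc m c)) (ℕₚ.+-suc k (m ℕ.+ c)))) (ℕₚ.+-suc k c))
      (widen (+ N) x (k ℕ.+ c) T len)
    e₁ : ∀ N j → + 1 + N + - (+ 1 + j) ≡ N - j
    e₁ = solve-∀
    e₂ : ∀ N k i → + 1 + N + (k + i) ≡ + 1 + (N + k) + i
    e₂ = solve-∀
    e₃ : ∀ k mc i → + 1 + (k + mc) + (- + 1 - (k + i)) ≡ mc - i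
    e₃ = solve-∀
    product : Π * (factℤ c * factℤ (N ℕ.+ k)) ≡ factℤ N * factℤ (N ℕ.+ k ℕ.+ m)
    product =
      begin
        Π * (factℤ c * factℤ (N ℕ.+ k))
      ≡⟨ cong (_* (factℤ c * factℤ (N ℕ.+ k))) (trans (Πᴸ-symm _ k (desc (+ k) m)) (cong₂ _*_
           (trans (Πᴸ-desc _ (+ k) m) (trans (∏<-cong m λ i → cong₂ _*_
              (trans (e₂ (+ N) (+ k) (+ i)) (cong (λ z → + 1 + z + + i) (sym (pos-+ N k))))
              (trans (cong (λ z → + 1 + z + mirror (+ k + + i)) (pos-+ k (m ℕ.+ c))) (e₃ (+ k) (+ (m ℕ.+ c)) (+ i)))) (∏<-* m _ _)))
           (trans (Πᴸ-block _ k) (∏<-cong k λ j → e₁ (+ N) (+ j))))) ⟩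
        r * f * g * (factℤ c * factℤ (N ℕ.+ k))
      ≡⟨ q r f g (factℤ c) (factℤ (N ℕ.+ k)) ⟩
        g * (f * factℤ c) * (r * factℤ (N ℕ.+ k))
      ≡⟨ cong₂ (λ y z → g * y * z) (falling m refl) (rising m (N ℕ.+ k)) ⟩
        g * factℤ (m ℕ.+ c) * factℤ (N ℕ.+ k ℕ.+ m)
      ≡⟨ cong (_* factℤ (N ℕ.+ k ℕ.+ m)) (falling k refl) ⟩
        factℤ N * factℤ (N ℕ.+ k ℕ.+ m)
      ∎
      where
      r f g : ℤ
      r = ∏< m (λ i → + suc (N ℕ.+ k) + + i)
      f = ∏< m (λ i → + (m ℕ.+ c) - + i)
      g = ∏< k (λ j → + N - + j)
      q : ∀ r f g c s → r * f * g * (c * s) ≡ g * (f * c) * (r * s)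
      q = solve-∀
    q₁ : ∀ w a b c → w * (a * b) * c ≡ w * (a * c) * b
    q₁ = solve-∀
    q₂ : ∀ w p a b → w * (p * a) * b ≡ w * p * (a * b)
    q₂ = solve-∀
    q₃ : ∀ w p a b → w * p * (a * b) ≡ w * a * (p * b)
    q₃ = solve-∀

-- The forced walk at c = 0, and both recursions in terms of a, b, c

module ClosedForm where
  open import Data.Integer using (_+_; _-_; _*_; -_; _^_; _<_; _≤_)
  open Alternants
  open Weights
  open TupleSums
  open Evaluation
  open Configurations
  open Totals
  open BaseCase

  pre-≢ : ∀ t → pre t ≢ t
  pre-≢ t e = <-irrefl refl (+1≤⇒< {t} {t} (≤-reflexive (trans (cong (_+ + 1) (sym e)) (q t))))
    where
    q : ∀ t → t - + 1 + + 1 ≡ t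
    q = solve-∀

  steps-zero : ∀ (G : List ℤ → ℤ) ts → (∀ us → Stepped pre ts us → G us ≡ + 0) → steps pre G ts ≡ + 0
  steps-zero G ts z = trans (steps-cong-stepped pre ts z) (zeros ts)
    where
    zeros : ∀ ts → steps pre (λ _ → + 0) ts ≡ + 0
    zeros [] = refl
    zeros (t ∷ ts) = cong₂ _+_ (zeros ts) (zeros ts)

  steps-single : ∀ (G : List ℤ → ℤ) ts ws → Stepped pre ts ws →
    (∀ us → Stepped pre ts us → us ≢ ws → G us ≡ + 0) → steps pre G ts ≡ G ws
  steps-single G [] [] [] _ = refl
  steps-single G (t ∷ ts) (_ ∷ ws) (inj₁ refl ∷ p) z =
    trans (cong₂ _+_
      (steps-single (λ us → G (t ∷ us)) ts ws p λ us q us≢ → z (t ∷ us) (inj₁ refl ∷ q) λ {refl → us≢ refl})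
      (steps-zero _ ts λ us q → z (pre t ∷ us) (inj₂ refl ∷ q) (head≢ us)))
    (+-identityʳ (G (t ∷ ws)))
    where
    head≢ : ∀ us → pre t ∷ us ≢ t ∷ ws
    head≢ us e = pre-≢ t (cong (λ { (x ∷ _) → x ; [] → t }) e)
  steps-single G (t ∷ ts) (_ ∷ ws) (inj₂ refl ∷ p) z =
    trans (cong₂ _+_
      (steps-zero _ ts λ us q → z (t ∷ us) (inj₁ refl ∷ q) (head≢ us))
      (steps-single (λ us → G (pre t ∷ us)) ts ws p λ us q us≢ → z (pre t ∷ us) (inj₂ refl ∷ q) λ {refl → us≢ refl}))
    (+-identityˡ (G (pre t ∷ ws)))
    where
    head≢ : ∀ us → t ∷ us ≢ pre t ∷ ws
    head≢ us e = pre-≢ t (sym (cong (λ { (x ∷ _) → x ; [] → t }) e))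

  desc-++ : ∀ s m q → desc s (m ℕ.+ q) ≡ desc (s + + q) m ++ desc s q
  desc-++ s zero q = refl
  desc-++ s (suc m) q = cong₂ _∷_ (trans (cong (λ z → s + z) (trans (pos-+ m q) (+-comm (+ m) (+ q)))) (sym (+-assoc s (+ q) (+ m)))) (desc-++ s m q)

  desc-snoc : ∀ s x → desc s (suc x) ≡ desc (s + + 1) x ++ [ s ]
  desc-snoc s x = trans (cong (desc s) (ℕₚ.+-comm 1 x)) (trans (desc-++ s x 1) (cong (λ z → desc (s + + 1) x ++ [ z ]) (+-identityʳ s)))

  block-desc : ∀ k → block k ≡ desc (- + k) k
  block-desc zero = refl
  block-desc (suc k) = trans (cong (_++ [ -[1+ k ] ]) (trans (block-desc k) (cong (λ s → desc s k) (e (+ k))))) (sym (desc-snoc -[1+ k ] k))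
    where
    e : ∀ k → - k ≡ - (+ 1 + k) + + 1
    e = solve-∀

  -- The mirror images of k, ..., k + m - 1 continue the block to the left without a gap.
  symm-desc : ∀ k m → symm k (desc (+ k) m) ≡ desc (+ k) m ++ desc (- + (k ℕ.+ m)) (k ℕ.+ m)
  symm-desc k zero = trans (block-desc k) (cong (λ q → desc (- + q) q) (sym (ℕₚ.+-identityʳ k)))
  symm-desc k (suc m) = cong (+ k + + m ∷_)
    (trans (cong (_++ [ mirror (+ k + + m) ]) (symm-desc k m))
    (trans (++-assoc (desc (+ k) m) _ _) (cong (desc (+ k) m ++_)
      (trans (cong₂ (λ s z → desc s (k ℕ.+ m) ++ [ z ]) (e₁ (+ (k ℕ.+ m)))
                 (trans (cong mirror (sym (pos-+ k m))) (e₂ (+ (k ℕ.+ m)))))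
      (trans (sym (desc-snoc -[1+ k ℕ.+ m ] (k ℕ.+ m)))
             (cong (λ q → desc (- + q) q) (sym (ℕₚ.+-suc k m))))))))
    where
    e₁ : ∀ q → - q ≡ - (+ 1 + q) + + 1
    e₁ = solve-∀
    e₂ : ∀ q → - + 1 - q ≡ - (+ 1 + q)
    e₂ = solve-∀

  module Forced (m q : ℕ) (0<x : 0 ℕ.< m ℕ.+ q) where
    open Walks (+ q) (m ℕ.+ q)

    gap : ℕ → List ℤ
    gap g = desc (+ g) m ++ desc (- + q) q

    length-gap : ∀ g → length (gap g) ≡ m ℕ.+ q
    length-gap g = trans (length-++ (desc (+ g) m)) (cong₂ ℕ._+_ (length-desc (+ g) m) (length-desc (- + q) q))

    gap-strict : ∀ g → Strict (gap g)
    gap-strict g = go m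
      where
      low : All (_< + 0) (desc (- + q) q)
      low = All.map (λ (_ , p) → <-≤-trans p (≤-reflexive (+-inverseˡ (+ q)))) (desc-between (- + q) q)
      go : ∀ j → Strict (desc (+ g) j ++ desc (- + q) q)
      go zero = desc-strict (- + q) q
      go (suc j) = strict-cons (Allₚ.++⁺ (All.map proj₂ (desc-between (+ g) j)) (All.map (λ p → <-≤-trans p (ℤ.+≤+ ℕ.z≤n)) low)) (go j)

    gap-stepped : ∀ g → Stepped pre (gap (suc g)) (gap g)
    gap-stepped g = go m
      where
      same : ∀ us → Stepped pre us us
      same [] = []
      same (u ∷ us) = inj₁ refl ∷ same us
      e : ∀ g j → g + j ≡ + 1 + g + j - + 1
      e = solve-∀
      go : ∀ j → Stepped pre (desc (+ suc g) j ++ desc (- + q) q) (desc (+ g) j ++ desc (- + q) q)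
      go zero = same _
      go (suc j) = inj₂ (e (+ g) (+ j)) ∷ go j

    split : ∀ ts {ts′ us} → Stepped pre (ts ++ ts′) us → ∃ λ us₁ → ∃ λ us₂ → us ≡ us₁ ++ us₂ × Stepped pre ts us₁ × Stepped pre ts′ us₂
    split [] p = [] , _ , refl , [] , p
    split (t ∷ ts) (e ∷ p) with split ts p
    ... | us₁ , us₂ , refl , p₁ , p₂ = _ ∷ us₁ , us₂ , refl , e ∷ p₁ , p₂

    pre-≤ : ∀ t → pre t ≤ t
    pre-≤ t = lin (ℤ.+≤+ (ℕ.z≤n {1})) (e t)
      where
      e : ∀ t → t - (t - + 1) ≡ + 1 - + 0
      e = solve-∀

    strict-++⁻ : ∀ us₁ {us₂} → Strict (us₁ ++ us₂) → Strict us₁ × Strict us₂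
    strict-++⁻ [] s = [] , s
    strict-++⁻ (u ∷ us₁) s with strict-++⁻ us₁ (strict-tail s)
    ... | s₁ , s₂ = strict-cons (Allₚ.++⁻ˡ us₁ (strict-head s)) s₁ , s₂

    -- The m upper entries lose at most one unit and so stay at or above g, while the bound on the
    -- right end keeps them below g + m; the q lower entries are confined to -q, ..., -1. In both
    -- parts `desc-unique` leaves a single choice.
    gap-unique : ∀ g us → Stepped pre (gap (suc g)) us → Strict us → All (Between (- + q) (g ℕ.+ (m ℕ.+ q))) us → us ≡ gap g
    gap-unique g us p s b with split (desc (+ suc g) m) p
    ... | us₁ , us₂ , refl , p₁ , p₂ =
      cong₂ _++_
        (desc-unique (+ g) m us₁ (trans (sym (Pointwise-length p₁)) (length-desc (+ suc g) m)) (proj₁ ss)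
          (upper p₁ (All.map proj₁ (desc-between (+ suc g) m)) (Allₚ.++⁻ˡ us₁ b)))
        (desc-unique (- + q) q us₂ (trans (sym (Pointwise-length p₂)) (length-desc (- + q) q)) (proj₂ ss)
          (lower p₂ (All.map proj₂ (desc-between (- + q) q)) (Allₚ.++⁻ʳ us₁ b)))
      where
      ss = strict-++⁻ us₁ s
      e₁ : ∀ t g → t - + 1 - g ≡ t - (+ 1 + g)
      e₁ = solve-∀
      e₂ : ∀ g m q → - q + (g + (m + q)) ≡ g + m
      e₂ = solve-∀
      bound : - + q + + (g ℕ.+ (m ℕ.+ q)) ≡ + g + + m
      bound = trans (cong (λ z → - + q + z) (trans (pos-+ g (m ℕ.+ q)) (cong (λ z → + g + z) (pos-+ m q)))) (e₂ (+ g) (+ m) (+ q))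
      upper : ∀ {ts vs} → Stepped pre ts vs → All (+ suc g ≤_) ts → All (Between (- + q) (g ℕ.+ (m ℕ.+ q))) vs → All (Between (+ g) m) vs
      upper [] [] [] = []
      upper (e ∷ p) (l ∷ ls) ((_ , h) ∷ hs) = (low e l , <-≤-trans h (≤-reflexive bound)) ∷ upper p ls hs
        where
        low : ∀ {u t} → u ≡ t ⊎ u ≡ pre t → + suc g ≤ t → + g ≤ u
        low (inj₁ refl) l = ≤-trans (ℤ.+≤+ (ℕₚ.n≤1+n g)) l
        low {t = t} (inj₂ refl) l = lin l (e₁ t (+ g))
      lower : ∀ {ts vs} → Stepped pre ts vs → All (_< - + q + + q) ts → All (Between (- + q) (g ℕ.+ (m ℕ.+ q))) vs → All (Between (- + q) q) vs
      lower [] [] [] = []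
      lower (e ∷ p) (l ∷ ls) ((h , _) ∷ hs) = (h , up e l) ∷ lower p ls hs
        where
        up : ∀ {u t} → u ≡ t ⊎ u ≡ pre t → t < - + q + + q → u < - + q + + q
        up (inj₁ refl) l = l
        up {t = t} (inj₂ refl) l = ≤-<-trans (pre-≤ t) l

    -- The only walk moves the m upper positions down in every step and fixes the q lower ones.
    forced : ∀ g → walks# g (gap g) ≡ + 1
    forced zero with gap 0 ≟ᴸ top
    ... | yes _ = refl
    ... | no gap≢top = ⊥-elim (gap≢top (sym (trans (desc-++ (- + q) m q) (cong (λ s → desc s m ++ desc (- + q) q) (+-inverseˡ (+ q))))))
    forced (suc g) =
      trans (cong (_* steps pre (walks# g) (gap (suc g))) (ind-yes (gap-strict (suc g))))
     (trans (*-identityˡ _) (trans (steps-single (walks# g) (gap (suc g)) (gap g) (gap-stepped g) vanish) (forced g)))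
      where
      vanish : ∀ us → Stepped pre (gap (suc g)) us → us ≢ gap g → walks# g us ≡ + 0
      vanish us p us≢ = *-cancel-0 (κ≢0 g)
        (trans (walks#-alt g us (trans (sym (Pointwise-length p)) (length-gap (suc g))))
        (trans (cong (μ g *_) z) (*-zeroʳ (μ g))))
        where
        z : ind us * alt id (wt g) us ≡ + 0
        z with all-or-any (fits 0<x g) us
        ... | inj₁ all = cong (_* alt id (wt g) us) (ind-no λ s → us≢ (gap-unique g us p s all))
        ... | inj₂ any = trans (cong (ind us *_) (alt-zero id (wt g) any)) (*-zeroʳ (ind us))

  core-walks-zero : ∀ k m → 0 ℕ.< k ℕ.+ (m ℕ.+ m) → core-walks k m 0 ≡ + 1
  core-walks-zero k m 0<x =
    trans (cong (Walks.walks# (+ (k ℕ.+ (m ℕ.+ 0))) (k ℕ.+ (m ℕ.+ m)) (k ℕ.+ 0)) (symm-desc k m))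
   (trans (cong₂ (λ q x → Walks.walks# (+ q) x (k ℕ.+ 0) (desc (+ k) m ++ desc (- + (k ℕ.+ m)) (k ℕ.+ m))) (cong (k ℕ.+_) (ℕₚ.+-identityʳ m)) (x≡ k m))
   (trans (cong (λ n → Walks.walks# (+ (k ℕ.+ m)) (m ℕ.+ (k ℕ.+ m)) n (desc (+ k) m ++ desc (- + (k ℕ.+ m)) (k ℕ.+ m))) (ℕₚ.+-identityʳ k))
          (Forced.forced m (k ℕ.+ m) (subst (0 ℕ.<_) (x≡ k m) 0<x) k)))
    where
    x≡ : ∀ k m → k ℕ.+ (m ℕ.+ m) ≡ m ℕ.+ (k ℕ.+ m)
    x≡ = ℕ-Solver.solve-∀

  walks#-[] : ∀ A n → Walks.walks# A 0 n [] ≡ + 1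
  walks#-[] A zero = refl
  walks#-[] A (suc n) = trans (*-identityˡ _) (walks#-[] A n)

  tilings# : ℕ → ℕ → ℕ → ℕ → ℕ → ℤ
  tilings# M k a b c = Σᵗ a M (λ rs → Walks.walks# (+ (k ℕ.+ (a ℕ.+ c))) (k ℕ.+ (a ℕ.+ a)) (k ℕ.+ (b ℕ.+ c)) (symm k rs))

  exchange-tilings : ∀ M k a b c → k ℕ.+ (a ℕ.+ (b ℕ.+ c)) ℕ.< M →
    tilings# M k a (suc b) c * (factℤ (a ℕ.+ b) * factℤ (k ℕ.+ (a ℕ.+ b) ℕ.+ k) * factℤ c * factℤ (k ℕ.+ c)) ≡
    tilings# M k a b (suc c) * (factℤ (k ℕ.+ (a ℕ.+ c)) * factℤ (k ℕ.+ (a ℕ.+ c)) * factℤ b * factℤ (k ℕ.+ b))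
  exchange-tilings M k a b c M> with k ℕ.+ a in ka
  -- For k + a = 0 there are no walkers, and A or B may be 0, so that the parameters α = A - 1 and β
  -- = B - 1 of `Exchange` need not exist. Both counts are 1, from the empty configuration.
  exchange-tilings M zero zero b c M> | zero =
    trans (cong (_* (factℤ b * factℤ (b ℕ.+ 0) * factℤ c * factℤ c)) (walks#-[] (+ c) (suc b ℕ.+ c)))
   (trans (cong (λ z → + 1 * (factℤ b * factℤ z * factℤ c * factℤ c)) (ℕₚ.+-identityʳ b))
   (trans (q (factℤ b) (factℤ c)) (cong (_* (factℤ c * factℤ c * factℤ b * factℤ b)) (sym (walks#-[] (+ suc c) (b ℕ.+ suc c))))))
    where
    q : ∀ b c → + 1 * (b * b * c * c) ≡ + 1 * (c * c * b * b)
    q = solve-∀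
  exchange-tilings M zero (suc a) b c M> | zero with () ← ka
  exchange-tilings M (suc k) a b c M> | zero with () ← ka
  exchange-tilings M k a b c M> | suc p =
    trans (cong₂ (λ t z → t * (factℤ (a ℕ.+ b) * factℤ (z ℕ.+ k) * factℤ c * factℤ (k ℕ.+ c)))
            (cong (λ A → Σᵗ a M (λ rs → Walks.walks# (+ A) (k ℕ.+ (a ℕ.+ a)) (k ℕ.+ (suc b ℕ.+ c)) (symm k rs))) (sym sα)) (sym sβ))
   (trans (E.exchange-fact b c sα sβ)
          (cong₂ (λ t z → t * (factℤ z * factℤ z * factℤ b * factℤ (k ℕ.+ b)))
            (cong₂ (λ A n → Σᵗ a M (λ rs → Walks.walks# (+ A) (k ℕ.+ (a ℕ.+ a)) n (symm k rs))) (sα′) (cong (k ℕ.+_) (sym (ℕₚ.+-suc b c)))) sα))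
    where
    assoc : ∀ c → k ℕ.+ a ℕ.+ c ≡ k ℕ.+ (a ℕ.+ c)
    assoc = ℕₚ.+-assoc k a
    sα : suc (p ℕ.+ c) ≡ k ℕ.+ (a ℕ.+ c)
    sα = trans (cong (ℕ._+ c) (sym ka)) (assoc c)
    sβ : suc (p ℕ.+ b) ≡ k ℕ.+ (a ℕ.+ b)
    sβ = trans (cong (ℕ._+ b) (sym ka)) (assoc b)
    sα′ : suc (suc (p ℕ.+ c)) ≡ k ℕ.+ (a ℕ.+ suc c)
    sα′ = trans (cong suc sα) (trans (sym (ℕₚ.+-suc k (a ℕ.+ c))) (cong (k ℕ.+_) (sym (ℕₚ.+-suc a c))))
    p+a : ℕ.pred (k ℕ.+ (a ℕ.+ a)) ≡ p ℕ.+ a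
    p+a = cong ℕ.pred (trans (sym (assoc a)) (cong (ℕ._+ a) ka))
    size : k ℕ.+ (suc b ℕ.+ c) ℕ.+ ℕ.pred (k ℕ.+ (a ℕ.+ a)) ≡ suc (p ℕ.+ c ℕ.+ suc (p ℕ.+ b))
    size = trans (cong (k ℕ.+ (suc b ℕ.+ c) ℕ.+_) p+a) (trans (r₁ k a b c p) (trans (cong (λ z → suc (z ℕ.+ (b ℕ.+ c ℕ.+ p))) ka) (r₂ b c p)))
      where
      r₁ : ∀ k a b c p → k ℕ.+ (suc b ℕ.+ c) ℕ.+ (p ℕ.+ a) ≡ suc (k ℕ.+ a ℕ.+ (b ℕ.+ c ℕ.+ p))
      r₁ = ℕ-Solver.solve-∀
      r₂ : ∀ b c p → suc (suc p ℕ.+ (b ℕ.+ c ℕ.+ p)) ≡ suc (p ℕ.+ c ℕ.+ suc (p ℕ.+ b))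
      r₂ = ℕ-Solver.solve-∀
    bound : ∀ d e → k ℕ.+ (a ℕ.+ (d ℕ.+ e)) ℕ.< M → p ℕ.+ d ℕ.< M
    bound d e M> = ℕₚ.≤-<-trans (ℕₚ.≤-trans (ℕₚ.+-monoˡ-≤ d (ℕₚ.≤-trans (ℕₚ.n≤1+n p) (ℕₚ.≤-reflexive (sym ka))))
      (ℕₚ.≤-trans (ℕₚ.≤-reflexive (assoc d)) (ℕₚ.+-monoʳ-≤ k (ℕₚ.+-monoʳ-≤ a (ℕₚ.m≤m+n d e))))) M>
    module E = Exchange k a (k ℕ.+ (suc b ℕ.+ c)) (p ℕ.+ c) (p ℕ.+ b) M size
      (trans size (cong suc (ℕₚ.+-suc (p ℕ.+ c) (p ℕ.+ b))))
      (bound c b (subst (λ z → k ℕ.+ (a ℕ.+ z) ℕ.< M) (ℕₚ.+-comm b c) M>)) (bound b c M>)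

  tilings#-core : ∀ M k a c → 0 ℕ.< k ℕ.+ (a ℕ.+ a) → k ℕ.+ a ℕ.≤ M → tilings# M k a 0 c ≡ core-walks k a c
  tilings#-core M k a c 0<x k+a≤M with k ℕ.+ a in ka
  tilings#-core M zero (suc a) c 0<x k+a≤M | zero with () ← ka
  tilings#-core M (suc k) a c 0<x k+a≤M | zero with () ← ka
  ... | suc p =
    trans (cong (λ A → Σᵗ a M (λ rs → Walks.walks# (+ A) (k ℕ.+ (a ℕ.+ a)) (k ℕ.+ c) (symm k rs))) (sym sα))
   (trans (total-single k a (k ℕ.+ c) (p ℕ.+ c) p size (sym ka) M (subst (ℕ._≤ M) (sym ka) k+a≤M))
          (cong (λ A → Walks.walks# (+ A) (k ℕ.+ (a ℕ.+ a)) (k ℕ.+ c) (symm k (desc (+ k) a))) sα))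
    where
    sα : suc (p ℕ.+ c) ≡ k ℕ.+ (a ℕ.+ c)
    sα = trans (cong (ℕ._+ c) (sym ka)) (ℕₚ.+-assoc k a c)
    size : k ℕ.+ c ℕ.+ ℕ.pred (k ℕ.+ (a ℕ.+ a)) ≡ suc (p ℕ.+ c ℕ.+ p)
    size = trans (cong (λ z → k ℕ.+ c ℕ.+ ℕ.pred z) (trans (sym (ℕₚ.+-assoc k a a)) (cong (ℕ._+ a) ka)))
      (trans (r₁ k a c p) (trans (cong (ℕ._+ (c ℕ.+ p)) ka) (r₂ c p)))
      where
      r₁ : ∀ k a c p → k ℕ.+ c ℕ.+ (p ℕ.+ a) ≡ k ℕ.+ a ℕ.+ (c ℕ.+ p)
      r₁ = ℕ-Solver.solve-∀
      r₂ : ∀ c p → suc p ℕ.+ (c ℕ.+ p) ≡ suc (p ℕ.+ c ℕ.+ p)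
      r₂ = ℕ-Solver.solve-∀

-- The rational products as quotients of superfactorials

module Fractions where
  open import Data.Nat using (_+_; _*_; _≤_; _<_)

  ⟦_⟧ : ℕ → ℚ
  ⟦ n ⟧ = (ℤ.+ n) ℚ./ 1

  ⟦⟧-* : ∀ m n → ⟦ m * n ⟧ ≡ ⟦ m ⟧ ℚ.* ⟦ n ⟧
  ⟦⟧-* m n = ℚₚ.toℚᵘ-injective (ℚᵘₚ.≃-trans (ℚₚ.toℚᵘ-fromℚᵘ (mkℚᵘ (ℤ.+ (m * n)) 0))
    (ℚᵘₚ.≃-trans (*≡* (cong (ℤ._* ℤ.+ 1) (ℤₚ.pos-* m n)))
    (ℚᵘₚ.≃-sym (ℚᵘₚ.≃-trans (ℚₚ.toℚᵘ-homo-* ⟦ m ⟧ ⟦ n ⟧)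
      (ℚᵘₚ.*-cong (ℚₚ.toℚᵘ-fromℚᵘ (mkℚᵘ (ℤ.+ m) 0)) (ℚₚ.toℚᵘ-fromℚᵘ (mkℚᵘ (ℤ.+ n) 0)))))))

  -- A fraction in cross-multiplied form, not necessarily reduced, so that comparing rational
  -- products becomes an identity between natural numbers.
  record Frac (q : ℚ) (n d : ℕ) : Set where
    constructor frac
    field scaled : q ℚ.* ⟦ d ⟧ ≡ ⟦ n ⟧

  ratio-frac : ∀ n d → 0 < d → Frac (ratio n d) n d
  ratio-frac n (suc d) _ = frac (ℚₚ.toℚᵘ-injective (ℚᵘₚ.≃-trans (ℚₚ.toℚᵘ-homo-* (ratio n (suc d)) ⟦ suc d ⟧)
    (ℚᵘₚ.≃-trans (ℚᵘₚ.*-cong (ℚₚ.toℚᵘ-fromℚᵘ (mkℚᵘ (ℤ.+ n) d)) (ℚₚ.toℚᵘ-fromℚᵘ (mkℚᵘ (ℤ.+ suc d) 0)))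
    (ℚᵘₚ.≃-trans (*≡* eq) (ℚᵘₚ.≃-sym (ℚₚ.toℚᵘ-fromℚᵘ (mkℚᵘ (ℤ.+ n) 0)))))))
    where
    eq : ℤ.+ n ℤ.* ℤ.+ suc d ℤ.* ℤ.+ 1 ≡ ℤ.+ n ℤ.* ℤ.+ (suc d * 1)
    eq = trans (ℤₚ.*-identityʳ _) (cong (λ z → ℤ.+ n ℤ.* ℤ.+ z) (sym (ℕₚ.*-identityʳ (suc d))))

  frac-* : ∀ {p q n m d e} → Frac p n d → Frac q m e → Frac (p ℚ.* q) (n * m) (d * e)
  frac-* {p} {q} {n} {m} {d} {e} (frac f) (frac g) = frac (
    trans (cong (p ℚ.* q ℚ.*_) (⟦⟧-* d e))
   (trans (ℚₚ.*-assoc p q (⟦ d ⟧ ℚ.* ⟦ e ⟧))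
   (trans (cong (p ℚ.*_) (trans (sym (ℚₚ.*-assoc q ⟦ d ⟧ ⟦ e ⟧)) (trans (cong (ℚ._* ⟦ e ⟧) (ℚₚ.*-comm q ⟦ d ⟧)) (ℚₚ.*-assoc ⟦ d ⟧ q ⟦ e ⟧))))
   (trans (sym (ℚₚ.*-assoc p ⟦ d ⟧ (q ℚ.* ⟦ e ⟧)))
   (trans (cong₂ ℚ._*_ f g) (sym (⟦⟧-* n m)))))))

  ⟦⟧-cancelʳ : ∀ {p q} d → 0 < d → p ℚ.* ⟦ d ⟧ ≡ q ℚ.* ⟦ d ⟧ → p ≡ q
  ⟦⟧-cancelʳ {p} {q} (suc d) 0<d e = trans (sym (undo p)) (trans (cong (ℚ._* ratio 1 (suc d)) e) (undo q))
    where
    one : ⟦ suc d ⟧ ℚ.* ratio 1 (suc d) ≡ 1ℚ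
    one = trans (ℚₚ.*-comm ⟦ suc d ⟧ (ratio 1 (suc d))) (Frac.scaled (ratio-frac 1 (suc d) 0<d))
    undo : ∀ p → p ℚ.* ⟦ suc d ⟧ ℚ.* ratio 1 (suc d) ≡ p
    undo p = trans (ℚₚ.*-assoc p _ _) (trans (cong (p ℚ.*_) one) (ℚₚ.*-identityʳ p))

  frac-unique : ∀ {p q n d} → 0 < d → Frac p n d → Frac q n d → p ≡ q
  frac-unique {d = d} 0<d (frac f) (frac g) = ⟦⟧-cancelʳ d 0<d (trans f (sym g))

  frac-reduce : ∀ {p n d n′ d′} → 0 < d → Frac p n d → n * d′ ≡ n′ * d → Frac p n′ d′
  frac-reduce {p} {n} {d} {n′} {d′} 0<d (frac f) e = frac (⟦⟧-cancelʳ d 0<d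
    (trans (ℚₚ.*-assoc p _ _) (trans (cong (p ℚ.*_) (ℚₚ.*-comm ⟦ d′ ⟧ ⟦ d ⟧))
    (trans (sym (ℚₚ.*-assoc p _ _)) (trans (cong (ℚ._* ⟦ d′ ⟧) f)
    (trans (sym (⟦⟧-* n d′)) (trans (cong ⟦_⟧ e) (⟦⟧-* n′ d))))))))

  -- A telescoping product. The start asks for `N 0 ≡ D 0` rather than for 1, so that superfactorial
  -- quotients can carry the constants that normalise them at the empty product.
  frac-∏ : ∀ {f} (N D n d : ℕ → ℕ) → N 0 ≡ D 0 → (∀ i → N (suc i) ≡ N i * n i) → (∀ i → D (suc i) ≡ D i * d i) →
    (∀ i → Frac (f (suc i)) (n i) (d i)) → ∀ m → Frac (∏ m f) (N m) (D m)
  frac-∏ N D n d N₀ N₊ D₊ fr zero = frac (trans (ℚₚ.*-identityˡ _) (cong ⟦_⟧ (sym N₀)))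
  frac-∏ {f} N D n d N₀ N₊ D₊ fr (suc m) =
    subst₂ (Frac (∏ m f ℚ.* f (suc m))) (sym (N₊ m)) (sym (D₊ m))
      (frac-* {∏ m f} {f (suc m)} {N m} {n m} {D m} {d m} (frac-∏ N D n d N₀ N₊ D₊ fr m) (fr m))

  -- The superfactorial 0! 1! ... (n - 1)!, that is, Barnes' G at n + 1.
  H : ℕ → ℕ
  H zero = 1
  H (suc n) = H n * n !

  0<! : ∀ n → 0 < n !
  0<! = ℕₚ.1≤n!

  0<* : ∀ {m n} → 0 < m → 0 < n → 0 < m * n
  0<* = ℕₚ.*-mono-≤

  0<H : ∀ n → 0 < H n
  0<H zero = ℕₚ.≤-refl
  0<H (suc n) = 0<* (0<H n) (0<! n)

  poch-fact : ∀ s k → poch (suc s) k * s ! ≡ (s + k) !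
  poch-fact s zero = trans (ℕₚ.+-identityʳ (s !)) (cong _! (sym (ℕₚ.+-identityʳ s)))
  poch-fact s (suc k) =
    trans (q (poch (suc s) k) (suc s + k) (s !))
   (trans (cong ((suc s + k) *_) (poch-fact s k)) (cong _! (sym (ℕₚ.+-suc s k))))
    where
    q : ∀ p x f → p * x * f ≡ x * (p * f)
    q = ℕ-Solver.solve-∀

  0<poch : ∀ s k → 0 < poch (suc s) k
  0<poch s zero = ℕₚ.≤-refl
  0<poch s (suc k) = 0<* (0<poch s k) (ℕ.s≤s ℕ.z≤n)

  poch-frac : ∀ s t q → Frac (ratio (poch (suc s) q) (poch (suc t) q)) ((s + q) ! * t !) ((t + q) ! * s !)
  poch-frac s t q = frac-reduce {ratio (poch (suc s) q) (poch (suc t) q)} (0<poch t q) (ratio-frac _ _ (0<poch t q))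
    (trans (cong (λ z → poch (suc s) q * (z * s !)) (sym (poch-fact t q)))
    (trans (r (poch (suc s) q) (poch (suc t) q) (t !) (s !)) (cong (λ z → z * t ! * poch (suc t) q) (poch-fact s q))))
    where
    r : ∀ p u t s → p * (u * t * s) ≡ p * s * t * u
    r = ℕ-Solver.solve-∀

  pochs-frac : ∀ s t q i → Frac (ratio (poch (s + suc i) q) (poch (t + suc i) q))
    ((s + q + i) ! * (t + i) !) ((t + q + i) ! * (s + i) !)
  pochs-frac s t q i =
    subst₂ (λ S T → Frac (ratio (poch S q) (poch T q)) ((s + q + i) ! * (t + i) !) ((t + q + i) ! * (s + i) !))
      (sym (ℕₚ.+-suc s i)) (sym (ℕₚ.+-suc t i))
      (subst₂ (λ x y → Frac (ratio (poch (suc (s + i)) q) (poch (suc (t + i)) q)) (x ! * (t + i) !) (y ! * (s + i) !))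
        (r s i q) (r t i q) (poch-frac (s + i) (t + i) q))
    where
    r : ∀ s i q → s + i + q ≡ s + q + i
    r = ℕ-Solver.solve-∀

  H-suc : ∀ s m → H (s + suc m) ≡ H (s + m) * (s + m) !
  H-suc s m = cong H (ℕₚ.+-suc s m)

  -- Numerator and denominator of ∏_{i=1}^m (s + i)_q / (t + i)_q. The bracketed last factors do not
  -- depend on m; they equalise the two at m = 0.
  Gn Gd : ℕ → ℕ → ℕ → ℕ → ℕ
  Gn s t q m = H (s + q + m) * H (t + m) * (H (t + q) * H s)
  Gd s t q m = H (t + q + m) * H (s + m) * (H (s + q) * H t)

  private
    regroup : ∀ h x g y z → h * x * (g * y) * z ≡ h * g * z * (x * y)
    regroup = ℕ-Solver.solve-∀

  Gn-zero : ∀ s t q → Gn s t q 0 ≡ Gd s t q 0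
  Gn-zero s t q =
    trans (cong₂ (λ x y → H x * H y * (H (t + q) * H s)) (ℕₚ.+-identityʳ (s + q)) (ℕₚ.+-identityʳ t))
   (trans (r (H (s + q)) (H t) (H (t + q)) (H s))
          (sym (cong₂ (λ x y → H x * H y * (H (s + q) * H t)) (ℕₚ.+-identityʳ (t + q)) (ℕₚ.+-identityʳ s))))
    where
    r : ∀ a b c d → a * b * (c * d) ≡ c * d * (a * b)
    r = ℕ-Solver.solve-∀

  Gn-suc : ∀ s t q m → Gn s t q (suc m) ≡ Gn s t q m * ((s + q + m) ! * (t + m) !)
  Gn-suc s t q m = trans (cong₂ (λ x y → x * y * (H (t + q) * H s)) (H-suc (s + q) m) (H-suc t m))
    (regroup (H (s + q + m)) ((s + q + m) !) (H (t + m)) ((t + m) !) (H (t + q) * H s))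

  Gd-suc : ∀ s t q m → Gd s t q (suc m) ≡ Gd s t q m * ((t + q + m) ! * (s + m) !)
  Gd-suc s t q m = trans (cong₂ (λ x y → x * y * (H (s + q) * H t)) (H-suc (t + q) m) (H-suc s m))
    (regroup (H (t + q + m)) ((t + q + m) !) (H (s + m)) ((s + m) !) (H (s + q) * H t))

  0<Gd : ∀ s t q m → 0 < Gd s t q m
  0<Gd s t q m = 0<* (0<* (0<H (t + q + m)) (0<H (s + m))) (0<* (0<H (s + q)) (0<H t))

  ∏-pochs : ∀ s t q m → Frac (∏ m λ i → ratio (poch (s + i) q) (poch (t + i) q)) (Gn s t q m) (Gd s t q m)
  ∏-pochs s t q = frac-∏ (Gn s t q) (Gd s t q) _ _ (Gn-zero s t q) (Gn-suc s t q) (Gd-suc s t q) (pochs-frac s t q)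

  ∏-pochs₂ : ∀ s t q q′ m → Frac (∏ m λ i → ratio (poch (s + i) q) (poch (t + i) q) ℚ.* ratio (poch (s + i) q′) (poch (t + i) q′))
    (Gn s t q m * Gn s t q′ m) (Gd s t q m * Gd s t q′ m)
  ∏-pochs₂ s t q q′ = frac-∏ (λ m → Gn s t q m * Gn s t q′ m) (λ m → Gd s t q m * Gd s t q′ m) _ _
    (cong₂ _*_ (Gn-zero s t q) (Gn-zero s t q′))
    (λ i → trans (cong₂ _*_ (Gn-suc s t q i) (Gn-suc s t q′ i)) (r (Gn s t q i) ((s + q + i) ! * (t + i) !) (Gn s t q′ i) ((s + q′ + i) ! * (t + i) !)))
    (λ i → trans (cong₂ _*_ (Gd-suc s t q i) (Gd-suc s t q′ i)) (r (Gd s t q i) ((t + q + i) ! * (s + i) !) (Gd s t q′ i) ((t + q′ + i) ! * (s + i) !)))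
    (λ i → frac-* {ratio (poch (s + suc i) q) (poch (t + suc i) q)} (pochs-frac s t q i) (pochs-frac s t q′ i))
    where
    r : ∀ a b c d → a * b * (c * d) ≡ a * c * (b * d)
    r = ℕ-Solver.solve-∀

  -- MacMahon's count in the form H (x + y + z) H x H y H z over H (x + y) H (y + z) H (z + x). The
  -- variable of the outermost product comes last.
  Pn Pd : ℕ → ℕ → ℕ → ℕ
  Pn y z x = H (y + z + x) * H x * (H y * H z)
  Pd y z x = H (z + x) * H (y + x) * H (y + z)

  P-frac : ∀ x y z → Frac (P x y z) (Pn y z x) (Pd y z x)
  P-frac x y z = frac-∏ (Pn y z) (Pd y z) (λ i → (y + z + i) ! * i !) (λ i → (z + i) ! * (y + i) !) base
    (λ i → trans (cong (λ u → u * (H i * i !) * (H y * H z)) (H-suc (y + z) i)) (regroup (H (y + z + i)) ((y + z + i) !) (H i) (i !) (H y * H z)))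
    (λ i → trans (cong₂ (λ u v → u * v * H (y + z)) (H-suc z i) (H-suc y i)) (regroup (H (z + i)) ((z + i) !) (H (y + i)) ((y + i) !) (H (y + z))))
    plane x
    where
    base : Pn y z 0 ≡ Pd y z 0
    base = trans (cong (λ u → H u * 1 * (H y * H z)) (ℕₚ.+-identityʳ (y + z)))
      (trans (r (H (y + z)) (H y) (H z)) (sym (cong₂ (λ u v → H u * H v * H (y + z)) (ℕₚ.+-identityʳ z) (ℕₚ.+-identityʳ y))))
      where
      r : ∀ a b c → a * 1 * (b * c) ≡ c * b * a
      r = ℕ-Solver.solve-∀
    line : ∀ i j → Frac (∏ z λ k → ratio (suc i + suc j + k ℕ.∸ 1) (suc i + suc j + k ℕ.∸ 2)) (suc (i + j + z)) (suc (i + j))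
    line i j = telescope z
      where
      term : ∀ k → Frac (ratio (suc i + suc j + suc k ℕ.∸ 1) (suc i + suc j + suc k ℕ.∸ 2)) (suc (suc (i + j + k))) (suc (i + j + k))
      -- Rewriting the index sum with three successors makes both truncated subtractions exact and
      -- the denominator positive.
      term k = subst (λ w → Frac (ratio (w ℕ.∸ 1) (w ℕ.∸ 2)) (suc (suc (i + j + k))) (suc (i + j + k))) (sym (r i j k)) (ratio-frac _ _ (ℕ.s≤s ℕ.z≤n))
        where
        r : ∀ i j k → suc i + suc j + suc k ≡ suc (suc (suc (i + j + k)))
        r = ℕ-Solver.solve-∀
      telescope : ∀ z → Frac (∏ z λ k → ratio (suc i + suc j + k ℕ.∸ 1) (suc i + suc j + k ℕ.∸ 2)) (suc (i + j + z)) (suc (i + j))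
      telescope zero = frac (trans (ℚₚ.*-identityˡ _) (cong (λ w → ⟦ suc w ⟧) (sym (ℕₚ.+-identityʳ (i + j)))))
      telescope (suc z) = frac-reduce {∏ (suc z) λ k → ratio (suc i + suc j + k ℕ.∸ 1) (suc i + suc j + k ℕ.∸ 2)} (0<* {suc (i + j)} {suc (i + j + z)} (ℕ.s≤s ℕ.z≤n) (ℕ.s≤s ℕ.z≤n))
        (frac-* {∏ z λ k → ratio (suc i + suc j + k ℕ.∸ 1) (suc i + suc j + k ℕ.∸ 2)} (telescope z) (term z))
        (trans (r (suc (i + j + z)) (suc (suc (i + j + z))) (suc (i + j))) (cong (λ w → suc w * (suc (i + j) * suc (i + j + z))) (sym (ℕₚ.+-suc (i + j) z))))
        where
        r : ∀ a b c → a * b * c ≡ b * (c * a)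
        r = ℕ-Solver.solve-∀
    plane : ∀ i → Frac (∏ y λ j → ∏ z λ k → ratio (suc i + j + k ℕ.∸ 1) (suc i + j + k ℕ.∸ 2)) ((y + z + i) ! * i !) ((z + i) ! * (y + i) !)
    plane i = subst₂ (Frac (∏ y λ j → ∏ z λ k → ratio (suc i + j + k ℕ.∸ 1) (suc i + j + k ℕ.∸ 2)))
      (cong (λ w → w ! * i !) (r i y z)) (cong₂ (λ u v → u ! * v !) (ℕₚ.+-comm i z) (ℕₚ.+-comm i y))
      (frac-∏ (λ y → (i + y + z) ! * i !) (λ y → (i + z) ! * (i + y) !) (λ j → suc (i + j + z)) (λ j → suc (i + j))
        (cong₂ (λ u v → (u + z) ! * v !) (ℕₚ.+-identityʳ i) (sym (ℕₚ.+-identityʳ i)))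
        (λ j → trans (cong (λ w → (w + z) ! * i !) (ℕₚ.+-suc i j)) (r₁ (suc (i + j + z)) ((i + j + z) !) (i !)))
        (λ j → trans (cong (λ w → (i + z) ! * w !) (ℕₚ.+-suc i j)) (r₂ ((i + z) !) (suc (i + j)) ((i + j) !)))
        (line i) y)
      where
      r : ∀ i y z → i + y + z ≡ y + z + i
      r = ℕ-Solver.solve-∀
      r₁ : ∀ s f g → s * f * g ≡ f * g * s
      r₁ = ℕ-Solver.solve-∀
      r₂ : ∀ f s g → f * (s * g) ≡ f * g * s
      r₂ = ℕ-Solver.solve-∀

-- Comparison of the tiling count with the product formula

module Product where
  open import Data.Integer using (_*_)
  open Evaluation
  open BaseCase
  open ClosedForm
  open Fractions

  Hℤ : ℕ → ℤ
  Hℤ n = + H n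

  Hℤ-suc : ∀ n → Hℤ (suc n) ≡ Hℤ n * factℤ n
  Hℤ-suc n = pos-* (H n) (n !)

  Hℤ≡suc : ∀ {m} n → m ≡ suc n → Hℤ m ≡ Hℤ n * factℤ n
  Hℤ≡suc n e = trans (cong Hℤ e) (Hℤ-suc n)

  -- The first line of `num` is the numerator of P(a+k, b+k, c), the second that of P(a, b, c+k). In
  -- `den` the squares arise because H (k + b + c) and H (a + k + c) occur in both denominators.
  num den : ℕ → ℕ → ℕ → ℕ → ℤ
  num k a b c =
    Hℤ (a ℕ.+ k) * Hℤ (k ℕ.+ b) * Hℤ c * Hℤ (a ℕ.+ k ℕ.+ (b ℕ.+ k) ℕ.+ c) *
    (Hℤ a * Hℤ b * Hℤ (k ℕ.+ c) * Hℤ (a ℕ.+ k ℕ.+ b ℕ.+ c))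
  den k a b c =
    Hℤ (a ℕ.+ k ℕ.+ (b ℕ.+ k)) * Hℤ (a ℕ.+ b) * (Hℤ (k ℕ.+ b ℕ.+ c) * Hℤ (k ℕ.+ b ℕ.+ c)) *
    (Hℤ (a ℕ.+ k ℕ.+ c) * Hℤ (a ℕ.+ k ℕ.+ c))

  private
    n₁ : ∀ a k b → a ℕ.+ k ℕ.+ (suc b ℕ.+ k) ≡ suc (a ℕ.+ k ℕ.+ (b ℕ.+ k))
    n₁ = ℕ-Solver.solve-∀
    n₂ : ∀ a k b → k ℕ.+ (a ℕ.+ b) ℕ.+ k ≡ a ℕ.+ k ℕ.+ (b ℕ.+ k)
    n₂ = ℕ-Solver.solve-∀
    n₃ : ∀ a k c → k ℕ.+ (a ℕ.+ c) ≡ a ℕ.+ k ℕ.+ c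
    n₃ = ℕ-Solver.solve-∀
    n₄ : ∀ k b c → k ℕ.+ suc b ℕ.+ c ≡ k ℕ.+ b ℕ.+ suc c
    n₄ = ℕ-Solver.solve-∀
    n₅ : ∀ a k b c → a ℕ.+ k ℕ.+ (suc b ℕ.+ k) ℕ.+ c ≡ a ℕ.+ k ℕ.+ (b ℕ.+ k) ℕ.+ suc c
    n₅ = ℕ-Solver.solve-∀
    n₆ : ∀ a k b c → a ℕ.+ k ℕ.+ suc b ℕ.+ c ≡ a ℕ.+ k ℕ.+ b ℕ.+ suc c
    n₆ = ℕ-Solver.solve-∀
    n₇ : ∀ k a c → k ℕ.+ (a ℕ.+ c) ℕ.+ k ≡ a ℕ.+ k ℕ.+ k ℕ.+ c
    n₇ = ℕ-Solver.solve-∀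

  -- Superfactorials whose argument contains b + c are unchanged when c + 1 and b become c and b +
  -- 1. Each of the others that involves b or c gains or loses one factorial, and these factorials
  -- are exactly those of the exchange relation.
  step-b : ∀ k a b c (t₁ t₂ : ℤ) →
    t₁ * (factℤ (a ℕ.+ b) * factℤ (k ℕ.+ (a ℕ.+ b) ℕ.+ k) * factℤ c * factℤ (k ℕ.+ c)) ≡
    t₂ * (factℤ (k ℕ.+ (a ℕ.+ c)) * factℤ (k ℕ.+ (a ℕ.+ c)) * factℤ b * factℤ (k ℕ.+ b)) →
    t₂ * den k a b (suc c) ≡ num k a b (suc c) → t₁ * den k a (suc b) c ≡ num k a (suc b) c
  step-b k a b c t₁ t₂ ex ih =
    cancel _ _ (fq * ft) (*-≢0 (factℤ≢0 c) (factℤ≢0 (k ℕ.+ c)))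
    (begin
      t₁ * den k a (suc b) c * (fq * ft)
    ≡⟨ cong (λ d → t₁ * d * (fq * ft)) (cong₂ (λ x y → x * y * (z * z))
         (cong₂ _*_ (Hℤ≡suc _ (n₁ a k b)) (Hℤ≡suc _ (ℕₚ.+-suc a b)))
         (cong (λ n → Hℤ n * Hℤ n) (n₄ k b c))) ⟩
      t₁ * (u * fu * (v * fv) * (w * w) * (z * z)) * (fq * ft)
    ≡⟨ q₁ t₁ u fu v fv w z fq ft ⟩
      t₁ * (fv * fu * fq * ft) * (u * v * (w * w) * (z * z))
    ≡⟨ cong (λ x → x * (u * v * (w * w) * (z * z))) (trans (cong (λ n → t₁ * (fv * factℤ n * fq * ft)) (sym (n₂ a k b)))
         (trans ex (cong (λ n → t₂ * (factℤ n * factℤ n * fs * fp)) (n₃ a k c)))) ⟩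
      t₂ * (fz * fz * fs * fp) * (u * v * (w * w) * (z * z))
    ≡⟨ q₂ t₂ fz fs fp u v w z ⟩
      t₂ * (u * v * (w * w) * (z * fz * (z * fz))) * (fs * fp)
    ≡⟨ cong (λ x → t₂ * (u * v * (w * w) * (x * x)) * (fs * fp)) (sym (Hℤ≡suc _ (ℕₚ.+-suc (a ℕ.+ k) c))) ⟩
      t₂ * den k a b (suc c) * (fs * fp)
    ≡⟨ cong (_* (fs * fp)) ih ⟩
      num k a b (suc c) * (fs * fp)
    ≡⟨ cong₂ (λ x y → g * p * x * r * (e * s * y * h) * (fs * fp)) (Hℤ-suc c) (Hℤ≡suc _ (ℕₚ.+-suc k c)) ⟩
      g * p * (q * fq) * r * (e * s * (t * ft) * h) * (fs * fp)
    ≡⟨ q₃ g p q fq r e s t ft h fs fp ⟩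
      g * (p * fp) * q * r * (e * (s * fs) * t * h) * (fq * ft)
    ≡⟨ cong (_* (fq * ft)) (cong₂ _*_
         (cong₂ (λ x n → g * x * q * Hℤ n) (sym (Hℤ≡suc _ (ℕₚ.+-suc k b))) (sym (n₅ a k b c)))
         (cong₂ (λ x n → e * x * t * Hℤ n) (sym (Hℤ-suc b)) (sym (n₆ a k b c)))) ⟩
      num k a (suc b) c * (fq * ft)
    ∎)
    where
    u fu v fv w z fz g p fp q fq r e s fs t ft h : ℤ
    u = Hℤ (a ℕ.+ k ℕ.+ (b ℕ.+ k))
    fu = factℤ (a ℕ.+ k ℕ.+ (b ℕ.+ k))
    v = Hℤ (a ℕ.+ b)
    fv = factℤ (a ℕ.+ b)
    w = Hℤ (k ℕ.+ b ℕ.+ suc c)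
    z = Hℤ (a ℕ.+ k ℕ.+ c)
    fz = factℤ (a ℕ.+ k ℕ.+ c)
    g = Hℤ (a ℕ.+ k)
    p = Hℤ (k ℕ.+ b)
    fp = factℤ (k ℕ.+ b)
    q = Hℤ c
    fq = factℤ c
    r = Hℤ (a ℕ.+ k ℕ.+ (b ℕ.+ k) ℕ.+ suc c)
    e = Hℤ a
    s = Hℤ b
    fs = factℤ b
    t = Hℤ (k ℕ.+ c)
    ft = factℤ (k ℕ.+ c)
    h = Hℤ (a ℕ.+ k ℕ.+ b ℕ.+ suc c)
    q₁ : ∀ t u fu v fv w z fq ft → t * (u * fu * (v * fv) * (w * w) * (z * z)) * (fq * ft) ≡ t * (fv * fu * fq * ft) * (u * v * (w * w) * (z * z))
    q₁ = solve-∀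
    q₂ : ∀ t fz fs fp u v w z → t * (fz * fz * fs * fp) * (u * v * (w * w) * (z * z)) ≡ t * (u * v * (w * w) * (z * fz * (z * fz))) * (fs * fp)
    q₂ = solve-∀
    q₃ : ∀ g p q fq r e s t ft h fs fp → g * p * (q * fq) * r * (e * s * (t * ft) * h) * (fs * fp) ≡ g * (p * fp) * q * r * (e * (s * fs) * t * h) * (fq * ft)
    q₃ = solve-∀

  step-c : ∀ k a c (t₁ t₂ : ℤ) →
    t₂ * (factℤ (k ℕ.+ (a ℕ.+ c)) * factℤ (k ℕ.+ c)) ≡ t₁ * (factℤ c * factℤ (k ℕ.+ (a ℕ.+ c) ℕ.+ k)) →
    t₁ * den k a 0 c ≡ num k a 0 c → t₂ * den k a 0 (suc c) ≡ num k a 0 (suc c)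
  step-c k a c t₁ t₂ ex ih =
    begin
      t₂ * den k a 0 (suc c)
    ≡⟨ cong₂ (λ x y → t₂ * (u * v * (x * x) * (y * y))) (Hℤ≡suc _ w-suc) (Hℤ≡suc _ (ℕₚ.+-suc (a ℕ.+ k) c)) ⟩
      t₂ * (u * v * (w * fw * (w * fw)) * (z * fz * (z * fz)))
    ≡⟨ q₁ t₂ u v w fw z fz ⟩
      t₂ * (fz * fw) * (u * v * (w * w) * (z * z) * (fw * fz))
    ≡⟨ cong (_* (u * v * (w * w) * (z * z) * (fw * fz))) ex′ ⟩
      t₁ * (fq * fr) * (u * v * (w * w) * (z * z) * (fw * fz))
    ≡⟨ q₂ t₁ fq fr (u * v * (w * w) * (z * z)) fw fz ⟩
      t₁ * den k a 0 c * (fq * fr * fw * fz)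
    ≡⟨ cong (_* (fq * fr * fw * fz)) ih ⟩
      num k a 0 c * (fq * fr * fw * fz)
    ≡⟨ q₃ g p q r e t h fq fr fw fz ⟩
      g * p * (q * fq) * (r * fr) * (e * + 1 * (t * fw) * (h * fz))
    ≡⟨ cong₂ _*_
         (cong₂ (λ x y → g * p * x * y) (sym (Hℤ-suc c)) (sym (Hℤ≡suc _ (ℕₚ.+-suc (a ℕ.+ k ℕ.+ k) c))))
         (cong₂ (λ x y → e * + 1 * x * y) (sym t-suc) (sym h-suc)) ⟩
      num k a 0 (suc c)
    ∎
    where
    u v w fw z fz g p q fq r fr e t h : ℤ
    u = Hℤ (a ℕ.+ k ℕ.+ k)
    v = Hℤ (a ℕ.+ 0)
    w = Hℤ (k ℕ.+ 0 ℕ.+ c)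
    fw = factℤ (k ℕ.+ 0 ℕ.+ c)
    z = Hℤ (a ℕ.+ k ℕ.+ c)
    fz = factℤ (a ℕ.+ k ℕ.+ c)
    g = Hℤ (a ℕ.+ k)
    p = Hℤ (k ℕ.+ 0)
    q = Hℤ c
    fq = factℤ c
    r = Hℤ (a ℕ.+ k ℕ.+ k ℕ.+ c)
    fr = factℤ (a ℕ.+ k ℕ.+ k ℕ.+ c)
    e = Hℤ a
    t = Hℤ (k ℕ.+ c)
    h = Hℤ (a ℕ.+ k ℕ.+ 0 ℕ.+ c)
    w-suc : k ℕ.+ 0 ℕ.+ suc c ≡ suc (k ℕ.+ 0 ℕ.+ c)
    w-suc = ℕₚ.+-suc (k ℕ.+ 0) c
    ex′ : t₂ * (fz * fw) ≡ t₁ * (fq * fr)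
    ex′ = trans (cong₂ (λ m n → t₂ * (factℤ m * factℤ n)) (sym (n₃ a k c)) (cong (ℕ._+ c) (ℕₚ.+-identityʳ k)))
          (trans ex (cong (λ n → t₁ * (fq * factℤ n)) (n₇ k a c)))
    t-suc : Hℤ (k ℕ.+ suc c) ≡ t * fw
    t-suc = trans (Hℤ≡suc _ (ℕₚ.+-suc k c)) (cong (λ n → t * factℤ n) (cong (ℕ._+ c) (sym (ℕₚ.+-identityʳ k))))
    h-suc : Hℤ (a ℕ.+ k ℕ.+ 0 ℕ.+ suc c) ≡ h * fz
    h-suc = trans (Hℤ≡suc _ (ℕₚ.+-suc (a ℕ.+ k ℕ.+ 0) c)) (cong (λ n → h * factℤ n) (cong (ℕ._+ c) (ℕₚ.+-identityʳ (a ℕ.+ k))))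
    q₁ : ∀ t u v w fw z fz → t * (u * v * (w * fw * (w * fw)) * (z * fz * (z * fz))) ≡ t * (fz * fw) * (u * v * (w * w) * (z * z) * (fw * fz))
    q₁ = solve-∀
    q₂ : ∀ t fq fr d fw fz → t * (fq * fr) * (d * (fw * fz)) ≡ t * d * (fq * fr * fw * fz)
    q₂ = solve-∀
    q₃ : ∀ g p q r e t h fq fr fw fz → g * p * q * r * (e * + 1 * t * h) * (fq * fr * fw * fz) ≡ g * p * (q * fq) * (r * fr) * (e * + 1 * (t * fw) * (h * fz))
    q₃ = solve-∀

  base : ∀ k a → den k a 0 0 ≡ num k a 0 0
  base k a =
    trans (cong₂ (λ x y → x * y) (cong₂ (λ m n → Hℤ (a ℕ.+ k ℕ.+ k) * Hℤ m * (Hℤ n * Hℤ n)) (ℕₚ.+-identityʳ a) k00) (cong (λ n → Hℤ n * Hℤ n) (ℕₚ.+-identityʳ (a ℕ.+ k))))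
   (trans (r (Hℤ (a ℕ.+ k ℕ.+ k)) (Hℤ a) (Hℤ k) (Hℤ (a ℕ.+ k)))
          (sym (cong₂ _*_ (cong₂ (λ m n → Hℤ (a ℕ.+ k) * Hℤ m * + 1 * Hℤ n) (ℕₚ.+-identityʳ k) (ℕₚ.+-identityʳ (a ℕ.+ k ℕ.+ k)))
             (cong₂ (λ m n → Hℤ a * + 1 * Hℤ m * Hℤ n) (ℕₚ.+-identityʳ k) (trans (cong (ℕ._+ 0) (ℕₚ.+-identityʳ (a ℕ.+ k))) (ℕₚ.+-identityʳ (a ℕ.+ k)))))))
    where
    k00 : k ℕ.+ 0 ℕ.+ 0 ≡ k
    k00 = trans (ℕₚ.+-identityʳ (k ℕ.+ 0)) (ℕₚ.+-identityʳ k)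
    r : ∀ u e p g → u * e * (p * p) * (g * g) ≡ g * p * + 1 * u * (e * + 1 * p * g)
    r = solve-∀

  core-walks-den : ∀ k a c → 0 ℕ.< k ℕ.+ (a ℕ.+ a) → core-walks k a c * den k a 0 c ≡ num k a 0 c
  core-walks-den k a zero 0<x = trans (cong (_* den k a 0 0) (core-walks-zero k a 0<x)) (trans (*-identityˡ _) (base k a))
  core-walks-den k a (suc c) 0<x = step-c k a c (core-walks k a c) (core-walks k a (suc c)) (core-walks-suc k a c 0<x) (core-walks-den k a c 0<x)

  -- The recursion on b trades b for c, so the bound on `M`, which sees only b + c, is preserved. At
  -- b = 0 the count is `core-walks`, except for k = a = 0, where only the empty walk exists.
  tilings#-den : ∀ M k a b c → k ℕ.+ (a ℕ.+ (b ℕ.+ c)) ℕ.< M → tilings# M k a b c * den k a b c ≡ num k a b c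
  tilings#-den M k a (suc b) c M> = step-b k a b c (tilings# M k a (suc b) c) (tilings# M k a b (suc c)) (exchange-tilings M k a b c (ℕₚ.<-trans (ℕₚ.+-monoʳ-< k (ℕₚ.+-monoʳ-< a ℕₚ.≤-refl)) M>))
    (tilings#-den M k a b (suc c) (subst (λ n → k ℕ.+ (a ℕ.+ n) ℕ.< M) (sym (ℕₚ.+-suc b c)) M>))
  tilings#-den M zero zero zero c M> = trans (cong (_* den 0 0 0 c) (walks#-[] (+ c) c)) (r (Hℤ c))
    where
    r : ∀ h → + 1 * (+ 1 * + 1 * (h * h) * (h * h)) ≡ + 1 * + 1 * h * h * (+ 1 * + 1 * h * h)
    r = solve-∀
  tilings#-den M zero (suc a) zero c M> = trans (cong (_* den 0 (suc a) 0 c) (tilings#-core M 0 (suc a) c (ℕ.s≤s ℕ.z≤n) (ℕₚ.≤-trans (ℕₚ.m≤m+n (suc a) c) (ℕₚ.<⇒≤ M>)))) (core-walks-den 0 (suc a) c (ℕ.s≤s ℕ.z≤n))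
  tilings#-den M (suc k) a zero c M> = trans (cong (_* den (suc k) a 0 c) (tilings#-core M (suc k) a c (ℕ.s≤s ℕ.z≤n) (ℕₚ.≤-trans (ℕₚ.+-monoʳ-≤ (suc k) (ℕₚ.m≤m+n a c)) (ℕₚ.<⇒≤ M>)))) (core-walks-den (suc k) a c (ℕ.s≤s ℕ.z≤n))

  product-side : ℕ → ℕ → ℕ → ℕ → ℚ.ℚ
  product-side k a b c = P (b ℕ.+ k) c k
    ℚ.* ∏ b (λ i → ratio (poch (a ℕ.+ i) k) (poch i k))
    ℚ.* ∏ c (λ i → ratio (poch (a ℕ.+ k ℕ.+ i) b) (poch (k ℕ.+ i) b) ℚ.* ratio (poch (a ℕ.+ k ℕ.+ i) (b ℕ.+ k)) (poch (k ℕ.+ i) (b ℕ.+ k)))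

  numℕ denℕ : ℕ → ℕ → ℕ → ℕ → ℕ
  numℕ k a b c = H (a ℕ.+ k) ℕ.* H (k ℕ.+ b) ℕ.* H c ℕ.* H (a ℕ.+ k ℕ.+ (b ℕ.+ k) ℕ.+ c) ℕ.* (H a ℕ.* H b ℕ.* H (k ℕ.+ c) ℕ.* H (a ℕ.+ k ℕ.+ b ℕ.+ c))
  denℕ k a b c = H (a ℕ.+ k ℕ.+ (b ℕ.+ k)) ℕ.* H (a ℕ.+ b) ℕ.* (H (k ℕ.+ b ℕ.+ c) ℕ.* H (k ℕ.+ b ℕ.+ c)) ℕ.* (H (a ℕ.+ k ℕ.+ c) ℕ.* H (a ℕ.+ k ℕ.+ c))

  -- Multiplying the three factors, H (k + (b + k) + c), H (a + k + b), H (k + (b + k)) and both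
  -- copies of H k cancel, together with one H (k + b), H (a + k) and H (k + c). What remains is
  -- P(a+k, b+k, c) P(a, b, c+k).
  product-frac : ∀ k a b c → Frac (product-side k a b c) (numℕ k a b c) (denℕ k a b c)
  product-frac k a b c = frac-reduce
    (0<* (0<* (0<* (0<* (0<H (k ℕ.+ (b ℕ.+ k))) (0<H (c ℕ.+ (b ℕ.+ k)))) (0<H (c ℕ.+ k))) (0<Gd a 0 k b)) (0<* (0<Gd (a ℕ.+ k) k b c) (0<Gd (a ℕ.+ k) k (b ℕ.+ k) c)))
    (frac-* (frac-* (P-frac (b ℕ.+ k) c k) (∏-pochs a 0 k b)) (∏-pochs₂ (a ℕ.+ k) k b (b ℕ.+ k) c))
    (trans (cong₂ ℕ._*_ lhs-num refl) (trans (r (H (a ℕ.+ k)) (H (k ℕ.+ b)) (H c) (H (a ℕ.+ k ℕ.+ (b ℕ.+ k) ℕ.+ c)) (H a) (H b) (H (k ℕ.+ c)) (H (a ℕ.+ k ℕ.+ b ℕ.+ c))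
        (H (k ℕ.+ (b ℕ.+ k) ℕ.+ c)) (H k) (H (a ℕ.+ k ℕ.+ b)) (H (k ℕ.+ (b ℕ.+ k))) (H (a ℕ.+ k ℕ.+ (b ℕ.+ k))) (H (a ℕ.+ b)) (H (k ℕ.+ b ℕ.+ c)) (H (a ℕ.+ k ℕ.+ c)))
      (cong (numℕ k a b c ℕ.*_) (sym lhs-den))))
    where
    m₁ : ∀ k b c → c ℕ.+ k ℕ.+ (b ℕ.+ k) ≡ k ℕ.+ (b ℕ.+ k) ℕ.+ c
    m₁ = ℕ-Solver.solve-∀
    m₂ : ∀ k b c → c ℕ.+ (b ℕ.+ k) ≡ k ℕ.+ b ℕ.+ c
    m₂ = ℕ-Solver.solve-∀
    lhs-num : Pn c k (b ℕ.+ k) ℕ.* Gn a 0 k b ℕ.* (Gn (a ℕ.+ k) k b c ℕ.* Gn (a ℕ.+ k) k (b ℕ.+ k) c) ≡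
      H (k ℕ.+ (b ℕ.+ k) ℕ.+ c) ℕ.* H (k ℕ.+ b) ℕ.* (H c ℕ.* H k) ℕ.* (H (a ℕ.+ k ℕ.+ b) ℕ.* H b ℕ.* (H k ℕ.* H a)) ℕ.*
      (H (a ℕ.+ k ℕ.+ b ℕ.+ c) ℕ.* H (k ℕ.+ c) ℕ.* (H (k ℕ.+ b) ℕ.* H (a ℕ.+ k)) ℕ.*
       (H (a ℕ.+ k ℕ.+ (b ℕ.+ k) ℕ.+ c) ℕ.* H (k ℕ.+ c) ℕ.* (H (k ℕ.+ (b ℕ.+ k)) ℕ.* H (a ℕ.+ k))))
    lhs-num = cong₂ (λ x y → H x ℕ.* H y ℕ.* (H c ℕ.* H k) ℕ.* (H (a ℕ.+ k ℕ.+ b) ℕ.* H b ℕ.* (H k ℕ.* H a)) ℕ.*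
      (H (a ℕ.+ k ℕ.+ b ℕ.+ c) ℕ.* H (k ℕ.+ c) ℕ.* (H (k ℕ.+ b) ℕ.* H (a ℕ.+ k)) ℕ.*
       (H (a ℕ.+ k ℕ.+ (b ℕ.+ k) ℕ.+ c) ℕ.* H (k ℕ.+ c) ℕ.* (H (k ℕ.+ (b ℕ.+ k)) ℕ.* H (a ℕ.+ k))))) (m₁ k b c) (ℕₚ.+-comm b k)
    lhs-den : Pd c k (b ℕ.+ k) ℕ.* Gd a 0 k b ℕ.* (Gd (a ℕ.+ k) k b c ℕ.* Gd (a ℕ.+ k) k (b ℕ.+ k) c) ≡
      H (k ℕ.+ (b ℕ.+ k)) ℕ.* H (k ℕ.+ b ℕ.+ c) ℕ.* H (k ℕ.+ c) ℕ.* (H (k ℕ.+ b) ℕ.* H (a ℕ.+ b) ℕ.* (H (a ℕ.+ k) ℕ.* 1)) ℕ.*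
      (H (k ℕ.+ b ℕ.+ c) ℕ.* H (a ℕ.+ k ℕ.+ c) ℕ.* (H (a ℕ.+ k ℕ.+ b) ℕ.* H k) ℕ.*
       (H (k ℕ.+ (b ℕ.+ k) ℕ.+ c) ℕ.* H (a ℕ.+ k ℕ.+ c) ℕ.* (H (a ℕ.+ k ℕ.+ (b ℕ.+ k)) ℕ.* H k)))
    lhs-den = cong₂ (λ x y → H (k ℕ.+ (b ℕ.+ k)) ℕ.* H x ℕ.* H y ℕ.* (H (k ℕ.+ b) ℕ.* H (a ℕ.+ b) ℕ.* (H (a ℕ.+ k) ℕ.* 1)) ℕ.*
      (H (k ℕ.+ b ℕ.+ c) ℕ.* H (a ℕ.+ k ℕ.+ c) ℕ.* (H (a ℕ.+ k ℕ.+ b) ℕ.* H k) ℕ.*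
       (H (k ℕ.+ (b ℕ.+ k) ℕ.+ c) ℕ.* H (a ℕ.+ k ℕ.+ c) ℕ.* (H (a ℕ.+ k ℕ.+ (b ℕ.+ k)) ℕ.* H k)))) (m₂ k b c) (ℕₚ.+-comm c k)
    r : ∀ g p q r e s t h x K y z u v w j →
      x ℕ.* p ℕ.* (q ℕ.* K) ℕ.* (y ℕ.* s ℕ.* (K ℕ.* e)) ℕ.* (h ℕ.* t ℕ.* (p ℕ.* g) ℕ.* (r ℕ.* t ℕ.* (z ℕ.* g))) ℕ.*
        (u ℕ.* v ℕ.* (w ℕ.* w) ℕ.* (j ℕ.* j)) ≡
      g ℕ.* p ℕ.* q ℕ.* r ℕ.* (e ℕ.* s ℕ.* t ℕ.* h) ℕ.*
        (z ℕ.* w ℕ.* t ℕ.* (p ℕ.* v ℕ.* (g ℕ.* 1)) ℕ.* (w ℕ.* j ℕ.* (y ℕ.* K) ℕ.* (x ℕ.* j ℕ.* (u ℕ.* K))))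
    r = ℕ-Solver.solve-∀

  private
    _⊛_ : ∀ {x y m n} → x ≡ + m → y ≡ + n → x * y ≡ + (m ℕ.* n)
    _⊛_ {m = m} {n} p q = trans (cong₂ _*_ p q) (sym (pos-* m n))

  tilings#-product : ∀ M k a b c N → k ℕ.+ (a ℕ.+ (b ℕ.+ c)) ℕ.< M → tilings# M k a b c ≡ + N → ⟦ N ⟧ ≡ product-side k a b c
  tilings#-product M k a b c N M> e = frac-unique 0<den (frac (trans (sym (⟦⟧-* N (denℕ k a b c))) (cong ⟦_⟧ eq))) (product-frac k a b c)
    where
    0<den : 0 ℕ.< denℕ k a b c
    0<den = 0<* (0<* (0<* (0<H (a ℕ.+ k ℕ.+ (b ℕ.+ k))) (0<H (a ℕ.+ b))) (0<* (0<H (k ℕ.+ b ℕ.+ c)) (0<H (k ℕ.+ b ℕ.+ c)))) (0<* (0<H (a ℕ.+ k ℕ.+ c)) (0<H (a ℕ.+ k ℕ.+ c)))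
    eq : N ℕ.* denℕ k a b c ≡ numℕ k a b c
    h : ∀ n → Hℤ n ≡ + H n
    h n = refl
    eq = +-injective (trans (sym (_⊛_ {tilings# M k a b c} {den k a b c} e den≡)) (trans (tilings#-den M k a b c M>) num≡))
      where
      den≡ : den k a b c ≡ + denℕ k a b c
      den≡ = ((h (a ℕ.+ k ℕ.+ (b ℕ.+ k)) ⊛ h (a ℕ.+ b)) ⊛ (h (k ℕ.+ b ℕ.+ c) ⊛ h (k ℕ.+ b ℕ.+ c))) ⊛ (h (a ℕ.+ k ℕ.+ c) ⊛ h (a ℕ.+ k ℕ.+ c))
      num≡ : num k a b c ≡ + numℕ k a b c
      num≡ = (((h (a ℕ.+ k) ⊛ h (k ℕ.+ b)) ⊛ h c) ⊛ h (a ℕ.+ k ℕ.+ (b ℕ.+ k) ℕ.+ c)) ⊛ (((h a ⊛ h b) ⊛ h (k ℕ.+ c)) ⊛ h (a ℕ.+ k ℕ.+ b ℕ.+ c))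

-- Counting with duplicate-free lists and boolean filters

module Lists where
  open import Data.Nat using (_≤_)

  private
    variable
      A B : Set

  unique-⊆⇒≤ : (xs ys : List A) → Unique xs → (∀ {x} → x ∈ xs → x ∈ ys) → length xs ≤ length ys
  unique-⊆⇒≤ [] ys _ _ = ℕ.z≤n
  unique-⊆⇒≤ (x ∷ xs) ys (x∉ ∷ u) sub with ∈-∃++ (sub (here refl))
  ... | us , vs , refl = subst (suc (length xs) ≤_)
        (trans (cong suc (length-++ us)) (trans (sym (ℕₚ.+-suc (length us) (length vs))) (sym (length-++ us))))
        (ℕ.s≤s (unique-⊆⇒≤ xs (us ++ vs) u λ {w} w∈ → remove w∈ (∈-++⁻ us (sub (there w∈)))))
    where
    remove : ∀ {w} → w ∈ xs → w ∈ us ⊎ w ∈ x ∷ vs → w ∈ us ++ vs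
    remove _ (inj₁ p) = ∈-++⁺ˡ p
    remove w∈ (inj₂ (here refl)) = ⊥-elim (All.lookup x∉ w∈ refl)
    remove _ (inj₂ (there p)) = ∈-++⁺ʳ us p

  unique-map : (f : A → B) (xs : List A) → (∀ {x y} → x ∈ xs → y ∈ xs → f x ≡ f y → x ≡ y) → Unique xs → Unique (map f xs)
  unique-map f [] _ _ = []
  unique-map f (x ∷ xs) inj (x∉ ∷ u) =
    All.tabulate (λ {w} w∈ e → let y , y∈ , w≡ = ∈-map⁻ f w∈ in All.lookup x∉ y∈ (inj (here refl) (there y∈) (trans e w≡)))
    ∷ unique-map f xs (λ p q → inj (there p) (there q)) u

  -- The tilings are counted as the length of a filtered list. Two such counts are identified by a
  -- bijection between duplicate-free lists, with one inequality from surjectivity and the other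
  -- from injectivity.
  bijection-length : (f : B → A) (xs : List A) (ys : List B) → Unique xs → Unique ys →
    (∀ {y} → y ∈ ys → f y ∈ xs) → (∀ {x} → x ∈ xs → ∃ λ y → y ∈ ys × f y ≡ x) →
    (∀ {y y′} → y ∈ ys → y′ ∈ ys → f y ≡ f y′ → y ≡ y′) → length xs ≡ length ys
  bijection-length f xs ys ux uy to onto inj = ℕₚ.≤-antisym
    (subst (length xs ≤_) (length-map f ys) (unique-⊆⇒≤ xs (map f ys) ux
      λ x∈ → let y , y∈ , e = onto x∈ in subst (_∈ map f ys) e (∈-map⁺ f y∈)))
    (subst (_≤ length xs) (length-map f ys) (unique-⊆⇒≤ (map f ys) xs (unique-map f ys inj uy)
      λ w∈ → let y , y∈ , e = ∈-map⁻ f w∈ in subst (_∈ xs) (sym e) (to y∈)))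

  ∈-concatMap⁺ : (f : A → List B) {xs : List A} {x : A} {y : B} → x ∈ xs → y ∈ f x → y ∈ concatMap f xs
  ∈-concatMap⁺ f (here refl) q = ∈-++⁺ˡ q
  ∈-concatMap⁺ f {x ∷ xs} (there p) q = ∈-++⁺ʳ (f x) (∈-concatMap⁺ f p q)

  ∈-concatMap⁻ : (f : A → List B) (xs : List A) {y : B} → y ∈ concatMap f xs → ∃ λ x → x ∈ xs × y ∈ f x
  ∈-concatMap⁻ f (x ∷ xs) p with ∈-++⁻ (f x) p
  ... | inj₁ q = x , here refl , q
  ... | inj₂ q = let x′ , x∈ , r = ∈-concatMap⁻ f xs q in x′ , there x∈ , r

  unique-concatMap : (f : A → List B) (xs : List A) → Unique xs → (∀ x → x ∈ xs → Unique (f x)) →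
    (∀ {x x′ y} → y ∈ f x → y ∈ f x′ → x ≡ x′) → Unique (concatMap f xs)
  unique-concatMap f [] _ _ _ = []
  unique-concatMap f (x ∷ xs) (x∉ ∷ u) uf inj = ++⁺ (uf x (here refl)) (unique-concatMap f xs u (λ x′ p → uf x′ (there p)) inj)
    λ { (p , q) → let x′ , x∈ , r = ∈-concatMap⁻ f xs q in All.lookup x∉ x∈ (inj p r) }

  ∈-filterB⁺ : (p : A → Bool) {xs : List A} {x : A} → x ∈ xs → p x ≡ true → x ∈ filterB p xs
  ∈-filterB⁺ p {x ∷ xs} (here refl) e rewrite e = here refl
  ∈-filterB⁺ p {x ∷ xs} (there q) e with p x
  ... | true = there (∈-filterB⁺ p q e)
  ... | false = ∈-filterB⁺ p q e

  ∈-filterB⁻ : (p : A → Bool) (xs : List A) {x : A} → x ∈ filterB p xs → x ∈ xs × p x ≡ true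
  ∈-filterB⁻ p (x ∷ xs) q with p x in e
  ∈-filterB⁻ p (x ∷ xs) (here refl) | true = here refl , e
  ∈-filterB⁻ p (x ∷ xs) (there q) | true = let r , s = ∈-filterB⁻ p xs q in there r , s
  ∈-filterB⁻ p (x ∷ xs) q | false = let r , s = ∈-filterB⁻ p xs q in there r , s

  unique-filterB : (p : A → Bool) (xs : List A) → Unique xs → Unique (filterB p xs)
  unique-filterB p [] _ = []
  unique-filterB p (x ∷ xs) (x∉ ∷ u) with p x
  ... | true = All.tabulate (λ q → All.lookup x∉ (proj₁ (∈-filterB⁻ p xs q))) ∷ unique-filterB p xs u
  ... | false = unique-filterB p xs u

  ∧-true⁻ : ∀ {b c} → b ∧ c ≡ true → b ≡ true × c ≡ true
  ∧-true⁻ {true} e = refl , e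

  ∧-true⁺ : ∀ {b c} → b ≡ true → c ≡ true → b ∧ c ≡ true
  ∧-true⁺ refl refl = refl

  allB⁻ : (p : A → Bool) (xs : List A) → allB p xs ≡ true → ∀ {x} → x ∈ xs → p x ≡ true
  allB⁻ p (x ∷ xs) e (here refl) = proj₁ (∧-true⁻ e)
  allB⁻ p (x ∷ xs) e (there q) = allB⁻ p xs (proj₂ (∧-true⁻ {p x} e)) q

  allB⁺ : (p : A → Bool) (xs : List A) → (∀ {x} → x ∈ xs → p x ≡ true) → allB p xs ≡ true
  allB⁺ p [] _ = refl
  allB⁺ p (x ∷ xs) f = ∧-true⁺ (f (here refl)) (allB⁺ p xs λ q → f (there q))

  anyB⁻ : (p : A → Bool) (xs : List A) → anyB p xs ≡ true → ∃ λ x → x ∈ xs × p x ≡ true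
  anyB⁻ p (x ∷ xs) e with p x in eq
  ... | true = x , here refl , eq
  ... | false = let y , y∈ , q = anyB⁻ p xs e in y , there y∈ , q

  anyB⁺ : (p : A → Bool) {xs : List A} {x : A} → x ∈ xs → p x ≡ true → anyB p xs ≡ true
  anyB⁺ p (here refl) e rewrite e = refl
  anyB⁺ p {x ∷ xs} (there q) e with p x
  ... | true = refl
  ... | false = anyB⁺ p q e

  filterB-single : (p : A → Bool) (xs : List A) {x₀ : A} → Unique xs → x₀ ∈ xs → p x₀ ≡ true →
    (∀ {x} → x ∈ xs → p x ≡ true → x ≡ x₀) → length (filterB p xs) ≡ 1
  filterB-single p (x ∷ xs) {x₀} (x∉ ∷ u) x₀∈ e only with p x in eq | x₀∈
  ... | true | _ = cong suc (none xs λ {w} w∈ pw → All.lookup x∉ w∈ (trans (only (here refl) eq) (sym (only (there w∈) pw))))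
    where
    none : ∀ ys → (∀ {w} → w ∈ ys → p w ≢ true) → length (filterB p ys) ≡ 0
    none [] _ = refl
    none (y ∷ ys) never with p y in eq′
    ... | true = ⊥-elim (never (here refl) eq′)
    ... | false = none ys λ q → never (there q)
  ... | false | here refl with () ← trans (sym eq) e
  ... | false | there q = filterB-single p xs u q e λ r → only (there r)

  length-filterB-map : (p : B → Bool) (f : A → B) (xs : List A) → length (filterB p (map f xs)) ≡ length (filterB (λ a → p (f a)) xs)
  length-filterB-map p f [] = refl
  length-filterB-map p f (x ∷ xs) with p (f x)
  ... | true = cong suc (length-filterB-map p f xs)
  ... | false = length-filterB-map p f xs

  zip-map : (f : A → B) (xs : List A) → zip xs (map f xs) ≡ map (λ a → a , f a) xs
  zip-map f [] = refl
  zip-map f (x ∷ xs) = cong (_ ∷_) (zip-map f xs)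

  map-cong-∈ : {f g : A → B} (xs : List A) → (∀ {x} → x ∈ xs → f x ≡ g x) → map f xs ≡ map g xs
  map-cong-∈ [] _ = refl
  map-cong-∈ (x ∷ xs) e = cong₂ _∷_ (e (here refl)) (map-cong-∈ xs λ q → e (there q))

  map-≡⇒ : {f g : A → B} {xs : List A} → map f xs ≡ map g xs → ∀ {x} → x ∈ xs → f x ≡ g x
  map-≡⇒ {xs = x ∷ xs} e (here refl) = proj₁ (∷-injective e)
  map-≡⇒ {xs = x ∷ xs} e (there q) = map-≡⇒ (proj₂ (∷-injective e)) q

-- Explicit enumeration of the walks counted so far

module WalkLists where
  open import Data.Integer using (_+_; -_)
  open Alternants using (steps)
  open Weights using (pre)
  open TupleSums
  open Configurations
  open ClosedForm using (tilings#)
  open Lists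

  -- One layer of lozenges crossed by the walks: each occupied position together with its step,
  -- `false` for direction 0, which keeps the position, and `true` for direction 1, which lowers it
  -- by one.
  Row : Set
  Row = List (ℤ × Bool)

  target : ℤ × Bool → ℤ
  target (p , false) = p
  target (p , true) = pre p

  bots tops : Row → List ℤ
  bots = map proj₁
  tops = map target

  rows : List ℤ → List Row
  rows [] = [] ∷ []
  rows (t ∷ ts) = map ((t , false) ∷_) (rows ts) ++ map ((t , true) ∷_) (rows ts)

  ∈-rows⁺ : ∀ R → R ∈ rows (bots R)
  ∈-rows⁺ [] = here refl
  ∈-rows⁺ ((t , false) ∷ R) = ∈-++⁺ˡ (∈-map⁺ _ (∈-rows⁺ R))
  ∈-rows⁺ ((t , true) ∷ R) = ∈-++⁺ʳ (map ((t , false) ∷_) (rows (bots R))) (∈-map⁺ _ (∈-rows⁺ R))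

  ∈-rows⁻ : ∀ ts {R} → R ∈ rows ts → bots R ≡ ts
  ∈-rows⁻ [] (here refl) = refl
  ∈-rows⁻ (t ∷ ts) p with ∈-++⁻ (map ((t , false) ∷_) (rows ts)) p
  ... | inj₁ q with ∈-map⁻ _ q
  ...   | R , R∈ , refl = cong (t ∷_) (∈-rows⁻ ts R∈)
  ∈-rows⁻ (t ∷ ts) p | inj₂ q with ∈-map⁻ _ q
  ...   | R , R∈ , refl = cong (t ∷_) (∈-rows⁻ ts R∈)

  unique-rows : ∀ ts → Unique (rows ts)
  unique-rows [] = [] ∷ []
  unique-rows (t ∷ ts) = ++⁺ (half false) (half true)
    λ { (p , q) → clash p q }
    where
    half : ∀ b → Unique (map ((t , b) ∷_) (rows ts))
    half b = unique-map _ (rows ts) (λ _ _ e → proj₂ (∷-injective e)) (unique-rows ts)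
    clash : ∀ {R} → R ∈ map ((t , false) ∷_) (rows ts) → R ∈ map ((t , true) ∷_) (rows ts) → _
    clash p q with ∈-map⁻ _ p | ∈-map⁻ _ q
    ... | _ , _ , refl | _ , _ , ()

  -- `rows` branches at each entry exactly as `steps` does, so the length of the concatenation
  -- follows the recursion of the step operator.
  length-concatMap-rows : ∀ {X : Set} (G : List ℤ → ℤ) (f : Row → List X) ts →
    (∀ R → + length (f R) ≡ G (tops R)) → + length (concatMap f (rows ts)) ≡ steps pre G ts
  length-concatMap-rows G f [] e = trans (cong +_ (trans (length-++ (f [])) (ℕₚ.+-identityʳ (length (f []))))) (e [])
  length-concatMap-rows G f (t ∷ ts) e =
    trans (cong (λ l → + length l) (trans (concatMap-++ f (map ((t , false) ∷_) (rows ts)) (map ((t , true) ∷_) (rows ts)))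
                                          (cong₂ _++_ (concatMap-map f _ (rows ts)) (concatMap-map f _ (rows ts)))))
   (trans (cong +_ (length-++ (concatMap (λ R → f ((t , false) ∷ R)) (rows ts))))
   (trans (pos-+ (length (concatMap (λ R → f ((t , false) ∷ R)) (rows ts))) _)
          (cong₂ _+_ (length-concatMap-rows (λ us → G (t ∷ us)) (λ R → f ((t , false) ∷ R)) ts λ R → e _)
                     (length-concatMap-rows (λ us → G (pre t ∷ us)) (λ R → f ((t , true) ∷ R)) ts λ R → e _))))

  module _ (A : ℤ) (x : ℕ) where
    open Walks A x using (top; _≟ᴸ_; walks#)

    data Walk : ℕ → List ℤ → List Row → Set where
      done : ∀ {T} → T ≡ top → Walk zero T []
      step : ∀ {n} R {Rs} → Strict (bots R) → Walk n (tops R) Rs → Walk (suc n) (bots R) (R ∷ Rs)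

    walkList : ℕ → List ℤ → List (List Row)
    walkList zero T with T ≟ᴸ top
    ... | yes _ = [] ∷ []
    ... | no _ = []
    walkList (suc n) T with strict? T
    ... | yes _ = concatMap (λ R → map (R ∷_) (walkList n (tops R))) (rows T)
    ... | no _ = []

    length-walkList : ∀ n T → + length (walkList n T) ≡ walks# n T
    length-walkList zero T with T ≟ᴸ top
    ... | yes _ = refl
    ... | no _ = refl
    length-walkList (suc n) T with strict? T
    ... | yes _ = trans (length-concatMap-rows (walks# n) _ T λ R → trans (cong +_ (length-map (R ∷_) (walkList n (tops R)))) (length-walkList n (tops R)))
                        (sym (*-identityˡ _))
    ... | no _ = refl

    ∈-walkList⁺ : ∀ {n T Rs} → Walk n T Rs → Rs ∈ walkList n T
    ∈-walkList⁺ {T = T} (done e) with T ≟ᴸ top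
    ... | yes _ = here refl
    ... | no ¬e = ⊥-elim (¬e e)
    ∈-walkList⁺ (step R s w) with strict? (bots R)
    ... | yes _ = ∈-concatMap⁺ _ (∈-rows⁺ R) (∈-map⁺ (R ∷_) (∈-walkList⁺ w))
    ... | no ¬s = ⊥-elim (¬s s)

    ∈-walkList⁻ : ∀ n T {Rs} → Rs ∈ walkList n T → Walk n T Rs
    ∈-walkList⁻ zero T p with T ≟ᴸ top
    ∈-walkList⁻ zero T (here refl) | yes e = done e
    ∈-walkList⁻ (suc n) T p with strict? T
    ... | yes s with ∈-concatMap⁻ _ (rows T) p
    ...   | R , R∈ , q with ∈-map⁻ (R ∷_) q | ∈-rows⁻ T R∈
    ...     | Rs , Rs∈ , refl | refl = step R s (∈-walkList⁻ n (tops R) Rs∈)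

    unique-walkList : ∀ n T → Unique (walkList n T)
    unique-walkList zero T with T ≟ᴸ top
    ... | yes _ = [] ∷ []
    ... | no _ = []
    unique-walkList (suc n) T with strict? T
    ... | no _ = []
    ... | yes _ = unique-concatMap _ (rows T) (unique-rows T)
      (λ R _ → unique-map (R ∷_) (walkList n (tops R)) (λ _ _ e → proj₂ (∷-injective e)) (unique-walkList n (tops R)))
      λ p q → same (∈-map⁻ _ p) (∈-map⁻ _ q)
      where
      same : ∀ {R R′ Rs} → (∃ λ S → S ∈ walkList n (tops R) × Rs ≡ R ∷ S) → (∃ λ S → S ∈ walkList n (tops R′) × Rs ≡ R′ ∷ S) → R ≡ R′
      same (_ , _ , refl) (_ , _ , refl) = refl

  below : ℕ → List ℤ
  below zero = []
  below (suc M) = below M ++ [ + M ]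

  tuples : ℕ → ℕ → List (List ℤ)
  tuples zero M = [] ∷ []
  tuples (suc m) M = concatMap (λ t → map (t ∷_) (tuples m M)) (below M)

  length-concatMap-below : ∀ {X : Set} M (f : ℤ → List X) (g : ℤ → ℤ) → (∀ t → + length (f t) ≡ g t) →
    + length (concatMap f (below M)) ≡ Σ< M g
  length-concatMap-below zero f g e = refl
  length-concatMap-below (suc M) f g e =
    trans (cong (λ l → + length l) (concatMap-++ f (below M) [ + M ]))
   (trans (cong +_ (length-++ (concatMap f (below M))))
   (trans (pos-+ (length (concatMap f (below M))) _)
          (cong₂ _+_ (length-concatMap-below M f g e)
            (trans (cong +_ (trans (length-++ (f (+ M))) (ℕₚ.+-identityʳ (length (f (+ M)))))) (e (+ M))))))

  length-concatMap-tuples : ∀ {X : Set} m M (f : List ℤ → List X) (G : List ℤ → ℤ) → (∀ ts → + length (f ts) ≡ G ts) →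
    + length (concatMap f (tuples m M)) ≡ Σᵗ m M G
  length-concatMap-tuples zero M f G e = trans (cong +_ (trans (length-++ (f [])) (ℕₚ.+-identityʳ (length (f []))))) (e [])
  length-concatMap-tuples (suc m) M f G e =
    trans (cong (λ l → + length l) (nested (below M)))
          (length-concatMap-below M _ _ λ t → length-concatMap-tuples m M (λ ts → f (t ∷ ts)) (λ ts → G (t ∷ ts)) λ ts → e (t ∷ ts))
    where
    nested : ∀ us → concatMap f (concatMap (λ t → map (t ∷_) (tuples m M)) us) ≡ concatMap (λ t → concatMap (λ ts → f (t ∷ ts)) (tuples m M)) us
    nested [] = refl
    nested (u ∷ us) = trans (concatMap-++ f (map (u ∷_) (tuples m M)) _) (cong₂ _++_ (concatMap-map f (u ∷_) (tuples m M)) (nested us))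

  ∈-below⁺ : ∀ {M n} → n ℕ.< M → + n ∈ below M
  ∈-below⁺ {suc M} {n} (ℕ.s≤s n≤M) with ℕₚ.m≤n⇒m<n∨m≡n n≤M
  ... | inj₁ n<M = ∈-++⁺ˡ (∈-below⁺ n<M)
  ... | inj₂ refl = ∈-++⁺ʳ (below M) (here refl)

  ∈-below⁻ : ∀ M {t} → t ∈ below M → ∃ λ n → t ≡ + n × n ℕ.< M
  ∈-below⁻ (suc M) p with ∈-++⁻ (below M) p
  ... | inj₁ q = let n , e , n<M = ∈-below⁻ M q in n , e , ℕₚ.m<n⇒m<1+n n<M
  ... | inj₂ (here refl) = M , refl , ℕₚ.≤-refl

  unique-below : ∀ M → Unique (below M)
  unique-below zero = []
  unique-below (suc M) = ++⁺ (unique-below M) ([] ∷ []) λ { (p , here refl) → clash (∈-below⁻ M p) }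
    where
    clash : (∃ λ n → + M ≡ + n × n ℕ.< M) → _
    clash (_ , refl , M<M) = ℕₚ.<-irrefl refl M<M

  ∈-tuples⁺ : ∀ {M} ts → All (λ t → ∃ λ n → t ≡ + n × n ℕ.< M) ts → ts ∈ tuples (length ts) M
  ∈-tuples⁺ [] [] = here refl
  ∈-tuples⁺ (_ ∷ ts) ((n , refl , n<M) ∷ ps) = ∈-concatMap⁺ _ (∈-below⁺ n<M) (∈-map⁺ _ (∈-tuples⁺ ts ps))

  ∈-tuples⁻ : ∀ m M {ts} → ts ∈ tuples m M → length ts ≡ m × All (λ t → ∃ λ n → t ≡ + n × n ℕ.< M) ts
  ∈-tuples⁻ zero M (here refl) = refl , []
  ∈-tuples⁻ (suc m) M p with ∈-concatMap⁻ _ (below M) p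
  ... | t , t∈ , q with ∈-map⁻ (t ∷_) q
  ...   | ts , ts∈ , refl = let e , a = ∈-tuples⁻ m M ts∈ in cong suc e , ∈-below⁻ M t∈ ∷ a

  unique-tuples : ∀ m M → Unique (tuples m M)
  unique-tuples zero M = [] ∷ []
  unique-tuples (suc m) M = unique-concatMap _ (below M) (unique-below M)
    (λ t _ → unique-map (t ∷_) (tuples m M) (λ _ _ e → proj₂ (∷-injective e)) (unique-tuples m M))
    λ p q → same (∈-map⁻ _ p) (∈-map⁻ _ q)
    where
    same : ∀ {t t′ ts} → (∃ λ us → us ∈ tuples m M × ts ≡ t ∷ us) → (∃ λ us → us ∈ tuples m M × ts ≡ t′ ∷ us) → t ≡ t′
    same (_ , _ , refl) (_ , _ , refl) = refl

  symmetricWalks : ℕ → ℕ → ℕ → ℕ → ℕ → List (List ℤ × List Row)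
  symmetricWalks M k a b c =
    concatMap (λ rs → map (rs ,_) (walkList (+ (k ℕ.+ (a ℕ.+ c))) (k ℕ.+ (a ℕ.+ a)) (k ℕ.+ (b ℕ.+ c)) (symm k rs))) (tuples a M)

  ∈-symmetricWalks⁺ : ∀ {M k a b c rs Rs} → rs ∈ tuples a M →
    Walk (+ (k ℕ.+ (a ℕ.+ c))) (k ℕ.+ (a ℕ.+ a)) (k ℕ.+ (b ℕ.+ c)) (symm k rs) Rs → (rs , Rs) ∈ symmetricWalks M k a b c
  ∈-symmetricWalks⁺ {M} {k} {a} {b} {c} {rs} rs∈ w =
    ∈-concatMap⁺ (λ rs → map (rs ,_) (walkList (+ (k ℕ.+ (a ℕ.+ c))) (k ℕ.+ (a ℕ.+ a)) (k ℕ.+ (b ℕ.+ c)) (symm k rs)))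
      rs∈ (∈-map⁺ (rs ,_) (∈-walkList⁺ (+ (k ℕ.+ (a ℕ.+ c))) (k ℕ.+ (a ℕ.+ a)) w))

  ∈-symmetricWalks⁻ : ∀ M k a b c {rs Rs} → (rs , Rs) ∈ symmetricWalks M k a b c → rs ∈ tuples a M ×
    Walk (+ (k ℕ.+ (a ℕ.+ c))) (k ℕ.+ (a ℕ.+ a)) (k ℕ.+ (b ℕ.+ c)) (symm k rs) Rs
  ∈-symmetricWalks⁻ M k a b c p with ∈-concatMap⁻ _ (tuples a M) p
  ... | rs , rs∈ , q with ∈-map⁻ (rs ,_) q
  ...   | Rs , Rs∈ , refl = rs∈ , ∈-walkList⁻ (+ (k ℕ.+ (a ℕ.+ c))) (k ℕ.+ (a ℕ.+ a)) (k ℕ.+ (b ℕ.+ c)) (symm k rs) Rs∈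

  length-symmetricWalks : ∀ M k a b c → + length (symmetricWalks M k a b c) ≡ tilings# M k a b c
  length-symmetricWalks M k a b c = length-concatMap-tuples a M _ _ λ rs →
    trans (cong +_ (length-map (rs ,_) (walkList A x n (symm k rs)))) (length-walkList A x n (symm k rs))
    where
    A : ℤ
    A = + (k ℕ.+ (a ℕ.+ c))
    x n : ℕ
    x = k ℕ.+ (a ℕ.+ a)
    n = k ℕ.+ (b ℕ.+ c)

  unique-symmetricWalks : ∀ M k a b c → Unique (symmetricWalks M k a b c)
  unique-symmetricWalks M k a b c = unique-concatMap _ (tuples a M) (unique-tuples a M)
    (λ rs _ → unique-map (rs ,_) _ (λ _ _ e → proj₂ (,-injective e)) (unique-walkList (+ (k ℕ.+ (a ℕ.+ c))) (k ℕ.+ (a ℕ.+ a)) (k ℕ.+ (b ℕ.+ c)) (symm k rs)))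
    λ p q → same (∈-map⁻ _ p) (∈-map⁻ _ q)
    where
    same : ∀ {X : Set} {P Q : X → Set} {rs rs′ : List ℤ} {w} → (∃ λ v → P v × w ≡ (rs , v)) → (∃ λ v → Q v × w ≡ (rs′ , v)) → rs ≡ rs′
    same (_ , _ , refl) (_ , _ , refl) = refl

-- The region in coordinates centred at the bowtie

module Geometry (k a b c : ℕ) where
  open import Data.Integer using (_+_; _-_; -_; _<_; _≤_; _≤ᵇ_)
  open TupleSums using (lin; <⇒+1≤; +1≤⇒<)
  open Lists

  x y z n : ℕ
  x = k ℕ.+ (a ℕ.+ a)
  y = k ℕ.+ (b ℕ.+ b)
  z = k ℕ.+ (c ℕ.+ c)
  n = k ℕ.+ (b ℕ.+ c)

  open Region x y z k public

  A B : ℤ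
  A = + (k ℕ.+ (a ℕ.+ c))
  B = + (k ℕ.+ (a ℕ.+ b))

  half-double : ∀ m → ⌊ m ℕ.+ m /2⌋ ≡ m
  half-double m = sym (ℕₚ.n≡⌊n+n/2⌋ m)

  cu≡ : cu ≡ A - Z
  cu≡ = cong (λ m → + m - Z) (trans (cong ⌊_/2⌋ (r k a c)) (half-double (k ℕ.+ (a ℕ.+ c))))
    where
    r : ∀ k a c → k ℕ.+ (a ℕ.+ a) ℕ.+ (k ℕ.+ (c ℕ.+ c)) ≡ k ℕ.+ (a ℕ.+ c) ℕ.+ (k ℕ.+ (a ℕ.+ c))
    r = ℕ-Solver.solve-∀

  cv≡ : cv ≡ + n
  cv≡ = cong +_ (trans (cong ⌊_/2⌋ (r k b c)) (half-double (k ℕ.+ (b ℕ.+ c))))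
    where
    r : ∀ k b c → k ℕ.+ (b ℕ.+ b) ℕ.+ (k ℕ.+ (c ℕ.+ c)) ≡ k ℕ.+ (b ℕ.+ c) ℕ.+ (k ℕ.+ (b ℕ.+ c))
    r = ℕ-Solver.solve-∀

  T⇒≡ : ∀ {β} → Bool.T β → β ≡ true
  T⇒≡ {true} _ = refl

  ≤ᵇ⁻ : ∀ {i j} → (i ≤ᵇ j) ≡ true → i ≤ j
  ≤ᵇ⁻ e = ≤ᵇ⇒≤ (subst Bool.T (sym e) tt)

  ≤ᵇ⁺ : ∀ {i j} → i ≤ j → (i ≤ᵇ j) ≡ true
  ≤ᵇ⁺ p = T⇒≡ (≤⇒≤ᵇ p)

  true-iff : ∀ {β γ} → (β ≡ true → γ ≡ true) → (γ ≡ true → β ≡ true) → β ≡ γ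
  true-iff {true} f _ = sym (f refl)
  true-iff {false} {false} _ _ = refl
  true-iff {false} {true} _ g = g refl

  -- A comparison depends only on the difference of its sides, so boolean side conditions related by
  -- the rotation are matched by a ring identity.
  ≤ᵇ-cong : ∀ {i j i′ j′} → j - i ≡ j′ - i′ → (i ≤ᵇ j) ≡ (i′ ≤ᵇ j′)
  ≤ᵇ-cong {i} {j} {i′} {j′} e = true-iff (λ p → ≤ᵇ⁺ {i′} {j′} (lin (≤ᵇ⁻ {i} {j} p) (sym e))) (λ p → ≤ᵇ⁺ {i} {j} (lin (≤ᵇ⁻ {i′} {j′} p) e))

  ∨-true⁻ : ∀ {β γ} → β ∨ γ ≡ true → β ≡ true ⊎ γ ≡ true
  ∨-true⁻ {true} _ = inj₁ refl
  ∨-true⁻ {false} e = inj₂ e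

  not-true⁺ : ∀ {β} → (β ≡ true → ⊥) → not β ≡ true
  not-true⁺ {true} f = ⊥-elim (f refl)
  not-true⁺ {false} _ = refl

  not-true⁻ : ∀ {β} → not β ≡ true → β ≡ true → ⊥
  not-true⁻ {true} () _

  clash : ∀ {i j} → i ≤ j → j + + 1 ≤ i → ⊥
  clash {i} {j} p q = <-irrefl refl (<-≤-trans (+1≤⇒< q) p)

  ≰⇒+1≤ : ∀ {i j} → ¬ (i ≤ j) → j + + 1 ≤ i
  ≰⇒+1≤ p = <⇒+1≤ (≰⇒> p)

  -- The unit segment [p, p + 1] at height q above the centre, for heights up to the top side of the hexagon.
  Edge : ℕ → ℤ → Set
  Edge q p = - A ≤ p × p + + 1 ≤ A × - B ≤ p + + q × p + + q + + 1 ≤ B × (+ 0 ≤ p → + k ≤ p + + q)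

  edge? : ∀ q p → Dec (Edge q p)
  edge? q p = (- A ≤? p) ×-dec (p + + 1 ≤? A) ×-dec (- B ≤? p + + q) ×-dec (p + + q + + 1 ≤? B) ×-dec ((+ 0 ≤? p) →-dec (+ k ≤? p + + q))

  -- The up triangle above that segment, and the image under rot of the down triangle below it.
  U D : ℕ → ℤ → Cell
  U q p = cu + p , cv + + q
  D q p = cu - p - + 1 , cv - + q

  private
    K′ a′ b′ c′ : ℤ
    K′ = + k
    a′ = + a
    b′ = + b
    c′ = + c

  module _ (u v : ℤ) where

    Hex : Set
    Hex = + 0 ≤ v × v + + 1 ≤ Y + Z × - Z ≤ u × u + + 1 ≤ X × + 0 ≤ u + v × u + v + + 1 ≤ X + Y

    hex⁻ : inHexUp (u , v) ≡ true → Hex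
    hex⁻ e =
      let e₁ , e = ∧-true⁻ {+ 0 ≤ᵇ v} e
          e₂ , e = ∧-true⁻ {v + + 1 ≤ᵇ Y + Z} e
          e₃ , e = ∧-true⁻ { - Z ≤ᵇ u} e
          e₄ , e = ∧-true⁻ {u + + 1 ≤ᵇ X} e
          e₅ , e₆ = ∧-true⁻ {+ 0 ≤ᵇ u + v} e
      in ≤ᵇ⁻ e₁ , ≤ᵇ⁻ e₂ , ≤ᵇ⁻ e₃ , ≤ᵇ⁻ e₄ , ≤ᵇ⁻ e₅ , ≤ᵇ⁻ e₆

    hex⁺ : Hex → inHexUp (u , v) ≡ true
    hex⁺ (h₁ , h₂ , h₃ , h₄ , h₅ , h₆) =
      ∧-true⁺ (≤ᵇ⁺ h₁) (∧-true⁺ (≤ᵇ⁺ h₂) (∧-true⁺ (≤ᵇ⁺ h₃) (∧-true⁺ (≤ᵇ⁺ h₄) (∧-true⁺ (≤ᵇ⁺ h₅) (≤ᵇ⁺ h₆)))))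

  -- The four side conditions shared by the triangle above a segment and the triangle below it. In
  -- the hexagon, these two triangles differ only in the admissible heights.
  EdgeHex : ℕ → ℤ → Set
  EdgeHex q p = - A ≤ p × p + + 1 ≤ A × - B ≤ p + + q × p + + q + + 1 ≤ B

  private
    u₁ : ∀ A Z p → p - - A ≡ A - Z + p - - Z
    u₁ = solve-∀
    u₂ : ∀ k a c p → k + (a + c) - (p + + 1) ≡ k + (a + a) - (k + (a + c) - (k + (c + c)) + p + + 1)
    u₂ = solve-∀
    u₃ : ∀ k a b c p q → p + q - - (k + (a + b)) ≡ k + (a + c) - (k + (c + c)) + p + (k + (b + c) + q) - + 0
    u₃ = solve-∀
    u₄ : ∀ k a b c p q → k + (a + b) - (p + q + + 1) ≡ k + (a + a) + (k + (b + b)) - (k + (a + c) - (k + (c + c)) + p + (k + (b + c) + q) + + 1)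
    u₄ = solve-∀
    u₅ : ∀ k b c q → k + (b + c) - (q + + 1) ≡ k + (b + b) + (k + (c + c)) - (k + (b + c) + q + + 1)
    u₅ = solve-∀
    d₁ : ∀ k a c p → p - - (k + (a + c)) ≡ k + (a + a) - (k + (a + c) - (k + (c + c)) - p - + 1 + + 1)
    d₁ = solve-∀
    d₂ : ∀ A Z p → A - (p + + 1) ≡ A - Z - p - + 1 - - Z
    d₂ = solve-∀
    d₃ : ∀ k a b c p q → p + q - - (k + (a + b)) ≡ k + (a + a) + (k + (b + b)) - (k + (a + c) - (k + (c + c)) - p - + 1 + (k + (b + c) - q) + + 1)
    d₃ = solve-∀
    d₄ : ∀ k a b c p q → k + (a + b) - (p + q + + 1) ≡ k + (a + c) - (k + (c + c)) - p - + 1 + (k + (b + c) - q) - + 0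
    d₄ = solve-∀
    d₅ : ∀ n q → n - q ≡ n - q - + 0
    d₅ = solve-∀
    d₆ : ∀ k b c q → k + (b + b) + (k + (c + c)) - (k + (b + c) - (+ 1 + q) + + 1) ≡ k + (b + c) + q - + 0
    d₆ = solve-∀

  hexU⁻ : ∀ q p {u v} → u ≡ A - Z + p → v ≡ + n + + q → Hex u v → EdgeHex q p × + q + + 1 ≤ + n
  hexU⁻ q p refl refl (h₁ , h₂ , h₃ , h₄ , h₅ , h₆) =
    (lin h₃ (u₁ A Z p) , lin h₄ (u₂ K′ a′ c′ p) , lin h₅ (u₃ K′ a′ b′ c′ p (+ q)) , lin h₆ (u₄ K′ a′ b′ c′ p (+ q))) , lin h₂ (u₅ K′ b′ c′ (+ q))

  hexU⁺ : ∀ q p {u v} → u ≡ A - Z + p → v ≡ + n + + q → EdgeHex q p → + q + + 1 ≤ + n → Hex u v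
  hexU⁺ q p refl refl (h₁ , h₂ , h₃ , h₄) h₅ =
    ℤ.+≤+ ℕ.z≤n , lin h₅ (sym (u₅ K′ b′ c′ (+ q))) , lin h₁ (sym (u₁ A Z p)) , lin h₂ (sym (u₂ K′ a′ c′ p)) ,
    lin h₃ (sym (u₃ K′ a′ b′ c′ p (+ q))) , lin h₄ (sym (u₄ K′ a′ b′ c′ p (+ q)))

  hexD⁻ : ∀ q p {u v} → u ≡ A - Z - p - + 1 → v ≡ + n - + q → Hex u v → EdgeHex q p × + q ≤ + n
  hexD⁻ q p refl refl (h₁ , h₂ , h₃ , h₄ , h₅ , h₆) =
    (lin h₄ (d₁ K′ a′ c′ p) , lin h₃ (d₂ A Z p) , lin h₆ (d₃ K′ a′ b′ c′ p (+ q)) , lin h₅ (d₄ K′ a′ b′ c′ p (+ q))) , lin h₁ (d₅ (+ n) (+ q))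

  hexD⁺ : ∀ q p {u v} → u ≡ A - Z - p - + 1 → v ≡ + n - + suc q → EdgeHex (suc q) p → + suc q ≤ + n → Hex u v
  hexD⁺ q p refl refl (h₁ , h₂ , h₃ , h₄) h₅ =
    lin h₅ (sym (d₅ (+ n) (+ suc q))) , lin (ℤ.+≤+ (ℕ.z≤n {n ℕ.+ q})) (d₆ K′ b′ c′ (+ q)) , lin h₂ (sym (d₂ A Z p)) , lin h₁ (sym (d₁ K′ a′ c′ p)) ,
    lin h₄ (sym (d₄ K′ a′ b′ c′ p (+ suc q))) , lin h₃ (sym (d₃ K′ a′ b′ c′ p (+ suc q)))

  private
    u-U : ∀ p → cu + p ≡ A - Z + p
    u-U p = cong (_+ p) cu≡
    v-U : ∀ q → cv + + q ≡ + n + + q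
    v-U q = cong (_+ + q) cv≡
    u-D : ∀ p → cu - p - + 1 ≡ A - Z - p - + 1
    u-D p = cong (λ w → w - p - + 1) cu≡
    v-D : ∀ q → cv - + q ≡ + n - + q
    v-D q = cong (_- + q) cv≡

  lobe₁ lobe₂ : ℤ → ℤ → Bool
  lobe₁ du dv = (+ 0 ≤ᵇ du) ∧ (+ 0 ≤ᵇ dv) ∧ (du + dv + + 1 ≤ᵇ K)
  lobe₂ du dv = (du + + 1 ≤ᵇ + 0) ∧ (dv + + 1 ≤ᵇ + 0) ∧ (- K ≤ᵇ du + dv)

  upU⁻ : ∀ q p → inRegionUp (U q p) ≡ true → Edge q p × q ℕ.< n
  upU⁻ q p e with ∧-true⁻ {inHexUp (U q p)} e
  ... | h , nb with hexU⁻ q p (u-U p) (v-U q) (hex⁻ (cu + p) (cv + + q) h)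
  ... | (h₁ , h₂ , h₃ , h₄) , h₅ = (h₁ , h₂ , h₃ , h₄ , off) , drop‿+≤+ (subst (_≤ + n) (+-comm (+ q) (+ 1)) h₅)
    where
    r₁ : ∀ cu p → cu + p - cu - + 0 ≡ p - + 0
    r₁ = solve-∀
    r₂ : ∀ cv q → cv + q - cv - + 0 ≡ q - + 0
    r₂ = solve-∀
    r₃ : ∀ cu cv p q k → k - (cu + p - cu + (cv + q - cv) + + 1) ≡ k - (p + q + + 1)
    r₃ = solve-∀
    off : + 0 ≤ p → + k ≤ p + + q
    off 0≤p with + k ≤? p + + q
    ... | yes k≤ = k≤
    ... | no k≰ = ⊥-elim (not-true⁻ nb (trans (cong (_∨ lobe₂ (cu + p - cu) (cv + + q - cv))
      (∧-true⁺ (≤ᵇ⁺ {+ 0} {cu + p - cu} (lin 0≤p (r₁ cu p))) (∧-true⁺ (≤ᵇ⁺ {+ 0} {cv + + q - cv} (lin (ℤ.+≤+ (ℕ.z≤n {q})) (r₂ cv (+ q)))) (≤ᵇ⁺ {cu + p - cu + (cv + + q - cv) + + 1} {K} (lin (≰⇒+1≤ k≰) (r₃ cu cv p (+ q) K′)))))) refl))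

  upU⁺ : ∀ q p → Edge q p → q ℕ.< n → inRegionUp (U q p) ≡ true
  upU⁺ q p (h₁ , h₂ , h₃ , h₄ , off) q<n = ∧-true⁺
    (hex⁺ (cu + p) (cv + + q) (hexU⁺ q p (u-U p) (v-U q) (h₁ , h₂ , h₃ , h₄) (subst (_≤ + n) (+-comm (+ 1) (+ q)) (ℤ.+≤+ q<n))))
    (not-true⁺ λ e → bow (∨-true⁻ {lobe₁ (cu + p - cu) (cv + + q - cv)} e))
    where
    r₁ : ∀ cu p → p - + 0 ≡ cu + p - cu - + 0
    r₁ = solve-∀
    r₂ : ∀ cv q → - + 1 - q ≡ + 0 - (cv + q - cv + + 1)
    r₂ = solve-∀
    r₃ : ∀ cu cv p q k → k - (p + q + + 1) ≡ k - (cu + p - cu + (cv + q - cv) + + 1)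
    r₃ = solve-∀
    bow : lobe₁ (cu + p - cu) (cv + + q - cv) ≡ true ⊎ lobe₂ (cu + p - cu) (cv + + q - cv) ≡ true → ⊥
    bow (inj₁ e) =
      let e₁ , e = ∧-true⁻ {+ 0 ≤ᵇ cu + p - cu} e
          _ , e₃ = ∧-true⁻ {+ 0 ≤ᵇ cv + + q - cv} e
      in clash (off (lin (≤ᵇ⁻ {+ 0} {cu + p - cu} e₁) (r₁ cu p))) (lin (≤ᵇ⁻ {cu + p - cu + (cv + + q - cv) + + 1} {K} e₃) (r₃ cu cv p (+ q) K′))
    bow (inj₂ e) =
      let _ , e = ∧-true⁻ {cu + p - cu + + 1 ≤ᵇ + 0} e
          e₂ , _ = ∧-true⁻ {cv + + q - cv + + 1 ≤ᵇ + 0} e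
      in impossible (lin {c = + q} {d = -[1+ 0 ]} (≤ᵇ⁻ {cv + + q - cv + + 1} {+ 0} e₂) (r₂ cv (+ q)))
      where
      impossible : + q ≤ -[1+ 0 ] → ⊥
      impossible ()

  -- The rotated cell lies below the axis, where only `lobe₂` can contain it. This is the image of
  -- `lobe₁`, and it excludes the same segments, p ≥ 0 with p + suc q < k; hence `Edge` serves both
  -- the cells above and the cells below a segment.
  upD⁻ : ∀ q p → inRegionUp (D (suc q) p) ≡ true → Edge (suc q) p × suc q ℕ.≤ n
  upD⁻ q p e with ∧-true⁻ {inHexUp (D (suc q) p)} e
  ... | h , nb with hexD⁻ (suc q) p (u-D p) (v-D (suc q)) (hex⁻ (cu - p - + 1) (cv - + suc q) h)
  ... | (h₁ , h₂ , h₃ , h₄) , h₅ = (h₁ , h₂ , h₃ , h₄ , off) , drop‿+≤+ h₅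
    where
    r₁ : ∀ cu p → + 0 - (cu - p - + 1 - cu + + 1) ≡ p - + 0
    r₁ = solve-∀
    r₂ : ∀ cv q → + 0 - (cv - (+ 1 + q) - cv + + 1) ≡ q - + 0
    r₂ = solve-∀
    r₃ : ∀ cu cv p q k → cu - p - + 1 - cu + (cv - q - cv) - - k ≡ k - (p + q + + 1)
    r₃ = solve-∀
    off : + 0 ≤ p → + k ≤ p + + suc q
    off 0≤p with + k ≤? p + + suc q
    ... | yes k≤ = k≤
    ... | no k≰ = ⊥-elim (not-true⁻ nb (trans (∨-comm (lobe₁ (cu - p - + 1 - cu) (cv - + suc q - cv)) (lobe₂ (cu - p - + 1 - cu) (cv - + suc q - cv)))
      (cong (_∨ lobe₁ (cu - p - + 1 - cu) (cv - + suc q - cv))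
      (∧-true⁺ (≤ᵇ⁺ {cu - p - + 1 - cu + + 1} {+ 0} (lin 0≤p (r₁ cu p))) (∧-true⁺ (≤ᵇ⁺ {cv - + suc q - cv + + 1} {+ 0} (lin (ℤ.+≤+ (ℕ.z≤n {q})) (r₂ cv (+ q)))) (≤ᵇ⁺ { - K} {cu - p - + 1 - cu + (cv - + suc q - cv)} (lin (≰⇒+1≤ k≰) (r₃ cu cv p (+ suc q) K′))))))))

  upD⁺ : ∀ q p → Edge (suc q) p → suc q ℕ.≤ n → inRegionUp (D (suc q) p) ≡ true
  upD⁺ q p (h₁ , h₂ , h₃ , h₄ , off) q≤n = ∧-true⁺
    (hex⁺ (cu - p - + 1) (cv - + suc q) (hexD⁺ q p (u-D p) (v-D (suc q)) (h₁ , h₂ , h₃ , h₄) (ℤ.+≤+ q≤n)))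
    (not-true⁺ λ e → bow (∨-true⁻ {lobe₁ (cu - p - + 1 - cu) (cv - + suc q - cv)} e))
    where
    r₁ : ∀ cu p → p - + 0 ≡ + 0 - (cu - p - + 1 - cu + + 1)
    r₁ = solve-∀
    r₂ : ∀ cv q → - + 1 - q ≡ cv - (+ 1 + q) - cv - + 0
    r₂ = solve-∀
    r₃ : ∀ cu cv p q k → k - (p + q + + 1) ≡ cu - p - + 1 - cu + (cv - q - cv) - - k
    r₃ = solve-∀
    bow : lobe₁ (cu - p - + 1 - cu) (cv - + suc q - cv) ≡ true ⊎ lobe₂ (cu - p - + 1 - cu) (cv - + suc q - cv) ≡ true → ⊥
    bow (inj₂ e) =
      let e₁ , e = ∧-true⁻ {cu - p - + 1 - cu + + 1 ≤ᵇ + 0} e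
          _ , e₃ = ∧-true⁻ {cv - + suc q - cv + + 1 ≤ᵇ + 0} e
      in clash (off (lin (≤ᵇ⁻ {cu - p - + 1 - cu + + 1} {+ 0} e₁) (r₁ cu p))) (lin (≤ᵇ⁻ { - K} {cu - p - + 1 - cu + (cv - + suc q - cv)} e₃) (r₃ cu cv p (+ suc q) K′))
    bow (inj₁ e) =
      let _ , e = ∧-true⁻ {+ 0 ≤ᵇ cu - p - + 1 - cu} e
          e₂ , _ = ∧-true⁻ {+ 0 ≤ᵇ cv - + suc q - cv} e
      in impossible (lin {c = + q} {d = -[1+ 0 ]} (≤ᵇ⁻ {+ 0} {cv - + suc q - cv} e₂) (r₂ cv (+ q)))
      where
      impossible : + q ≤ -[1+ 0 ] → ⊥
      impossible ()

  -- The sign of v - cv decides. Cells below the axis are read through the rotation, so all later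
  -- arguments take place in the upper half. The heights of `D` start at 1, since the down triangle
  -- below a segment on the axis belongs to the lower half.
  cell-cases : ∀ e → (∃ λ q → ∃ λ p → e ≡ U q p) ⊎ (∃ λ q → ∃ λ p → e ≡ D (suc q) p)
  cell-cases (u , v) with v - cv in eq
  ... | + q = inj₁ (q , u - cu , cong₂ _,_ (r₁ cu u) (trans (r₁ cv v) (cong (λ w → cv + w) eq)))
    where
    r₁ : ∀ cu u → u ≡ cu + (u - cu)
    r₁ = solve-∀
  ... | -[1+ q ] = inj₂ (q , cu - u - + 1 , cong₂ _,_ (r₂ cu u) (trans (r₁ cv v) (cong (λ w → cv + w) eq)))
    where
    r₁ : ∀ cu u → u ≡ cu + (u - cu)
    r₁ = solve-∀
    r₂ : ∀ cu u → u ≡ cu - (cu - u - + 1) - + 1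
    r₂ = solve-∀

  -- The rotation exchanges opposite sides of the hexagon and the two lobes, so the conjuncts and
  -- disjuncts match after pairwise transposition.
  down-rot : ∀ e → inRegionDown e ≡ inRegionUp (rot e)
  down-rot (u , v) = cong₂ _∧_ hex (cong not bow)
    where
    swap : ∀ {β β′ γ γ′ δ δ′} → β ≡ γ′ → γ ≡ β′ → δ ≡ δ′ → β ∧ (γ ∧ δ) ≡ β′ ∧ (γ′ ∧ δ′)
    swap {β} {_} {γ} {_} {δ} refl refl refl = trans (sym (∧-assoc β γ δ)) (trans (cong (_∧ δ) (∧-comm β γ)) (∧-assoc γ β δ))
    swap₂ : ∀ {β β′ γ γ′} → β ≡ γ′ → γ ≡ β′ → β ∧ γ ≡ β′ ∧ γ′
    swap₂ {β} {_} {γ} refl refl = ∧-comm β γ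
    u′ v′ : ℤ
    u′ = cu + cu - u - + 1
    v′ = cv + cv - v - + 1
    r₁ : ∀ k b c v → v - + 0 ≡ k + (b + b) + (k + (c + c)) - (k + (b + c) + (k + (b + c)) - v - + 1 + + 1)
    r₁ = solve-∀
    r₂ : ∀ k b c v → k + (b + b) + (k + (c + c)) - (v + + 1) ≡ k + (b + c) + (k + (b + c)) - v - + 1 - + 0
    r₂ = solve-∀
    r₃ : ∀ k a c u → u - - (k + (c + c)) ≡ k + (a + a) - (k + (a + c) - (k + (c + c)) + (k + (a + c) - (k + (c + c))) - u - + 1 + + 1)
    r₃ = solve-∀
    r₄ : ∀ k a c u → k + (a + a) - (u + + 1) ≡ k + (a + c) - (k + (c + c)) + (k + (a + c) - (k + (c + c))) - u - + 1 - - (k + (c + c))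
    r₄ = solve-∀
    r₅ : ∀ k a b c u v → u + v + + 1 - + 0 ≡ k + (a + a) + (k + (b + b)) -
      (k + (a + c) - (k + (c + c)) + (k + (a + c) - (k + (c + c))) - u - + 1 + (k + (b + c) + (k + (b + c)) - v - + 1) + + 1)
    r₅ = solve-∀
    r₆ : ∀ k a b c u v → k + (a + a) + (k + (b + b)) - (u + v + + 2) ≡
      k + (a + c) - (k + (c + c)) + (k + (a + c) - (k + (c + c))) - u - + 1 + (k + (b + c) + (k + (b + c)) - v - + 1) - + 0
    r₆ = solve-∀
    hex : inHexDown (u , v) ≡ inHexUp (u′ , v′)
    hex = swap (≤ᵇ-cong {+ 0} {v} {v′ + + 1} {Y + Z} (trans (r₁ K′ b′ c′ v) (cong (λ w → Y + Z - (w + w - v - + 1 + + 1)) (sym cv≡))))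
               (≤ᵇ-cong {v + + 1} {Y + Z} {+ 0} {v′} (trans (r₂ K′ b′ c′ v) (cong (λ w → w + w - v - + 1 - + 0) (sym cv≡))))
         (swap (≤ᵇ-cong { - Z} {u} {u′ + + 1} {X} (trans (r₃ K′ a′ c′ u) (cong (λ w → X - (w + w - u - + 1 + + 1)) (sym cu≡))))
               (≤ᵇ-cong {u + + 1} {X} { - Z} {u′} (trans (r₄ K′ a′ c′ u) (cong (λ w → w + w - u - + 1 - - Z) (sym cu≡))))
         (swap₂ (≤ᵇ-cong {+ 0} {u + v + + 1} {u′ + v′ + + 1} {X + Y} (trans (r₅ K′ a′ b′ c′ u v) (cong₂ (λ w w′ → X + Y - (w + w - u - + 1 + (w′ + w′ - v - + 1) + + 1)) (sym cu≡) (sym cv≡))))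
                (≤ᵇ-cong {u + v + + 2} {X + Y} {+ 0} {u′ + v′} (trans (r₆ K′ a′ b′ c′ u v) (cong₂ (λ w w′ → w + w - u - + 1 + (w′ + w′ - v - + 1) - + 0) (sym cu≡) (sym cv≡))))))
    s₁ : ∀ cu u → u - cu - + 0 ≡ + 0 - (cu + cu - u - + 1 - cu + + 1)
    s₁ = solve-∀
    s₂ : ∀ cu u → + 0 - (u - cu + + 1) ≡ cu + cu - u - + 1 - cu - + 0
    s₂ = solve-∀
    s₃ : ∀ cu cv u v k → k - (u - cu + (v - cv) + + 2) ≡ cu + cu - u - + 1 - cu + (cv + cv - v - + 1 - cv) - - k
    s₃ = solve-∀
    s₄ : ∀ cu cv u v k → u - cu + (v - cv) + + 1 - - k ≡ k - (cu + cu - u - + 1 - cu + (cv + cv - v - + 1 - cv) + + 1)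
    s₄ = solve-∀
    bow : inBowtieDown (u , v) ≡ inBowtieUp (u′ , v′)
    bow = trans (∨-comm ((+ 0 ≤ᵇ u - cu) ∧ (+ 0 ≤ᵇ v - cv) ∧ (u - cu + (v - cv) + + 2 ≤ᵇ K))
                        ((u - cu + + 1 ≤ᵇ + 0) ∧ (v - cv + + 1 ≤ᵇ + 0) ∧ (- K ≤ᵇ u - cu + (v - cv) + + 1)))
      (cong₂ _∨_ (cong₂ _∧_ (≤ᵇ-cong {u - cu + + 1} {+ 0} {+ 0} {u′ - cu} (s₂ cu u)) (cong₂ _∧_ (≤ᵇ-cong {v - cv + + 1} {+ 0} {+ 0} {v′ - cv} (s₂ cv v)) (≤ᵇ-cong { - K} {u - cu + (v - cv) + + 1} {u′ - cu + (v′ - cv) + + 1} {K} (s₄ cu cv u v K))))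
                 (cong₂ _∧_ (≤ᵇ-cong {+ 0} {u - cu} {u′ - cu + + 1} {+ 0} (s₁ cu u)) (cong₂ _∧_ (≤ᵇ-cong {+ 0} {v - cv} {v′ - cv + + 1} {+ 0} (s₁ cv v)) (≤ᵇ-cong {u - cu + (v - cv) + + 2} {K} { - K} {u′ - cu + (v′ - cv)} (s₃ cu cv u v K)))))

-- Centrally symmetric tilings as colourings compatible with three involutions

module Colourings (k a b c : ℕ) where
  open import Data.Fin using (Fin; zero; suc)
  open import Data.Integer using (_+_; _-_; _*_; -_; _^_; _<_; _≤_)
  open TupleSums using (lin; <⇒+1≤; +1≤⇒<)
  open Lists
  open Geometry k a b c

  ∈-range⁺ : ∀ s m {v} → s ≤ v → v < s + + m → v ∈ range s m
  ∈-range⁺ s zero p q = ⊥-elim (<-irrefl refl (≤-<-trans p (<-≤-trans q (≤-reflexive (+-identityʳ s)))))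
  ∈-range⁺ s (suc m) {v} p q with s ≟ v
  ... | yes refl = here refl
  ... | no s≢v = there (∈-range⁺ (s + + 1) m (<⇒+1≤ (≤∧≢⇒< p s≢v)) (<-≤-trans q (≤-reflexive (sym (+-assoc s (+ 1) (+ m))))))

  ∈-range⁻ : ∀ s m {v} → v ∈ range s m → s ≤ v
  ∈-range⁻ s (suc m) (here refl) = ≤-refl
  ∈-range⁻ s (suc m) (there p) = ≤-trans (i≤i+j s (+ 1)) (∈-range⁻ (s + + 1) m p)

  unique-range : ∀ s m → Unique (range s m)
  unique-range s zero = []
  unique-range s (suc m) = All.tabulate (λ p e → <-irrefl e (+1≤⇒< (∈-range⁻ (s + + 1) m p))) ∷ unique-range (s + + 1) m

  unique-box : Unique box
  unique-box = unique-concatMap _ (range (- Z) (x ℕ.+ z)) (unique-range (- Z) (x ℕ.+ z))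
    (λ u _ → unique-map (u ,_) (range (+ 0) (y ℕ.+ z)) (λ _ _ e → proj₂ (,-injective e)) (unique-range (+ 0) (y ℕ.+ z)))
    λ p q → same (∈-map⁻ _ p) (∈-map⁻ _ q)
    where
    same : ∀ {u u′ e} → (∃ λ v → v ∈ range (+ 0) (y ℕ.+ z) × e ≡ (u , v)) → (∃ λ v → v ∈ range (+ 0) (y ℕ.+ z) × e ≡ (u′ , v)) → u ≡ u′
    same (_ , _ , refl) (_ , _ , refl) = refl

  ∈-up⁻ : ∀ {e} → e ∈ upCells → inRegionUp e ≡ true
  ∈-up⁻ p = proj₂ (∈-filterB⁻ inRegionUp box p)

  ∈-up⁺ : ∀ {e} → inRegionUp e ≡ true → e ∈ upCells
  ∈-up⁺ {u , v} e with hex⁻ u v (proj₁ (∧-true⁻ {inHexUp (u , v)} e))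
  ... | h₁ , h₂ , h₃ , h₄ , _ = ∈-filterB⁺ inRegionUp
    (∈-concatMap⁺ _ (∈-range⁺ (- Z) (x ℕ.+ z) h₃ (+1≤⇒< (≤-trans h₄ (≤-reflexive (r₁ X Z)))))
                    (∈-map⁺ (u ,_) (∈-range⁺ (+ 0) (y ℕ.+ z) h₁ (+1≤⇒< (≤-trans h₂ (≤-reflexive (r₂ (Y + Z)))))))) e
    where
    r₁ : ∀ X Z → X ≡ - Z + (X + Z)
    r₁ = solve-∀
    r₂ : ∀ w → w ≡ + 0 + w
    r₂ = solve-∀

  unique-up : Unique upCells
  unique-up = unique-filterB inRegionUp box unique-box

  -- ι δ e is the up triangle whose lozenge in direction δ is the rotated image of the lozenge of e in direction δ.
  ι : Fin 3 → Cell → Cell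
  ι δ e = rot (partner e δ)

  rot-rot : ∀ e → rot (rot e) ≡ e
  rot-rot (u , v) = cong₂ _,_ (r cu u) (r cv v)
    where
    r : ∀ w u → w + w - (w + w - u - + 1) - + 1 ≡ u
    r = solve-∀

  partner-ι : ∀ δ e → partner (ι δ e) δ ≡ rot e
  partner-ι zero (u , v) = refl
  partner-ι (suc zero) (u , v) = cong (_, cv + cv - v - + 1) (r cu u)
    where
    r : ∀ w u → w + w - (u - + 1) - + 1 - + 1 ≡ w + w - u - + 1
    r = solve-∀
  partner-ι (suc (suc zero)) (u , v) = cong (cu + cu - u - + 1 ,_) (r cv v)
    where
    r : ∀ w u → w + w - (u - + 1) - + 1 - + 1 ≡ w + w - u - + 1
    r = solve-∀

  ι-ι : ∀ δ e → ι δ (ι δ e) ≡ e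
  ι-ι δ e = trans (cong rot (partner-ι δ e)) (rot-rot e)

  partner-injective : ∀ δ δ′ e → partner e δ ≡ partner e δ′ → δ ≡ δ′
  partner-injective δ δ′ (u , v) = go δ δ′
    where
    w≢w-1 : ∀ w → w ≢ w - + 1
    w≢w-1 w e = <-irrefl (sym e) (+1≤⇒< (≤-reflexive (r w)))
      where
      r : ∀ w → w - + 1 + + 1 ≡ w
      r = solve-∀
    go : ∀ δ δ′ → partner (u , v) δ ≡ partner (u , v) δ′ → δ ≡ δ′
    go zero zero _ = refl
    go zero (suc zero) e = ⊥-elim (w≢w-1 u (proj₁ (,-injective e)))
    go zero (suc (suc zero)) e = ⊥-elim (w≢w-1 v (proj₂ (,-injective e)))
    go (suc zero) zero e = ⊥-elim (w≢w-1 u (sym (proj₁ (,-injective e))))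
    go (suc zero) (suc zero) _ = refl
    go (suc zero) (suc (suc zero)) e = ⊥-elim (w≢w-1 v (proj₂ (,-injective e)))
    go (suc (suc zero)) zero e = ⊥-elim (w≢w-1 v (sym (proj₂ (,-injective e))))
    go (suc (suc zero)) (suc zero) e = ⊥-elim (w≢w-1 u (proj₁ (,-injective e)))
    go (suc (suc zero)) (suc (suc zero)) _ = refl

  ==⁻ : ∀ {d e : Cell} → (d == e) ≡ true → d ≡ e
  ==⁻ {u , v} {u′ , v′} p with u ≟ u′ | v ≟ v′
  ... | yes refl | yes refl = refl

  ==⁺ : ∀ {d e : Cell} → d ≡ e → (d == e) ≡ true
  ==⁺ {u , v} refl = ∧-true⁺ (dec-true (u ≟ u) refl) (dec-true (v ≟ v) refl)

  -- A centrally symmetric tiling is a colouring f of the up triangles by directions that is compatible with the involutions ι.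
  Good : (Cell → Fin 3) → Set
  Good f = ∀ {e} → e ∈ upCells → ι (f e) e ∈ upCells × f (ι (f e) e) ≡ f e

  valid : List (Fin 3) → Bool
  valid l = isTiling l ∧ isSymmetric l

  module _ (f : Cell → Fin 3) where

    lozenge : Cell → Cell × Cell
    lozenge e = e , partner e (f e)

    pairs≡ : pairs (map f upCells) ≡ map lozenge upCells
    pairs≡ = trans (cong (map _) (zip-map f upCells)) (sym (map-∘ upCells))

    -- The rotated image of the lozenge of e is a lozenge of the tiling. Its up triangle is
    -- `ι (f e) e`, and `partner-injective` identifies its direction with that of e.
    valid⇒good : valid (map f upCells) ≡ true → Good f
    valid⇒good v {e} e∈ with anyB⁻ _ (pairs (map f upCells)) (allB⁻ _ (pairs (map f upCells)) (proj₂ (∧-true⁻ {isTiling (map f upCells)} v))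
        (subst (lozenge e ∈_) (sym pairs≡) (∈-map⁺ lozenge e∈)))
    ... | q , q∈ , e₁ with ∈-map⁻ lozenge (subst (q ∈_) pairs≡ q∈)
    ... | e′ , e′∈ , refl with ==⁻ {e′} {ι (f e) e} (proj₁ (∧-true⁻ {e′ == ι (f e) e} e₁)) | ==⁻ {partner e′ (f e′)} {rot e} (proj₂ (∧-true⁻ {e′ == ι (f e) e} e₁))
    ... | refl | e₂ = e′∈ , partner-injective (f (ι (f e) e)) (f e) (ι (f e) e) (trans e₂ (sym (partner-ι (f e) e)))

    module _ (good : Good f) where

      -- A down triangle d is the image of the up triangle `rot d`. If that has direction δ, the up
      -- triangle matched with d is `ι δ (rot d)`; as ι is an involution preserving colours, no
      -- other up triangle reaches d.
      covered : ∀ {d} → d ∈ downCells → length (filterB (λ e → partner e (f e) == d) upCells) ≡ 1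
      covered {d} d∈ = filterB-single _ upCells unique-up (proj₁ (good rd∈))
        (==⁺ (trans (cong (partner (ι (f (rot d)) (rot d))) (proj₂ (good rd∈))) (trans (partner-ι (f (rot d)) (rot d)) (rot-rot d))))
        λ {e} e∈ p → sym (trans (cong₂ ι (trans (cong f (sym (ιe e p))) (proj₂ (good e∈))) (sym (ιe e p))) (ι-ι (f e) e))
        where
        rd∈ : rot d ∈ upCells
        rd∈ = ∈-up⁺ (trans (sym (down-rot d)) (proj₂ (∈-filterB⁻ inRegionDown box d∈)))
        ιe : ∀ e → (partner e (f e) == d) ≡ true → ι (f e) e ≡ rot d
        ιe e p = cong rot (==⁻ {partner e (f e)} p)

      good⇒valid : valid (map f upCells) ≡ true
      good⇒valid = ∧-true⁺ (∧-true⁺ (allB⁺ _ (pairs (map f upCells)) inside) (allB⁺ _ downCells λ {d} d∈ → dec-true (count (λ p → proj₂ p == d) (pairs (map f upCells)) ℕ.≟ 1) (once d∈)))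
                           (allB⁺ _ (pairs (map f upCells)) symmetric)
        where
        inside : ∀ {p} → p ∈ pairs (map f upCells) → inRegionDown (proj₂ p) ≡ true
        inside {p} p∈ with ∈-map⁻ lozenge (subst (p ∈_) pairs≡ p∈)
        ... | e , e∈ , refl = trans (down-rot (partner e (f e))) (∈-up⁻ (proj₁ (good e∈)))
        once : ∀ {d} → d ∈ downCells → count (λ p → proj₂ p == d) (pairs (map f upCells)) ≡ 1
        once {d} d∈ = trans (cong (count (λ p → proj₂ p == d)) pairs≡)
          (trans (length-filterB-map (λ p → proj₂ p == d) lozenge upCells) (covered d∈))
        symmetric : ∀ {p} → p ∈ pairs (map f upCells) →
          anyB (λ q → (proj₁ q == rot (proj₂ p)) ∧ (proj₂ q == rot (proj₁ p))) (pairs (map f upCells)) ≡ true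
        symmetric {p} p∈ with ∈-map⁻ lozenge (subst (p ∈_) pairs≡ p∈)
        ... | e , e∈ , refl = anyB⁺ _ (subst (lozenge (ι (f e) e) ∈_) (sym pairs≡) (∈-map⁺ lozenge (proj₁ (good e∈))))
          (∧-true⁺ (==⁺ {ι (f e) e} refl) (==⁺ (trans (cong (partner (ι (f e) e)) (proj₂ (good e∈))) (partner-ι (f e) e))))

  ∈-assignments⁺ : ∀ l → l ∈ assignments (length l)
  ∈-assignments⁺ [] = here refl
  ∈-assignments⁺ (δ ∷ l) = ∈-concatMap⁺ (λ l → map (_∷ l) (zero ∷ suc zero ∷ suc (suc zero) ∷ [])) (∈-assignments⁺ l) (∈-map⁺ (_∷ l) (all-colours δ))
    where
    all-colours : ∀ (δ : Fin 3) → δ ∈ zero ∷ suc zero ∷ suc (suc zero) ∷ []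
    all-colours zero = here refl
    all-colours (suc zero) = there (here refl)
    all-colours (suc (suc zero)) = there (there (here refl))

  ∈-assignments⁻ : ∀ m {l} → l ∈ assignments m → length l ≡ m
  ∈-assignments⁻ zero (here refl) = refl
  ∈-assignments⁻ (suc m) p with ∈-concatMap⁻ _ (assignments m) p
  ... | l , l∈ , q with ∈-map⁻ (_∷ l) q
  ... | _ , _ , refl = cong suc (∈-assignments⁻ m l∈)

  unique-assignments : ∀ m → Unique (assignments m)
  unique-assignments zero = [] ∷ []
  unique-assignments (suc m) = unique-concatMap _ (assignments m) (unique-assignments m)
    (λ l _ → unique-map (_∷ l) _ (λ _ _ e → proj₁ (∷-injective e)) (((λ ()) ∷ (λ ()) ∷ []) ∷ (((λ ()) ∷ []) ∷ ([] ∷ []))))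
    λ p q → same (∈-map⁻ _ p) (∈-map⁻ _ q)
    where
    same : ∀ {l l′ m} → (∃ λ δ → δ ∈ zero ∷ suc zero ∷ suc (suc zero) ∷ [] × m ≡ δ ∷ l) → (∃ λ δ → δ ∈ zero ∷ suc zero ∷ suc (suc zero) ∷ [] × m ≡ δ ∷ l′) → l ≡ l′
    same (_ , _ , refl) (_ , _ , refl) = refl

  symmetricTilings : List (List (Fin 3))
  symmetricTilings = filterB valid (assignments (length upCells))

  M⊙B≡ : M⊙B x y z k ≡ length symmetricTilings
  M⊙B≡ = refl

  unique-symmetricTilings : Unique symmetricTilings
  unique-symmetricTilings = unique-filterB valid _ (unique-assignments (length upCells))

  good⇒∈ : ∀ f → Good f → map f upCells ∈ symmetricTilings
  good⇒∈ f g = ∈-filterB⁺ valid (subst (λ m → map f upCells ∈ assignments m) (length-map f upCells) (∈-assignments⁺ (map f upCells))) (good⇒valid f g)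

  private
    _≟ᶜ_ : (d e : Cell) → Dec (d ≡ e)
    d ≟ᶜ e with d == e in p
    ... | true = yes (==⁻ p)
    ... | false = no λ q → case trans (sym p) (==⁺ q) of λ ()

    colour : List Cell → List (Fin 3) → Cell → Fin 3
    colour (d ∷ ds) (δ ∷ l) e with d ≟ᶜ e
    ... | yes _ = δ
    ... | no _ = colour ds l e
    colour _ _ _ = zero

    map-colour : ∀ ds l → Unique ds → length l ≡ length ds → map (colour ds l) ds ≡ l
    map-colour [] [] _ _ = refl
    map-colour (d ∷ ds) (δ ∷ l) (d∉ ∷ u) len = cong₂ _∷_ head
      (trans (map-cong-∈ ds tail) (map-colour ds l u (ℕₚ.suc-injective len)))
      where
      head : colour (d ∷ ds) (δ ∷ l) d ≡ δ
      head with d ≟ᶜ d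
      ... | yes _ = refl
      ... | no ¬e = ⊥-elim (¬e refl)
      tail : ∀ {e} → e ∈ ds → colour (d ∷ ds) (δ ∷ l) e ≡ colour ds l e
      tail {e} e∈ with d ≟ᶜ e
      ... | yes refl = ⊥-elim (All.lookup d∉ e∈ refl)
      ... | no _ = refl

    colour-outside : ∀ ds l e → ¬ (e ∈ ds) → colour ds l e ≡ zero
    colour-outside [] l e _ = refl
    colour-outside (d ∷ ds) [] e _ = refl
    colour-outside (d ∷ ds) (δ ∷ l) e e∉ with d ≟ᶜ e
    ... | yes refl = ⊥-elim (e∉ (here refl))
    ... | no _ = colour-outside ds l e λ p → e∉ (there p)

  -- The value `zero` off the region is a deliberate normalisation: a nonzero colour certifies that
  -- its cell lies in the region, and segments of the top side will count as occupied.
  ∈⇒good : ∀ {l} → l ∈ symmetricTilings → ∃ λ f → Good f × map f upCells ≡ l × (∀ e → ¬ (e ∈ upCells) → f e ≡ zero)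
  ∈⇒good {l} p with ∈-filterB⁻ valid (assignments (length upCells)) p
  ... | l∈ , v = colour upCells l , valid⇒good (colour upCells l) (subst (λ m → valid m ≡ true) (sym e) v) , e , colour-outside upCells l
    where
    e : map (colour upCells l) upCells ≡ l
    e = map-colour upCells l unique-up (∈-assignments⁻ (length upCells) l∈)

-- The dictionary between directions and steps of walks

module WalkColourings (k a b c : ℕ) where
  open import Data.Fin using (Fin; zero; suc)
  open import Data.Integer using (_+_; _-_; _*_; -_; _^_; _<_; _≤_)
  open Weights using (pre; suc′)
  open TupleSums using (lin; <⇒+1≤; +1≤⇒<; Strict)
  open Evaluation using (mirror)
  open Configurations
  open Totals
  open Lists
  open WalkLists
  open Geometry k a b c
  open Colourings k a b c

  -- The involutions in upper-half coordinates: directions 0 and 1 lead from a segment to a segment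
  -- one level up, at p or p - 1, while direction 2 joins the two triangles at one segment, or on
  -- the axis the segments p and -1 - p.
  ι-0-U : ∀ q p → ι zero (U q p) ≡ D (suc q) p
  ι-0-U q p = cong₂ _,_ (r₁ cu p) (r₂ cv (+ q))
    where
    r₁ : ∀ cu p → cu + cu - (cu + p) - + 1 ≡ cu - p - + 1
    r₁ = solve-∀
    r₂ : ∀ cv q → cv + cv - (cv + q) - + 1 ≡ cv - (+ 1 + q)
    r₂ = solve-∀

  ι-1-U : ∀ q p → ι (suc zero) (U q p) ≡ D (suc q) (pre p)
  ι-1-U q p = cong₂ _,_ (r₁ cu p) (r₂ cv (+ q))
    where
    r₁ : ∀ cu p → cu + cu - (cu + p - + 1) - + 1 ≡ cu - (p - + 1) - + 1
    r₁ = solve-∀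
    r₂ : ∀ cv q → cv + cv - (cv + q) - + 1 ≡ cv - (+ 1 + q)
    r₂ = solve-∀

  ι-2-U₀ : ∀ p → ι (suc (suc zero)) (U 0 p) ≡ U 0 (mirror p)
  ι-2-U₀ p = cong₂ _,_ (r₁ cu p) (r₂ cv)
    where
    r₁ : ∀ cu p → cu + cu - (cu + p) - + 1 ≡ cu + (- + 1 - p)
    r₁ = solve-∀
    r₂ : ∀ cv → cv + cv - (cv + + 0 - + 1) - + 1 ≡ cv + + 0
    r₂ = solve-∀

  ι-2-U : ∀ q p → ι (suc (suc zero)) (U (suc q) p) ≡ D (suc q) p
  ι-2-U q p = cong₂ _,_ (r₁ cu p) (r₂ cv (+ suc q))
    where
    r₁ : ∀ cu p → cu + cu - (cu + p) - + 1 ≡ cu - p - + 1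
    r₁ = solve-∀
    r₂ : ∀ cv q → cv + cv - (cv + q - + 1) - + 1 ≡ cv - q
    r₂ = solve-∀

  ι-0-D : ∀ q p → ι zero (D (suc q) p) ≡ U q p
  ι-0-D q p = trans (cong (ι zero) (sym (ι-0-U q p))) (ι-ι zero (U q p))

  ι-1-D : ∀ q p → ι (suc zero) (D (suc q) p) ≡ U q (suc′ p)
  ι-1-D q p = trans (cong (λ w → ι (suc zero) (D (suc q) w)) (r p))
    (trans (cong (ι (suc zero)) (sym (ι-1-U q (suc′ p)))) (ι-ι (suc zero) (U q (suc′ p))))
    where
    r : ∀ p → p ≡ p + + 1 - + 1
    r = solve-∀

  ι-2-D : ∀ q p → ι (suc (suc zero)) (D (suc q) p) ≡ U (suc q) p
  ι-2-D q p = trans (cong (ι (suc (suc zero))) (sym (ι-2-U q p))) (ι-ι (suc (suc zero)) (U (suc q) p))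

  dir : Bool → Fin 3
  dir false = zero
  dir true = suc zero

  -- The default is direction 2, the lozenge straddling the horizontal segment: the walks cross
  -- exactly the segments that are not straddled.
  look : ℤ → Row → Fin 3
  look p [] = suc (suc zero)
  look p ((w , β) ∷ R) with p ≟ w
  ... | yes _ = dir β
  ... | no _ = look p R

  -- A cell `D (suc q) p` gets the colour of the step that ends at p, so the row is indexed by end
  -- points instead of starting points.
  shift : Row → Row
  shift = map (λ e → target e , proj₂ e)

  bots-shift : ∀ R → bots (shift R) ≡ tops R
  bots-shift R = sym (map-∘ R)

  look-∈ : ∀ {p β} R → Strict (bots R) → (p , β) ∈ R → look p R ≡ dir β
  look-∈ {p} ((w , β) ∷ R) s q with p ≟ w
  look-∈ ((w , β) ∷ R) s (here refl) | yes _ = refl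
  look-∈ ((w , β) ∷ R) s (there q) | yes refl = ⊥-elim (<-irrefl refl (All.lookup (strict-head s) (∈-map⁺ proj₁ q)))
  look-∈ ((w , β) ∷ R) s (here refl) | no ¬e = ⊥-elim (¬e refl)
  look-∈ ((w , β) ∷ R) s (there q) | no _ = look-∈ R (strict-tail s) q

  look-∉ : ∀ {p} R → p ∉ bots R → look p R ≡ suc (suc zero)
  look-∉ [] _ = refl
  look-∉ {p} ((w , β) ∷ R) p∉ with p ≟ w
  ... | yes refl = ⊥-elim (p∉ (here refl))
  ... | no _ = look-∉ R λ q → p∉ (there q)

  look-cases : ∀ p R → (∃ λ β → (p , β) ∈ R × look p R ≡ dir β) ⊎ (p ∉ bots R × look p R ≡ suc (suc zero))
  look-cases p [] = inj₂ ((λ ()) , refl)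
  look-cases p ((w , β) ∷ R) with p ≟ w
  ... | yes refl = inj₁ (β , here refl , refl)
  ... | no p≢w with look-cases p R
  ... | inj₁ (β′ , q , e) = inj₁ (β′ , there q , e)
  ... | inj₂ (p∉ , e) = inj₂ ((λ { (here p≡w) → p≢w p≡w ; (there q) → p∉ q }) , e)

  rowAt : List Row → ℕ → Row
  rowAt [] _ = []
  rowAt (R ∷ Rs) zero = R
  rowAt (R ∷ Rs) (suc q) = rowAt Rs q

  select : List Row → ℤ → ℤ → ℤ → Fin 3
  select Rs (+ q) p _ = look p (rowAt Rs q)
  select Rs -[1+ q ] _ p = look p (shift (rowAt Rs q))

  colourOf : List Row → Cell → Fin 3
  colourOf Rs (u , v) = select Rs (v - cv) (u - cu) (cu - u - + 1)

  colourOf-U : ∀ Rs q p → colourOf Rs (U q p) ≡ look p (rowAt Rs q)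
  colourOf-U Rs q p = trans (cong (λ w → select Rs w (cu + p - cu) (cu - (cu + p) - + 1)) (r cv (+ q)))
                            (cong (λ w → look w (rowAt Rs q)) (r cu p))
    where
    r : ∀ cu p → cu + p - cu ≡ p
    r = solve-∀

  colourOf-D : ∀ Rs q p → colourOf Rs (D (suc q) p) ≡ look p (shift (rowAt Rs q))
  colourOf-D Rs q p = trans (cong (λ w → select Rs w (cu - p - + 1 - cu) (cu - (cu - p - + 1) - + 1)) (r cv (+ q)))
                            (cong (λ w → look w (shift (rowAt Rs q))) (r′ cu p))
    where
    r : ∀ cv q → cv - (+ 1 + q) - cv ≡ - (+ 1 + q)
    r = solve-∀
    r′ : ∀ cu p → cu - (cu - p - + 1) - + 1 ≡ p
    r′ = solve-∀

  open Walks A x using (top)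

  row-strict : ∀ {m T Rs} → Walk A x m T Rs → ∀ q → q ℕ.< m → Strict (bots (rowAt Rs q))
  row-strict (step R s w) zero _ = s
  row-strict (step R s w) (suc q) (ℕ.s≤s q<m) = row-strict w q q<m

  row-first : ∀ {m T Rs} → Walk A x m T Rs → 0 ℕ.< m → bots (rowAt Rs 0) ≡ T
  row-first (step R s w) _ = refl

  row-next : ∀ {m T Rs} → Walk A x m T Rs → ∀ q → suc q ℕ.< m → tops (rowAt Rs q) ≡ bots (rowAt Rs (suc q))
  row-next (step R s w) zero (ℕ.s≤s 0<m) = sym (row-first w 0<m)
  row-next (step R s w) (suc q) (ℕ.s≤s q<m) = row-next w q q<m

  row-last : ∀ {m T Rs} → Walk A x m T Rs → ∀ q → suc q ≡ m → tops (rowAt Rs q) ≡ top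
  row-last (step R s (done e)) zero refl = e
  row-last (step R s w) (suc q) e = row-last w q (ℕₚ.suc-injective e)

  row-tops-strict : ∀ {m T Rs} → Walk A x m T Rs → ∀ q → q ℕ.< m → Strict (tops (rowAt Rs q))
  row-tops-strict w q q<m with ℕₚ.m≤n⇒m<n∨m≡n q<m
  ... | inj₁ sq<m = subst Strict (sym (row-next w q sq<m)) (row-strict w (suc q) sq<m)
  ... | inj₂ sq≡m = subst Strict (sym (row-last w q sq≡m)) (desc-strict (- A) x)

  target-≤ : ∀ e → target e ≤ proj₁ e
  target-≤ (p , false) = ≤-refl
  target-≤ (p , true) = lin (ℤ.+≤+ (ℕ.z≤n {1})) (r p)
    where
    r : ∀ p → p - (p - + 1) ≡ + 1 - + 0
    r = solve-∀

  target-≥ : ∀ e → proj₁ e ≤ target e + + 1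
  target-≥ (p , false) = lin (ℤ.+≤+ (ℕ.z≤n {1})) (r p)
    where
    r : ∀ p → p + + 1 - p ≡ + 1 - + 0
    r = solve-∀
  target-≥ (p , true) = ≤-reflexive (r p)
    where
    r : ∀ p → p ≡ p - + 1 + + 1
    r = solve-∀

  -- The walk is read backwards from `top`: each reversed step keeps its position or raises it by
  -- one.
  walk-bound : ∀ {m T Rs} → Walk A x m T Rs → ∀ {t} → t ∈ T → - A ≤ t × t + + 1 ≤ - A + + x + + m
  walk-bound (done refl) t∈ with All.lookup (desc-between (- A) x) t∈
  ... | p , q = p , ≤-trans (<⇒+1≤ q) (≤-reflexive (sym (+-identityʳ (- A + + x))))
  walk-bound (step {m} R s w) t∈ with ∈-map⁻ proj₁ t∈
  ... | e , e∈ , refl with walk-bound w (∈-map⁺ target e∈)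
  ... | p , q = ≤-trans p (target-≤ e) , lin (+-mono-≤ (target-≥ e) q) (r (proj₁ e) (target e) (- A + + x) (+ m))
    where
    r : ∀ t t′ X m → X + (+ 1 + m) - (t + + 1) ≡ t′ + + 1 + (X + m) - (t + (t′ + + 1))
    r = solve-∀

  -A+x+n : - A + + x + + n ≡ B
  -A+x+n = r (+ k) (+ a) (+ b) (+ c)
    where
    r : ∀ k a b c → - (k + (a + c)) + (k + (a + a)) + (k + (b + c)) ≡ k + (a + b)
    r = solve-∀

  -- The left bound and the upper right bound come from the m steps still to be made towards `top`.
  -- The remaining two sides and the lobe condition are inherited from height h, since a step lowers
  -- the position by at most one.
  edge-target : ∀ {h m} e → h ℕ.+ suc m ≡ n → - A ≤ target e → target e + + 1 ≤ - A + + x + + m → Edge h (proj₁ e) → Edge (suc h) (target e)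
  edge-target {h} {m} e hm p q (h₁ , h₂ , h₃ , h₄ , off) =
    p ,
    ≤-trans (+-monoˡ-≤ (+ 1) (target-≤ e)) h₂ ,
    lin (+-mono-≤ h₃ (target-≥ e)) (r₁ B (proj₁ e) (target e) (+ h)) ,
    lin q (trans (cong (_- (target e + + suc h + + 1)) (trans (sym -A+x+n) (cong (λ w → - A + + x + w) (trans (cong +_ (sym hm)) (pos-+ h (suc m))))))
                 (r₂ (- A + + x) (target e) (+ h) (+ m))) ,
    λ 0≤t → lin (+-mono-≤ (off (≤-trans 0≤t (target-≤ e))) (target-≥ e)) (r₃ (+ k) (proj₁ e) (target e) (+ h))
    where
    r₁ : ∀ B t t′ h → t′ + (+ 1 + h) - - B ≡ t + h + (t′ + + 1) - (- B + t)
    r₁ = solve-∀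
    r₂ : ∀ X t h m → X + (h + (+ 1 + m)) - (t + (+ 1 + h) + + 1) ≡ X + m - (t + + 1)
    r₂ = solve-∀
    r₃ : ∀ k t t′ h → t′ + (+ 1 + h) - k ≡ t + h + (t′ + + 1) - (k + t)
    r₃ = solve-∀

  walk-edges : ∀ {h m T Rs} → h ℕ.+ m ≡ n → Walk A x m T Rs → (∀ {t} → t ∈ T → Edge h t) → ∀ q → q ℕ.< m →
    (∀ {t} → t ∈ bots (rowAt Rs q) → Edge (h ℕ.+ q) t) × (∀ {t} → t ∈ tops (rowAt Rs q) → Edge (suc (h ℕ.+ q)) t)
  walk-edges {h} {suc m} hm (step R {Rs} s w) edges q q<m = go q q<m
    where
    next : ∀ {t} → t ∈ tops R → Edge (suc h) t
    next t∈ with ∈-map⁻ target t∈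
    ... | e , e∈ , refl with walk-bound w (∈-map⁺ target e∈)
    ... | p , q = edge-target e hm p q (edges (∈-map⁺ proj₁ e∈))
    go : ∀ q → q ℕ.< suc m → (∀ {t} → t ∈ bots (rowAt (R ∷ Rs) q) → Edge (h ℕ.+ q) t) × (∀ {t} → t ∈ tops (rowAt (R ∷ Rs) q) → Edge (suc (h ℕ.+ q)) t)
    go zero _ = subst (λ h → (∀ {t} → t ∈ bots R → Edge h t) × (∀ {t} → t ∈ tops R → Edge (suc h) t)) (sym (ℕₚ.+-identityʳ h)) (edges , next)
    go (suc q) (ℕ.s≤s q<m) = subst (λ h → (∀ {t} → t ∈ bots (rowAt Rs q) → Edge h t) × (∀ {t} → t ∈ tops (rowAt Rs q) → Edge (suc h) t))
      (sym (ℕₚ.+-suc h q)) (walk-edges (trans (sym (ℕₚ.+-suc h m)) hm) w next q q<m)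

  mirror-mirror : ∀ t → mirror (mirror t) ≡ t
  mirror-mirror t = r t
    where
    r : ∀ t → - + 1 - (- + 1 - t) ≡ t
    r = solve-∀

  ∈-symm⁻ : ∀ rs {t} → t ∈ symm k rs → t ∈ block k ⊎ t ∈ rs ⊎ mirror t ∈ rs
  ∈-symm⁻ [] p = inj₁ p
  ∈-symm⁻ (r ∷ rs) (here refl) = inj₂ (inj₁ (here refl))
  ∈-symm⁻ (r ∷ rs) (there p) with ∈-++⁻ (symm k rs) p
  ... | inj₂ (here refl) = inj₂ (inj₂ (here (mirror-mirror r)))
  ... | inj₁ q with ∈-symm⁻ rs q
  ... | inj₁ r₁ = inj₁ r₁
  ... | inj₂ (inj₁ r₁) = inj₂ (inj₁ (there r₁))
  ... | inj₂ (inj₂ r₁) = inj₂ (inj₂ (there r₁))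

  ∈-symm-block : ∀ rs {t} → t ∈ block k → t ∈ symm k rs
  ∈-symm-block [] p = p
  ∈-symm-block (r ∷ rs) p = there (∈-++⁺ˡ (∈-symm-block rs p))

  ∈-symm-right : ∀ {rs t} → t ∈ rs → t ∈ symm k rs
  ∈-symm-right (here refl) = here refl
  ∈-symm-right (there p) = there (∈-++⁺ˡ (∈-symm-right p))

  ∈-symm-left : ∀ {rs t} → mirror t ∈ rs → t ∈ symm k rs
  ∈-symm-left {r ∷ rs} {t} (here e) = there (∈-++⁺ʳ (symm k rs) (here (trans (sym (mirror-mirror t)) (cong mirror e))))
  ∈-symm-left (there p) = there (∈-++⁺ˡ (∈-symm-left p))

  ∈-block⁺ : ∀ j {t} → - + j ≤ t → t < + 0 → t ∈ block j
  ∈-block⁺ zero p q = ⊥-elim (<-irrefl refl (≤-<-trans p q))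
  ∈-block⁺ (suc j) {t} p q with - + j ≤? t
  ... | yes r = ∈-++⁺ˡ (∈-block⁺ j r q)
  ... | no ¬r = ∈-++⁺ʳ (block j) (here (≤-antisym (lin (<⇒+1≤ (≰⇒> ¬r)) (e (+ j) t)) p))
    where
    e : ∀ j t → - (+ 1 + j) - t ≡ - j - (t + + 1)
    e = solve-∀

  module _ {rs} (nonneg : All (+ 0 ≤_) rs) (st : Strict (symm k rs)) where

    -- Strictness puts -1 - r to the left of the whole block, whose last entry is -k for k > 0; this
    -- gives r ≥ k.
    symm-outer : ∀ {r} → r ∈ rs → + k ≤ r
    symm-outer = go rs nonneg st
      where
      outer : ∀ j {r rs} → (∀ {t} → t ∈ block j → t ∈ rs) → + 0 ≤ r → All (mirror r <_) rs → + j ≤ r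
      outer zero _ 0≤r _ = 0≤r
      outer (suc j) {r} sub _ lt = lin (<⇒+1≤ (All.lookup lt (sub (∈-++⁺ʳ (block j) (here refl))))) (e r (+ j))
        where
        e : ∀ r j → r - (+ 1 + j) ≡ - (+ 1 + j) - (- + 1 - r + + 1)
        e = solve-∀
      last-< : ∀ us {v} → Strict (us ++ [ v ]) → All (v <_) us
      last-< [] _ = []
      last-< (u ∷ us) s = All.lookup (strict-head s) (∈-++⁺ʳ us (here refl)) ∷ last-< us (strict-tail s)
      go : ∀ rs → All (+ 0 ≤_) rs → Strict (symm k rs) → ∀ {r} → r ∈ rs → + k ≤ r
      go (r ∷ rs) (0≤r ∷ _) s (here refl) = outer k (∈-symm-block rs) 0≤r (last-< (symm k rs) (strict-tail s))
      go (r ∷ rs) (_ ∷ ps) s (there p) = go rs ps (strict-init (symm k rs) (strict-tail s)) p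

    mirror-∈ : ∀ {t} → ¬ (- + k ≤ t × t < + 0) → t ∈ symm k rs → mirror t ∈ symm k rs
    mirror-∈ {t} out t∈ with ∈-symm⁻ rs t∈
    ... | inj₁ p = ⊥-elim (out (All.lookup (block-bounds k) p))
    ... | inj₂ (inj₁ p) = ∈-symm-left (subst (_∈ rs) (sym (mirror-mirror t)) p)
    ... | inj₂ (inj₂ p) = ∈-symm-right p

    symm-off : ∀ {t} → t ∈ symm k rs → + 0 ≤ t → + k ≤ t
    symm-off {t} t∈ 0≤t with ∈-symm⁻ rs t∈
    ... | inj₁ p = ⊥-elim (<-irrefl refl (≤-<-trans 0≤t (proj₂ (All.lookup (block-bounds k) p))))
    ... | inj₂ (inj₁ p) = symm-outer p
    ... | inj₂ (inj₂ p) = ⊥-elim (<-irrefl refl (≤-<-trans (All.lookup nonneg p) (mirror-neg 0≤t)))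

    module _ {Rs} (w : Walk A x n (symm k rs) Rs) where

      symm-bound : ∀ {t} → t ∈ symm k rs → - A ≤ t × t + + 1 ≤ B
      symm-bound t∈ = let p , q = walk-bound w t∈ in p , ≤-trans q (≤-reflexive -A+x+n)

      -- The walk itself yields only -A ≤ t and t + 1 ≤ B. Applied to the mirror image of t, the
      -- same bounds give t + 1 ≤ A and -B ≤ t; the block positions satisfy them directly.
      symm-edge : ∀ {t} → t ∈ symm k rs → Edge 0 t
      symm-edge {t} t∈ = proj₁ bt , proj₁ bounds , subst (- B ≤_) (sym (+-identityʳ t)) (proj₂ bounds) ,
        subst (λ w → w + + 1 ≤ B) (sym (+-identityʳ t)) (proj₂ bt) ,
        λ 0≤t → subst (+ k ≤_) (sym (+-identityʳ t)) (symm-off t∈ 0≤t)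
        where
        bt = symm-bound t∈
        e₁ : ∀ k ac t → k + ac - (t + + 1) ≡ + 0 + (k + ac) - (t + + 1 + + 0)
        e₁ = solve-∀
        e₂ : ∀ k ab t → t - - (k + ab) ≡ t + ab - - k
        e₂ = solve-∀
        e₃ : ∀ A t → A - (t + + 1) ≡ - + 1 - t - - A
        e₃ = solve-∀
        e₄ : ∀ B t → t - - B ≡ B - (- + 1 - t + + 1)
        e₄ = solve-∀
        low : - + k ≤ t × t < + 0 → t + + 1 ≤ A × - B ≤ t
        low (p , q) = lin (+-mono-≤ (<⇒+1≤ q) (ℤ.+≤+ (ℕ.z≤n {k ℕ.+ (a ℕ.+ c)}))) (e₁ (+ k) (+ (a ℕ.+ c)) t) ,
                      lin (≤-trans p (i≤i+j t (+ (a ℕ.+ b)))) (e₂ (+ k) (+ (a ℕ.+ b)) t)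
        reflected : mirror t ∈ symm k rs → t + + 1 ≤ A × - B ≤ t
        reflected m∈ = let p , q = symm-bound m∈ in lin p (e₃ A t) , lin q (e₄ B t)
        bounds : t + + 1 ≤ A × - B ≤ t
        bounds with ∈-symm⁻ rs t∈
        ... | inj₁ p = low (All.lookup (block-bounds k) p)
        ... | inj₂ (inj₁ p) = reflected (∈-symm-left (subst (_∈ rs) (sym (mirror-mirror t)) p))
        ... | inj₂ (inj₂ p) = reflected (∈-symm-right p)

-- The bijection between symmetric tilings and symmetric families of walks

module Correspondence (k a b c : ℕ) where
  open import Data.Fin using (Fin; zero; suc)
  open import Data.Integer using (_+_; _-_; _*_; -_; _^_; _<_; _≤_)
  open WalkColourings k a b c
  open Weights using (pre; suc′)
  open TupleSums using (lin; <⇒+1≤; +1≤⇒<; Strict)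
  open Evaluation using (mirror)
  open Configurations
  open Totals
  open Lists
  open WalkLists
  open Geometry k a b c
  open Colourings k a b c
  open Walks A x using (top)

  two : Fin 3
  two = suc (suc zero)

  dir≢two : ∀ {β} → dir β ≢ two
  dir≢two {false} ()
  dir≢two {true} ()

  strict-ext : ∀ {S T} → Strict S → Strict T → (∀ {t} → t ∈ S → t ∈ T) → (∀ {t} → t ∈ T → t ∈ S) → S ≡ T
  strict-ext {[]} {[]} _ _ _ _ = refl
  strict-ext {[]} {t ∷ T} _ _ _ g with () ← g (here refl)
  strict-ext {s ∷ S} {[]} _ _ f _ with () ← f (here refl)
  strict-ext {s ∷ S} {t ∷ T} ss st f g = cong₂ _∷_ s≡t
    (strict-ext (strict-tail ss) (strict-tail st) (λ p → drop (strict-head ss) p s≡t (f (there p)))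
      (λ p → drop (strict-head st) p (sym s≡t) (g (there p))))
    where
    drop : ∀ {u v w} {L L′ : List ℤ} → All (_< u) L → w ∈ L → u ≡ v → w ∈ v ∷ L′ → w ∈ L′
    drop lt w∈ refl (here refl) = ⊥-elim (<-irrefl refl (All.lookup lt w∈))
    drop lt w∈ refl (there p) = p
    s≡t : s ≡ t
    s≡t with f (here refl) | g (here refl)
    ... | here e | _ = e
    ... | there _ | here e = sym e
    ... | there p | there q = ⊥-elim (<-asym (All.lookup (strict-head st) p) (All.lookup (strict-head ss) q))

  ∈-desc⁺ : ∀ s m {t} → Between s m t → t ∈ desc s m
  ∈-desc⁺ s zero (p , q) = ⊥-elim (<-irrefl refl (≤-<-trans p (<-≤-trans q (≤-reflexive (+-identityʳ s)))))
  ∈-desc⁺ s (suc m) {t} (p , q) with t ≟ s + + m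
  ... | yes e = here e
  ... | no t≢ = there (∈-desc⁺ s m (p , ≤∧≢⇒< (<suc⇒≤ {s} {m} {t} q) t≢))

  edge-top : ∀ {p} → Edge n p → p ∈ top
  edge-top {p} (h₁ , _ , _ , h₄ , _) = ∈-desc⁺ (- A) x (h₁ , +1≤⇒< (lin h₄ (trans (r (- A + + x) p (+ n)) (cong (_- (p + + n + + 1)) -A+x+n))))
    where
    r : ∀ X p n → X - (p + + 1) ≡ X + n - (p + n + + 1)
    r = solve-∀

  top-edge : ∀ {p} → p ∈ top → Edge n p
  top-edge {p} p∈ with All.lookup (desc-between (- A) x) p∈
  ... | l , h = l ,
    lin (+-mono-≤ (<⇒+1≤ h) (ℤ.+≤+ (ℕ.z≤n {c ℕ.+ c ℕ.+ k}))) (r₁ (+ k) (+ a) (+ c) p) ,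
    lin (+-mono-≤ l (ℤ.+≤+ (ℕ.z≤n {b ℕ.+ b ℕ.+ k}))) (r₂ (+ k) (+ a) (+ b) (+ c) p) ,
    lin (<⇒+1≤ h) (trans (cong (_- (p + + n + + 1)) (sym -A+x+n)) (r₃ (- A + + x) p (+ n))) ,
    λ 0≤p → lin (+-mono-≤ 0≤p (ℤ.+≤+ (ℕ.z≤n {b ℕ.+ c}))) (r₄ (+ k) (+ (b ℕ.+ c)) p)
    where
    r₁ : ∀ k a c p → k + (a + c) - (p + + 1) ≡ - (k + (a + c)) + (k + (a + a)) + (c + c + k) - (p + + 1 + + 0)
    r₁ = solve-∀
    r₂ : ∀ k a b c p → p + (k + (b + c)) - - (k + (a + b)) ≡ p + (b + b + k) - (- (k + (a + c)) + + 0)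
    r₂ = solve-∀
    r₃ : ∀ X p n → X + n - (p + n + + 1) ≡ X - (p + + 1)
    r₃ = solve-∀
    r₄ : ∀ k bc p → p + (k + bc) - k ≡ p + bc - (+ 0 + + 0)
    r₄ = solve-∀

  -- The side conditions on the axis are invariant under p ↦ -1 - p. Only the lobe condition can
  -- fail for the mirror image, and it fails exactly when p lies above the left lobe.
  inner-or-mirror : ∀ {p} → Edge 0 p → ¬ (- + k ≤ p × p < + 0) → Edge 0 (mirror p)
  inner-or-mirror {p} (h₁ , h₂ , h₃ , h₄ , _) out =
    lin h₂ (r₁ A p) , lin h₁ (r₂ A p) , lin h₄ (r₃ B p) , lin h₃ (r₄ B p) , off
    where
    r₁ : ∀ A p → - + 1 - p - - A ≡ A - (p + + 1)
    r₁ = solve-∀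
    r₂ : ∀ A p → A - (- + 1 - p + + 1) ≡ p - - A
    r₂ = solve-∀
    r₃ : ∀ B p → - + 1 - p + + 0 - - B ≡ B - (p + + 0 + + 1)
    r₃ = solve-∀
    r₄ : ∀ B p → B - (- + 1 - p + + 0 + + 1) ≡ p + + 0 - - B
    r₄ = solve-∀
    r₅ : ∀ k p → p - - k ≡ k - (- + 1 - p + + 0 + + 1)
    r₅ = solve-∀
    r₆ : ∀ p → + 0 - (p + + 1) ≡ - + 1 - p - + 0
    r₆ = solve-∀
    off : + 0 ≤ mirror p → + k ≤ mirror p + + 0
    off 0≤m with + k ≤? mirror p + + 0
    ... | yes q = q
    ... | no ¬q = ⊥-elim (out (lin (≰⇒+1≤ ¬q) (r₅ (+ k) p) , +1≤⇒< (lin 0≤m (r₆ p))))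

  module FromWalk {rs Rs} (nonneg : All (+ 0 ≤_) rs) (w : Walk A x n (symm k rs) Rs) where

    private
      f : Cell → Fin 3
      f = colourOf Rs

      start-strict : 0 ℕ.< n → Strict (symm k rs)
      start-strict 0<n = subst Strict (row-first w 0<n) (row-strict w 0 0<n)

      edges : ∀ q → q ℕ.< n → (∀ {t} → t ∈ bots (rowAt Rs q) → Edge q t) × (∀ {t} → t ∈ tops (rowAt Rs q) → Edge (suc q) t)
      edges q q<n = walk-edges refl w (symm-edge nonneg (start-strict (ℕₚ.≤-<-trans ℕ.z≤n q<n)) w) q q<n

      goodAt : ∀ δ e e′ → f e ≡ δ → ι δ e ≡ e′ → e′ ∈ upCells → f e′ ≡ δ → ι (f e) e ∈ upCells × f (ι (f e) e) ≡ f e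
      goodAt δ e e′ fe refl e′∈ fe′ = subst (λ γ → ι γ e ∈ upCells × f (ι γ e) ≡ γ) (sym fe) (e′∈ , fe′)

    bots-edge : ∀ q → q ℕ.< n → ∀ {t} → t ∈ bots (rowAt Rs q) → Edge q t
    bots-edge q q<n = proj₁ (edges q q<n)

    -- A step is seen from its starting segment and from its end segment with the same colour, and
    -- an unoccupied segment gets direction 2 from both of its triangles. On the axis, this needs
    -- the mirror symmetry of the starting positions.
    walk-good : Good f
    walk-good {e} e∈ with cell-cases e
    ... | inj₁ (q , p , refl) = case-U q (upU⁻ q p (∈-up⁻ e∈)) (look-cases p (rowAt Rs q))
      where
      case-U : ∀ q → Edge q p × q ℕ.< n → (∃ λ β → (p , β) ∈ rowAt Rs q × look p (rowAt Rs q) ≡ dir β) ⊎ (p ∉ bots (rowAt Rs q) × look p (rowAt Rs q) ≡ two) →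
        ι (f (U q p)) (U q p) ∈ upCells × f (ι (f (U q p)) (U q p)) ≡ f (U q p)
      case-U q (_ , q<n) (inj₁ (false , m , l)) = goodAt zero (U q p) (D (suc q) p) (trans (colourOf-U Rs q p) l) (ι-0-U q p)
        (∈-up⁺ (upD⁺ q p (proj₂ (edges q q<n) (∈-map⁺ target m)) q<n))
        (trans (colourOf-D Rs q p) (look-∈ (shift (rowAt Rs q)) (subst Strict (sym (bots-shift (rowAt Rs q))) (row-tops-strict w q q<n)) (∈-map⁺ _ m)))
      case-U q (_ , q<n) (inj₁ (true , m , l)) = goodAt (suc zero) (U q p) (D (suc q) (pre p)) (trans (colourOf-U Rs q p) l) (ι-1-U q p)
        (∈-up⁺ (upD⁺ q (pre p) (proj₂ (edges q q<n) (∈-map⁺ target m)) q<n))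
        (trans (colourOf-D Rs q (pre p)) (look-∈ (shift (rowAt Rs q)) (subst Strict (sym (bots-shift (rowAt Rs q))) (row-tops-strict w q q<n)) (∈-map⁺ _ m)))
      case-U zero (edge , q<n) (inj₂ (p∉ , l)) = goodAt two (U 0 p) (U 0 (mirror p)) (trans (colourOf-U Rs 0 p) l) (ι-2-U₀ p)
        (∈-up⁺ (upU⁺ 0 (mirror p) (inner-or-mirror edge out) q<n))
        (trans (colourOf-U Rs 0 (mirror p)) (look-∉ (rowAt Rs 0) m∉))
        where
        p∉T : p ∉ symm k rs
        p∉T = subst (p ∉_) (row-first w q<n) p∉
        out : ¬ (- + k ≤ p × p < + 0)
        out (u , v) = p∉T (∈-symm-block rs (∈-block⁺ k u v))
        out′ : ¬ (- + k ≤ mirror p × mirror p < + 0)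
        out′ (u , v) = clash (proj₂ (proj₂ (proj₂ (proj₂ edge))) (lin (<⇒+1≤ v) (r₁ p))) (lin u (r₂ (+ k) p))
          where
          r₁ : ∀ p → p - + 0 ≡ + 0 - (- + 1 - p + + 1)
          r₁ = solve-∀
          r₂ : ∀ k p → k - (p + + 0 + + 1) ≡ - + 1 - p - - k
          r₂ = solve-∀
        m∉ : mirror p ∉ bots (rowAt Rs 0)
        m∉ m∈ = p∉T (subst (_∈ symm k rs) (mirror-mirror p) (mirror-∈ nonneg (start-strict q<n) out′ (subst (mirror p ∈_) (row-first w q<n) m∈)))
      case-U (suc q) (edge , q<n) (inj₂ (p∉ , l)) = goodAt two (U (suc q) p) (D (suc q) p) (trans (colourOf-U Rs (suc q) p) l) (ι-2-U q p)
        (∈-up⁺ (upD⁺ q p edge (ℕₚ.<⇒≤ q<n)))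
        (trans (colourOf-D Rs q p) (look-∉ (shift (rowAt Rs q)) (subst (p ∉_) (sym (trans (bots-shift (rowAt Rs q)) (row-next w q q<n))) p∉)))
    ... | inj₂ (q , p , refl) = case-D (upD⁻ q p (∈-up⁻ e∈)) (look-cases p (shift (rowAt Rs q)))
      where
      case-D : Edge (suc q) p × suc q ℕ.≤ n →
        (∃ λ β → (p , β) ∈ shift (rowAt Rs q) × look p (shift (rowAt Rs q)) ≡ dir β) ⊎ (p ∉ bots (shift (rowAt Rs q)) × look p (shift (rowAt Rs q)) ≡ two) →
        ι (f (D (suc q) p)) (D (suc q) p) ∈ upCells × f (ι (f (D (suc q) p)) (D (suc q) p)) ≡ f (D (suc q) p)
      case-D (_ , q<n) (inj₁ (β , m , l)) with ∈-map⁻ _ m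
      ... | (_ , false) , m′ , refl = goodAt zero (D (suc q) p) (U q p) (trans (colourOf-D Rs q p) l) (ι-0-D q p)
        (∈-up⁺ (upU⁺ q p (proj₁ (edges q q<n) (∈-map⁺ proj₁ m′)) q<n))
        (trans (colourOf-U Rs q p) (look-∈ (rowAt Rs q) (row-strict w q q<n) m′))
      ... | (p′ , true) , m′ , refl = goodAt (suc zero) (D (suc q) p) (U q p′) (trans (colourOf-D Rs q p) l) (trans (ι-1-D q p) (cong (U q) (r p′)))
        (∈-up⁺ (upU⁺ q p′ (proj₁ (edges q q<n) (∈-map⁺ proj₁ m′)) q<n))
        (trans (colourOf-U Rs q p′) (look-∈ (rowAt Rs q) (row-strict w q q<n) m′))
        where
        r : ∀ p → p - + 1 + + 1 ≡ p
        r = solve-∀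
      case-D (edge , q<n) (inj₂ (p∉ , l)) with ℕₚ.m≤n⇒m<n∨m≡n q<n
      ... | inj₁ sq<n = goodAt two (D (suc q) p) (U (suc q) p) (trans (colourOf-D Rs q p) l) (ι-2-D q p)
        (∈-up⁺ (upU⁺ (suc q) p edge sq<n))
        (trans (colourOf-U Rs (suc q) p) (look-∉ (rowAt Rs (suc q)) (subst (p ∉_) (trans (bots-shift (rowAt Rs q)) (row-next w q sq<n)) p∉)))
      -- At height n every segment of the top side is the end of a walk, so direction 2 cannot occur
      -- there.
      ... | inj₂ sq≡n = ⊥-elim (p∉ (subst (p ∈_) (sym (trans (bots-shift (rowAt Rs q)) (row-last w q sq≡n))) (edge-top (subst (λ h → Edge h p) sq≡n edge))))

  row-ext : ∀ {R R′} → bots R ≡ bots R′ → Strict (bots R) → (∀ {p} → p ∈ bots R → look p R ≡ look p R′) → R ≡ R′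
  row-ext {[]} {[]} _ _ _ = refl
  row-ext {(u , β) ∷ R} {(u′ , β′) ∷ R′} e s l with ∷-injective e
  ... | refl , e′ = cong₂ _∷_ (cong (u ,_) (dir-injective (trans (sym (hit β R)) (trans (l (here refl)) (hit β′ R′)))))
    (row-ext e′ (strict-tail s) λ p∈ → trans (sym (miss β R (u≢ p∈))) (trans (l (there p∈)) (miss β′ R′ (u≢ p∈))))
    where
    dir-injective : ∀ {β β′} → dir β ≡ dir β′ → β ≡ β′
    dir-injective {false} {false} _ = refl
    dir-injective {true} {true} _ = refl
    hit : ∀ β R → look u ((u , β) ∷ R) ≡ dir β
    hit β R with u ≟ u
    ... | yes _ = refl
    ... | no ¬e = ⊥-elim (¬e refl)
    u≢ : ∀ {p} → p ∈ bots R → p ≢ u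
    u≢ p∈ refl = <-irrefl refl (All.lookup (strict-head s) p∈)
    miss : ∀ β R {p} → p ≢ u → look p ((u , β) ∷ R) ≡ look p R
    miss β R {p} p≢u with p ≟ u
    ... | yes e = ⊥-elim (p≢u e)
    ... | no _ = refl

  rows-unique : ∀ {m T T′ Rs Rs′} → Walk A x m T Rs → Walk A x m T′ Rs′ → T ≡ T′ →
    (∀ q → q ℕ.< m → ∀ {p} → p ∈ bots (rowAt Rs q) → look p (rowAt Rs q) ≡ look p (rowAt Rs′ q)) → Rs ≡ Rs′
  rows-unique (done _) (done _) _ _ = refl
  rows-unique (step R s w) (step R′ s′ w′) e l with row-ext e s (l 0 (ℕ.s≤s ℕ.z≤n))
  ... | refl = cong (R ∷_) (rows-unique w w′ refl λ q q<m → l (suc q) (ℕ.s≤s q<m))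

  symm-injective : ∀ rs rs′ → length rs ≡ length rs′ → symm k rs ≡ symm k rs′ → rs ≡ rs′
  symm-injective [] [] _ _ = refl
  symm-injective (r ∷ rs) (r′ ∷ rs′) len e =
    cong₂ _∷_ (proj₁ (∷-injective e)) (symm-injective rs rs′ (ℕₚ.suc-injective len) (proj₁ (∷ʳ-injective (symm k rs) (symm k rs′) (proj₂ (∷-injective e)))))

  walk-injective : ∀ {rs rs′ Rs Rs′} → All (+ 0 ≤_) rs → All (+ 0 ≤_) rs′ → length rs ≡ length rs′ →
    Walk A x n (symm k rs) Rs → Walk A x n (symm k rs′) Rs′ → (∀ {e} → e ∈ upCells → colourOf Rs e ≡ colourOf Rs′ e) → rs ≡ rs′ × Rs ≡ Rs′
  walk-injective {rs} {rs′} {Rs} {Rs′} nn nn′ len w w′ same =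
    symm-injective rs rs′ len T≡ , rows-unique w w′ T≡ look≡
    where
    look≡ : ∀ q → q ℕ.< n → ∀ {p} → p ∈ bots (rowAt Rs q) → look p (rowAt Rs q) ≡ look p (rowAt Rs′ q)
    look≡ q q<n {p} p∈ = trans (sym (colourOf-U Rs q p)) (trans (same {U q p} (∈-up⁺ {U q p} (upU⁺ q p (FromWalk.bots-edge {rs} nn w q q<n p∈) q<n))) (colourOf-U Rs′ q p))
    sub : ∀ {rs rs′ Rs Rs′} → All (+ 0 ≤_) rs → Walk A x n (symm k rs) Rs → Walk A x n (symm k rs′) Rs′ →
      (∀ {e} → e ∈ upCells → colourOf Rs e ≡ colourOf Rs′ e) → 0 ℕ.< n → ∀ {p} → p ∈ symm k rs → p ∈ symm k rs′
    sub {rs} {rs′} {Rs} {Rs′} nn w w′ same 0<n {p} p∈ with look-cases p (rowAt Rs′ 0)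
    ... | inj₁ (_ , m , _) = subst (p ∈_) (row-first w′ 0<n) (∈-map⁺ proj₁ m)
    ... | inj₂ (_ , l) with ∈-map⁻ proj₁ (subst (p ∈_) (sym (row-first w 0<n)) p∈)
    ... | (_ , β) , m , refl = ⊥-elim (dir≢two (trans (sym (look-∈ (rowAt Rs 0) (row-strict w 0 0<n) m))
      (trans (sym (colourOf-U Rs 0 p)) (trans (same {U 0 p} (∈-up⁺ {U 0 p} (upU⁺ 0 p (FromWalk.bots-edge {rs} nn w 0 0<n (∈-map⁺ proj₁ m)) 0<n))) (trans (colourOf-U Rs′ 0 p) l)))))
    first : ∀ {m T Rs} → Walk A x m T Rs → m ≡ 0 → T ≡ top
    first (done e) _ = e
    T≡ : symm k rs ≡ symm k rs′
    T≡ with n ℕ.≟ 0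
    -- For n = 0 there are no cells in the upper half to read colours from, but both starting
    -- configurations are `top`.
    ... | yes n≡0 = trans (first w n≡0) (sym (first w′ n≡0))
    ... | no n≢0 = strict-ext (subst Strict (row-first w 0<n) (row-strict w 0 0<n)) (subst Strict (row-first w′ 0<n) (row-strict w′ 0 0<n))
      (sub {rs} {rs′} nn w w′ same 0<n) (sub {rs′} {rs} nn′ w′ w (λ {e} e∈ → sym (same {e} e∈)) 0<n)
      where
      0<n : 0 ℕ.< n
      0<n = ℕₚ.n≢0⇒n>0 n≢0

  walk-length : ∀ {m T Rs} → Walk A x m T Rs → length T ≡ x
  walk-length (done refl) = length-desc (- A) x
  walk-length (step R _ w) = trans (length-map proj₁ R) (trans (sym (length-map target R)) (walk-length w))

  module ToWalk (f : Cell → Fin 3) (good : Good f) (outside : ∀ e → ¬ (e ∈ upCells) → f e ≡ zero) where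

    Occ : ℕ → ℤ → Set
    Occ q p = Edge q p × f (U q p) ≢ two

    occ? : ∀ q p → Dec (Occ q p)
    occ? q p = edge? q p ×-dec ¬? (f (U q p) Fin.≟ two)

    A⁺ : ℕ
    A⁺ = k ℕ.+ (a ℕ.+ c)

    T : ℕ → List ℤ
    T q = filter (occ? q) (desc (- A) (A⁺ ℕ.+ A⁺))

    T-strict : ∀ q → Strict (T q)
    T-strict q = Linkedₚ.filter⁺ (occ? q) (λ p q → <-trans q p) (desc-strict (- A) (A⁺ ℕ.+ A⁺))

    ∈-T⁻ : ∀ q {p} → p ∈ T q → Occ q p
    ∈-T⁻ q p∈ = proj₂ (∈-filter⁻ (occ? q) {xs = desc (- A) (A⁺ ℕ.+ A⁺)} p∈)

    ∈-T⁺ : ∀ q {p} → Occ q p → p ∈ T q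
    ∈-T⁺ q {p} o@((h₁ , h₂ , _) , _) = ∈-filter⁺ (occ? q) (∈-desc⁺ (- A) (A⁺ ℕ.+ A⁺) (h₁ , +1≤⇒< (lin h₂ (r A p)))) o
      where
      r : ∀ A p → - A + (A + A) - (p + + 1) ≡ A - (p + + 1)
      r = solve-∀

    coloured-in : ∀ e {δ} → δ ≢ zero → f e ≡ δ → e ∈ upCells
    coloured-in e δ≢0 fe with inRegionUp e in eq
    ... | true = ∈-up⁺ eq
    ... | false = ⊥-elim (δ≢0 (trans (sym fe) (outside e λ p → case trans (sym eq) (∈-up⁻ p) of λ ())))

    next : ∀ {δ e} e′ → e ∈ upCells → f e ≡ δ → ι δ e ≡ e′ → e′ ∈ upCells × f e′ ≡ δ
    next {e = e} _ e∈ refl refl = good e∈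

    U∈ : ∀ {q p} → Edge q p → q ℕ.< n → U q p ∈ upCells
    U∈ {q} {p} e q<n = ∈-up⁺ (upU⁺ q p e q<n)

    two-below : ∀ q p → f (U (suc q) p) ≡ two → f (D (suc q) p) ≡ two
    two-below q p e = proj₂ (next (D (suc q) p) (coloured-in (U (suc q) p) (λ ()) e) e (ι-2-U q p))

    isOne : Fin 3 → Bool
    isOne (suc zero) = true
    isOne _ = false

    dir-isOne : ∀ δ → δ ≢ two → dir (isOne δ) ≡ δ
    dir-isOne zero _ = refl
    dir-isOne (suc zero) _ = refl
    dir-isOne (suc (suc zero)) ≢2 = ⊥-elim (≢2 refl)

    stepAt : ℕ → ℤ → ℤ × Bool
    stepAt q p = p , isOne (f (U q p))

    R : ℕ → Row
    R q = map (stepAt q) (T q)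

    bots-R : ∀ q → bots (R q) ≡ T q
    bots-R q = trans (sym (map-∘ (T q))) (go (T q))
      where
      go : ∀ ts → map (λ p → proj₁ (stepAt q p)) ts ≡ ts
      go [] = refl
      go (t ∷ ts) = cong (t ∷_) (go ts)

    module _ {q} (q<n : q ℕ.< n) where

      down-occ : ∀ {p δ} → δ ≢ two → D (suc q) p ∈ upCells → f (D (suc q) p) ≡ δ → Occ (suc q) p
      down-occ {p} δ≢ d∈ e = proj₁ (upD⁻ q p (∈-up⁻ d∈)) , λ u → δ≢ (trans (sym e) (two-below q p u))

      zero-up : ∀ {p} → Edge q p → f (U q p) ≡ zero → D (suc q) p ∈ upCells × f (D (suc q) p) ≡ zero
      zero-up {p} e fe = next (D (suc q) p) (U∈ e q<n) fe (ι-0-U q p)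

      one-up : ∀ {p} → Edge q p → f (U q p) ≡ suc zero → D (suc q) (pre p) ∈ upCells × f (D (suc q) (pre p)) ≡ suc zero
      one-up {p} e fe = next (D (suc q) (pre p)) (U∈ e q<n) fe (ι-1-U q p)

      target-occ : ∀ {p} → Occ q p → Occ (suc q) (target (stepAt q p))
      target-occ {p} (e , ≢2) with f (U q p) in fe
      ... | zero = let d∈ , fd = zero-up e fe in down-occ (λ ()) d∈ fd
      ... | suc zero = let d∈ , fd = one-up e fe in down-occ (λ ()) d∈ fd
      ... | suc (suc zero) = ⊥-elim (≢2 refl)

      pre-suc′ : ∀ p → pre (suc′ p) ≡ p
      pre-suc′ p = r p
        where
        r : ∀ p → p + + 1 - + 1 ≡ p
        r = solve-∀

      source-occ : ∀ {t} → Occ (suc q) t → ∃ λ p → Occ q p × t ≡ target (stepAt q p)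
      source-occ {t} (e , ≢2) with f (D (suc q) t) in fd
      ... | zero = let u∈ , fu = next (U q t) d∈ fd (ι-0-D q t)
                   in t , (proj₁ (upU⁻ q t (∈-up⁻ u∈)) , λ h → case trans (sym fu) h of λ ()) , cong (λ δ → target (t , isOne δ)) (sym fu)
        where
        d∈ : D (suc q) t ∈ upCells
        d∈ = ∈-up⁺ (upD⁺ q t e q<n)
      ... | suc zero = let u∈ , fu = next (U q (suc′ t)) d∈ fd (ι-1-D q t)
                       in suc′ t , (proj₁ (upU⁻ q (suc′ t) (∈-up⁻ u∈)) , λ h → case trans (sym fu) h of λ ()) ,
                          trans (sym (pre-suc′ t)) (cong (λ δ → target (suc′ t , isOne δ)) (sym fu))
        where
        d∈ : D (suc q) t ∈ upCells
        d∈ = ∈-up⁺ (upD⁺ q t e q<n)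
      ... | suc (suc zero) = ⊥-elim (≢2 (proj₂ (next (U (suc q) t) (∈-up⁺ (upD⁺ q t e q<n)) fd (ι-2-D q t))))

      -- Two steps can meet only if the left one has direction 0 and the right one, starting next to
      -- it, has direction 1. Both would then colour the same cell `D (suc q) p′`, with different
      -- colours.
      target-< : ∀ {p p′} → Occ q p → Occ q p′ → p′ < p → target (stepAt q p′) < target (stepAt q p)
      target-< {p} {p′} (e , ≢2) (e′ , ≢2′) lt with f (U q p) in fe | f (U q p′) in fe′
      ... | suc (suc zero) | _ = ⊥-elim (≢2 refl)
      ... | _ | suc (suc zero) = ⊥-elim (≢2′ refl)
      ... | zero | zero = lt
      ... | zero | suc zero = ≤-<-trans (target-≤ (p′ , true)) lt
      ... | suc zero | suc zero = +1≤⇒< (lin (<⇒+1≤ lt) (r p p′))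
        where
        r : ∀ p p′ → p - + 1 - (p′ - + 1 + + 1) ≡ p - (p′ + + 1)
        r = solve-∀
      ... | suc zero | zero = ≤∧≢⇒< (lin (<⇒+1≤ lt) (r p p′))
        λ { refl → case trans (sym (proj₂ (zero-up e′ fe′))) (proj₂ (one-up e fe)) of λ () }
        where
        r : ∀ p p′ → p - + 1 - p′ ≡ p - (p′ + + 1)
        r = solve-∀

      -- The involutions are invertible: each occupied segment of the next level is the end of a
      -- step, and each step ends in an occupied segment. `target-<` makes the list of ends strict,
      -- so equality of sets suffices.
      tops-R : tops (R q) ≡ T (suc q)
      tops-R = strict-ext (subst Strict (map-∘ (T q)) (mapped (T q) (∈-T⁻ q) (T-strict q))) (T-strict (suc q)) to from
        where
        mapped : ∀ ts → (∀ {p} → p ∈ ts → Occ q p) → Strict ts → Strict (map (λ p → target (stepAt q p)) ts)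
        mapped [] _ _ = []
        mapped (t ∷ []) _ _ = [-]
        mapped (t ∷ u ∷ ts) o (lt ∷ s) = target-< (o (here refl)) (o (there (here refl))) lt ∷ mapped (u ∷ ts) (λ p → o (there p)) s
        to : ∀ {t} → t ∈ tops (R q) → t ∈ T (suc q)
        to t∈ with ∈-map⁻ target t∈
        ... | e , e∈ , refl with ∈-map⁻ (stepAt q) e∈
        ... | p , p∈ , refl = ∈-T⁺ (suc q) (target-occ (∈-T⁻ q p∈))
        from : ∀ {t} → t ∈ T (suc q) → t ∈ tops (R q)
        from t∈ with source-occ (∈-T⁻ (suc q) t∈)
        ... | p , o , refl = ∈-map⁺ target (∈-map⁺ (stepAt q) (∈-T⁺ q o))

    -- The cells above the top side are outside the region, so their colour is `zero` and every
    -- segment of the top side counts as occupied.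
    T-top : T n ≡ top
    T-top = strict-ext (T-strict n) (desc-strict (- A) x) (λ p∈ → edge-top (proj₁ (∈-T⁻ n p∈)))
      λ {p} p∈ → ∈-T⁺ n (top-edge p∈ , λ e → ℕₚ.<-irrefl refl (proj₂ (upU⁻ n p (∈-up⁻ (coloured-in (U n p) (λ ()) e)))))

    rowsFrom : ℕ → ℕ → List Row
    rowsFrom zero q = []
    rowsFrom (suc m) q = R q ∷ rowsFrom m (suc q)

    walkFrom : ∀ m q → q ℕ.+ m ≡ n → Walk A x m (T q) (rowsFrom m q)
    walkFrom zero q e = done (trans (cong T (trans (sym (ℕₚ.+-identityʳ q)) e)) T-top)
    walkFrom (suc m) q e = subst (λ S → Walk A x (suc m) S (rowsFrom (suc m) q)) (bots-R q)
      (step (R q) (subst Strict (sym (bots-R q)) (T-strict q))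
        (subst (λ S → Walk A x m S (rowsFrom m (suc q))) (sym (tops-R q<n)) (walkFrom m (suc q) (trans (sym (ℕₚ.+-suc q m)) e))))
      where
      q<n : q ℕ.< n
      q<n = subst (q ℕ.<_) e (ℕₚ.m<m+n q (ℕ.s≤s ℕ.z≤n))

    rowAt-rowsFrom : ∀ m q i → i ℕ.< m → rowAt (rowsFrom m q) i ≡ R (q ℕ.+ i)
    rowAt-rowsFrom (suc m) q zero _ = cong R (sym (ℕₚ.+-identityʳ q))
    rowAt-rowsFrom (suc m) q (suc i) (ℕ.s≤s i<m) = trans (rowAt-rowsFrom m (suc q) i i<m) (cong R (sym (ℕₚ.+-suc q i)))

    rs : List ℤ
    rs = filter (+ 0 ≤?_) (T 0)

    ∈-rs⁻ : ∀ {r} → r ∈ rs → r ∈ T 0 × + 0 ≤ r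
    ∈-rs⁻ = ∈-filter⁻ (+ 0 ≤?_) {xs = T 0}

    rs-outer : All (+ k ≤_) rs
    rs-outer = All.tabulate λ {r} r∈ → let r∈T , 0≤r = ∈-rs⁻ r∈ in
      subst (+ k ≤_) (+-identityʳ r) (proj₂ (proj₂ (proj₂ (proj₂ (proj₁ (∈-T⁻ 0 r∈T))))) 0≤r)

    mirror-two : ∀ p → f (U 0 p) ≡ two → U 0 (mirror p) ∈ upCells × f (U 0 (mirror p)) ≡ two
    mirror-two p e = next (U 0 (mirror p)) (coloured-in (U 0 p) (λ ()) e) e (ι-2-U₀ p)

    occ-mirror : ∀ {p} → Occ 0 p → ¬ (- + k ≤ p × p < + 0) → Occ 0 (mirror p)
    occ-mirror {p} (e , ≢2) out = inner-or-mirror e out ,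
      λ h → ≢2 (trans (cong (λ w → f (U 0 w)) (sym (mirror-mirror p))) (proj₂ (mirror-two (mirror p) h)))

    -- Direction 2 above the left lobe would put the cell at -1 - p into the tiling, but that cell
    -- belongs to the removed right lobe.
    block-occ : ∀ {p} → - + k ≤ p → p < + 0 → Occ 0 p
    block-occ {p} l h = edge , λ e → clash (subst (+ k ≤_) (+-identityʳ (mirror p)) (proj₂ (proj₂ (proj₂ (proj₂ (proj₁ (upU⁻ 0 (mirror p) (∈-up⁻ (proj₁ (mirror-two p e)))))))) (lin (<⇒+1≤ h) (r₁ p)))) (lin l (r₂ (+ k) p))
      where
      r₁ : ∀ p → - + 1 - p - + 0 ≡ + 0 - (p + + 1)
      r₁ = solve-∀
      r₂ : ∀ k p → k - (- + 1 - p + + 1) ≡ p - - k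
      r₂ = solve-∀
      r₃ : ∀ k w p → p - - (k + w) ≡ p + w - (- k + + 0)
      r₃ = solve-∀
      r₄ : ∀ k w p → k + w - (p + + 1) ≡ + 0 + (k + w) - (p + + 1 + + 0)
      r₄ = solve-∀
      r₅ : ∀ k w p → p + + 0 - - (k + w) ≡ p + w - (- k + + 0)
      r₅ = solve-∀
      r₆ : ∀ k w p → k + w - (p + + 0 + + 1) ≡ + 0 + (k + w) - (p + + 1 + + 0)
      r₆ = solve-∀
      edge : Edge 0 p
      edge = lin (+-mono-≤ l (ℤ.+≤+ (ℕ.z≤n {a ℕ.+ c}))) (r₃ (+ k) (+ (a ℕ.+ c)) p) ,
        lin (+-mono-≤ (<⇒+1≤ h) (ℤ.+≤+ (ℕ.z≤n {k ℕ.+ (a ℕ.+ c)}))) (r₄ (+ k) (+ (a ℕ.+ c)) p) ,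
        lin (+-mono-≤ l (ℤ.+≤+ (ℕ.z≤n {a ℕ.+ b}))) (r₅ (+ k) (+ (a ℕ.+ b)) p) ,
        lin (+-mono-≤ (<⇒+1≤ h) (ℤ.+≤+ (ℕ.z≤n {k ℕ.+ (a ℕ.+ b)}))) (r₆ (+ k) (+ (a ℕ.+ b)) p) ,
        λ 0≤p → ⊥-elim (<-irrefl refl (≤-<-trans 0≤p h))

    T-symm : T 0 ≡ symm k rs
    T-symm = strict-ext (T-strict 0) (symm-strict k rs rs-outer (Linkedₚ.filter⁺ (+ 0 ≤?_) (λ p q → <-trans q p) (T-strict 0))) to from
      where
      nonneg-out : ∀ {p} → + 0 ≤ p → ¬ (- + k ≤ p × p < + 0)
      nonneg-out 0≤p (_ , p<0) = <-irrefl refl (≤-<-trans 0≤p p<0)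
      to : ∀ {t} → t ∈ T 0 → t ∈ symm k rs
      to {t} t∈ with + 0 ≤? t | - + k ≤? t
      ... | yes 0≤t | _ = ∈-symm-right (∈-filter⁺ (+ 0 ≤?_) t∈ 0≤t)
      ... | no 0≰t | yes l = ∈-symm-block rs (∈-block⁺ k l (≰⇒> 0≰t))
      ... | no 0≰t | no ¬l = ∈-symm-left (∈-filter⁺ (+ 0 ≤?_) (∈-T⁺ 0 (occ-mirror (∈-T⁻ 0 t∈) λ (l , _) → ¬l l)) (lin (≰⇒+1≤ 0≰t) (r t)))
        where
        r : ∀ t → - + 1 - t - + 0 ≡ + 0 - (t + + 1)
        r = solve-∀
      from : ∀ {t} → t ∈ symm k rs → t ∈ T 0
      from {t} t∈ with ∈-symm⁻ rs t∈
      ... | inj₁ p = let l , h = All.lookup (block-bounds k) p in ∈-T⁺ 0 (block-occ l h)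
      ... | inj₂ (inj₁ p) = proj₁ (∈-rs⁻ p)
      ... | inj₂ (inj₂ p) = let m∈ , 0≤m = ∈-rs⁻ p in
        subst (_∈ T 0) (mirror-mirror t) (∈-T⁺ 0 (occ-mirror (∈-T⁻ 0 m∈) (nonneg-out 0≤m)))

    Rs : List Row
    Rs = rowsFrom n 0

    walk : Walk A x n (symm k rs) Rs
    walk = subst (λ S → Walk A x n S Rs) T-symm (walkFrom n 0 refl)

    -- The walks conserve the number of occupied segments, and `top` has x = k + 2a of them, while
    -- the starting configuration has k plus twice the length of `rs`.
    length-rs : length rs ≡ a
    length-rs = trans (sym (half-double (length rs))) (trans (cong ℕ.⌊_/2⌋ (ℕₚ.+-cancelˡ-≡ k _ _ (trans (sym (length-symm k rs)) (walk-length walk)))) (half-double a))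

    rs-range : ∀ {M} → k ℕ.+ (a ℕ.+ c) ℕ.≤ M → All (InRange M) rs
    rs-range {M} A≤M = All.tabulate λ r∈ → let r∈T , 0≤r = ∈-rs⁻ r∈ in in-range 0≤r (proj₁ (proj₂ (proj₁ (∈-T⁻ 0 r∈T))))
      where
      in-range : ∀ {r} → + 0 ≤ r → r + + 1 ≤ A → InRange M r
      in-range {+ i} _ (ℤ.+≤+ p) = i , refl , ℕₚ.≤-trans (subst (ℕ._≤ k ℕ.+ (a ℕ.+ c)) (ℕₚ.+-comm i 1) p) A≤M

    colour≡ : ∀ {e} → e ∈ upCells → colourOf Rs e ≡ f e
    colour≡ {e} e∈ with cell-cases e
    ... | inj₁ (q , p , refl) = trans (colourOf-U Rs q p) (trans (cong (look p) (rowAt-rowsFrom n 0 q q<n)) at)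
      where
      edge : Edge q p
      edge = proj₁ (upU⁻ q p (∈-up⁻ e∈))
      q<n : q ℕ.< n
      q<n = proj₂ (upU⁻ q p (∈-up⁻ e∈))
      at : look p (R q) ≡ f (U q p)
      at with f (U q p) Fin.≟ two
      ... | yes e = trans (look-∉ (R q) λ p∈ → proj₂ (∈-T⁻ q (subst (p ∈_) (bots-R q) p∈)) e) (sym e)
      ... | no ≢2 = trans (look-∈ (R q) (subst Strict (sym (bots-R q)) (T-strict q)) (∈-map⁺ (stepAt q) (∈-T⁺ q (edge , ≢2)))) (dir-isOne (f (U q p)) ≢2)
    ... | inj₂ (q , p , refl) = trans (colourOf-D Rs q p) (trans (cong (λ S → look p (shift S)) (rowAt-rowsFrom n 0 q q<n)) (at (f (D (suc q) p)) refl))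
      where
      q<n : q ℕ.< n
      q<n = proj₂ (upD⁻ q p (∈-up⁻ e∈))
      strict-shift : Strict (bots (shift (R q)))
      strict-shift = subst Strict (sym (trans (bots-shift (R q)) (tops-R q<n))) (T-strict (suc q))
      at : ∀ δ → f (D (suc q) p) ≡ δ → look p (shift (R q)) ≡ f (D (suc q) p)
      at zero fd = let u∈ , fu = next (U q p) e∈ fd (ι-0-D q p) in
        trans (look-∈ (shift (R q)) strict-shift (∈-map⁺ _ (subst (λ δ → (p , isOne δ) ∈ R q) fu
          (∈-map⁺ (stepAt q) (∈-T⁺ q (proj₁ (upU⁻ q p (∈-up⁻ u∈)) , λ h → case trans (sym fu) h of λ ())))))) (sym fd)
      at (suc zero) fd = let u∈ , fu = next (U q (suc′ p)) e∈ fd (ι-1-D q p) in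
        trans (look-∈ (shift (R q)) strict-shift (subst (λ w → (w , true) ∈ shift (R q)) (pre-suc′ q<n p) (∈-map⁺ _ (subst (λ δ → (suc′ p , isOne δ) ∈ R q) fu
          (∈-map⁺ (stepAt q) (∈-T⁺ q (proj₁ (upU⁻ q (suc′ p) (∈-up⁻ u∈)) , λ h → case trans (sym fu) h of λ ()))))))) (sym fd)
      at (suc (suc zero)) fd = trans (look-∉ (shift (R q)) λ p∈ →
          proj₂ (∈-T⁻ (suc q) (subst (p ∈_) (trans (bots-shift (R q)) (tops-R q<n)) p∈)) (proj₂ (next (U (suc q) p) e∈ fd (ι-2-D q p))))
        (sym fd)

  module _ (M : ℕ) (A≤M : k ℕ.+ (a ℕ.+ c) ℕ.≤ M) where
    private
      colouring : List ℤ × List Row → List _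
      colouring (_ , Rs) = map (colourOf Rs) upCells

      nonneg : ∀ {rs} → All (InRange M) rs → All (+ 0 ≤_) rs
      nonneg = All.map λ { (_ , refl , _) → ℤ.+≤+ ℕ.z≤n }

      unpack : ∀ {rs Rs} → (rs , Rs) ∈ symmetricWalks M k a b c → length rs ≡ a × All (InRange M) rs × Walk A x n (symm k rs) Rs
      unpack p with ∈-symmetricWalks⁻ M k a b c p
      ... | rs∈ , w with ∈-tuples⁻ a M rs∈
      ... | e , r = e , r , w

      to : ∀ {w} → w ∈ symmetricWalks M k a b c → colouring w ∈ symmetricTilings
      to {rs , Rs} p with unpack p
      ... | _ , r , w = good⇒∈ (colourOf Rs) (FromWalk.walk-good {rs} {Rs} (nonneg r) w)

      from : ∀ {l} → l ∈ symmetricTilings → ∃ λ w → w ∈ symmetricWalks M k a b c × colouring w ≡ l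
      from {l} l∈ with ∈⇒good l∈
      ... | f , good , e , outside = (W.rs , W.Rs) ,
          ∈-symmetricWalks⁺ {M} {k} {a} {b} {c} (subst (λ m → W.rs ∈ tuples m M) W.length-rs (∈-tuples⁺ W.rs (W.rs-range A≤M))) W.walk ,
          trans (map-cong-∈ {f = colourOf W.Rs} {g = f} upCells (λ {e′} → W.colour≡ {e′})) e
        where module W = ToWalk f (λ {e′} → good {e′}) outside

      same : ∀ {w w′} → w ∈ symmetricWalks M k a b c → w′ ∈ symmetricWalks M k a b c → colouring w ≡ colouring w′ → w ≡ w′
      same {rs , Rs} {rs′ , Rs′} p p′ e = cong₂ _,_ (proj₁ equal) (proj₂ equal)
        where
        equal : rs ≡ rs′ × Rs ≡ Rs′
        equal = walk-injective {rs} {rs′} {Rs} {Rs′} (nonneg (proj₁ (proj₂ (unpack p)))) (nonneg (proj₁ (proj₂ (unpack p′))))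
          (trans (proj₁ (unpack p)) (sym (proj₁ (unpack p′)))) (proj₂ (proj₂ (unpack p))) (proj₂ (proj₂ (unpack p′)))
          (λ {e′} → map-≡⇒ {f = colourOf Rs} {g = colourOf Rs′} {xs = upCells} e {e′})

    tilings-walks : length symmetricTilings ≡ length (symmetricWalks M k a b c)
    tilings-walks = bijection-length colouring symmetricTilings (symmetricWalks M k a b c)
      unique-symmetricTilings (unique-symmetricWalks M k a b c) to from same

    M⊙B-walks : + M⊙B x y z k ≡ ClosedForm.tilings# M k a b c
    M⊙B-walks = trans (cong +_ (trans M⊙B≡ tilings-walks)) (length-symmetricWalks M k a b c)

-- From parities and halves to the parameters k, a, b, c

module Final where
  open import Data.Nat using (_+_; _*_; _∸_; _≤_; _%_)
  open TupleSums using (lin)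
  open Totals using (InRange)
  open ClosedForm using (tilings#)
  open Fractions using (⟦_⟧)
  open Product
  open Configurations using (symm)
  open Lists
  open WalkLists

  M⊙B-product : ∀ k a b c → ⟦ M⊙B (k + (a + a)) (k + (b + b)) (k + (c + c)) k ⟧ ≡ product-side k a b c
  M⊙B-product k a b c = tilings#-product M k a b c (M⊙B (k + (a + a)) (k + (b + b)) (k + (c + c)) k) ℕₚ.≤-refl
    (sym (Correspondence.M⊙B-walks k a b c M bound))
    where
    M : ℕ
    -- One truncation bound serves both sides: the evaluation asks for k + a + b + c < M, the
    -- bijection for A = k + a + c ≤ M.
    M = suc (k + (a + (b + c)))
    bound : k + (a + c) ≤ M
    bound = ℕₚ.m≤n⇒m≤1+n (ℕₚ.+-monoʳ-≤ k (ℕₚ.+-monoʳ-≤ a (ℕₚ.m≤n+m c b)))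

  even-or-odd : ∀ m → ∃ λ a → m ≡ a + a ⊎ m ≡ suc (a + a)
  even-or-odd zero = 0 , inj₁ refl
  even-or-odd (suc m) with even-or-odd m
  ... | a , inj₁ e = a , inj₂ (cong suc e)
  ... | a , inj₂ e = suc a , inj₁ (trans (cong suc e) (cong suc (sym (ℕₚ.+-suc a a))))

  same-parity : ∀ {m k} → m % 2 ≡ k % 2 → k ≤ m → ∃ λ a → m ≡ k + (a + a)
  same-parity {m} {k} p k≤m with ℕₚ.m≤n⇒∃[o]m+o≡n k≤m
  ... | o , refl with even-or-odd o
  ... | a , inj₁ refl = a , refl
  ... | a , inj₂ refl = ⊥-elim (suc%2 k (trans (sym (trans (cong (_% 2) (r k a)) ([m+kn]%n≡m%n (suc k) a 2))) p))
    where
    r : ∀ k a → k + suc (a + a) ≡ suc k + a * 2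
    r = ℕ-Solver.solve-∀
    suc%2 : ∀ k → suc k % 2 ≡ k % 2 → ⊥
    suc%2 zero ()
    suc%2 (suc zero) ()
    suc%2 (suc (suc k)) e = suc%2 k e

  private
    shape : ℕ → ℕ → ℕ → ℕ → ℕ → ℕ → ℚ
    shape k p q r s t = P p q k
      ℚ.* ∏ r (λ i → ratio (poch (s + i) k) (poch i k))
      ℚ.* ∏ q (λ i → ratio (poch (t + i) r) (poch (k + i) r) ℚ.* ratio (poch (t + i) p) (poch (k + i) p))

    half : ∀ {m} a → m ≡ a + a → ⌊ m /2⌋ ≡ a
    half a refl = sym (ℕₚ.n≡⌊n+n/2⌋ a)

    half-sum : ∀ k a → ⌊ k + (a + a) + k /2⌋ ≡ a + k
    half-sum k a = half (a + k) (r k a)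
      where
      r : ∀ k a → k + (a + a) + k ≡ a + k + (a + k)
      r = ℕ-Solver.solve-∀

    half-diff : ∀ k a → ⌊ k + (a + a) ∸ k /2⌋ ≡ a
    half-diff k a = half a (ℕₚ.m+n∸m≡n k (a + a))

  rhs≡ : ∀ k a b c → rhs (k + (a + a)) (k + (b + b)) (k + (c + c)) k ≡ product-side k a b c
  rhs≡ k a b c = go (half-sum k b) (half-diff k c) (half-diff k b) (half-diff k a) (half-sum k a)
    where
    go : ∀ {p p′ q q′ r r′ s s′ t t′} → p ≡ p′ → q ≡ q′ → r ≡ r′ → s ≡ s′ → t ≡ t′ → shape k p q r s t ≡ shape k p′ q′ r′ s′ t′
    go refl refl refl refl refl = refl

  main : ∀ {x y z k} → (∃ λ a → x ≡ k + (a + a)) → (∃ λ b → y ≡ k + (b + b)) → (∃ λ c → z ≡ k + (c + c)) →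
    ⟦ M⊙B x y z k ⟧ ≡ rhs x y z k
  main {k = k} (a , refl) (b , refl) (c , refl) = trans (M⊙B-product k a b c) (sym (rhs≡ k a b c))

open import Data.Nat using (_≤_; _%_)
open import Data.Rational using (_/_)

theorem4 : (x y z k : ℕ) →
    x % 2 ≡ k % 2 → y % 2 ≡ k % 2 → z % 2 ≡ k % 2 →
    k ≤ x → k ≤ y → k ≤ z →
    (+ M⊙B x y z k) / 1 ≡ rhs x y z k
theorem4 x y z k px py pz k≤x k≤y k≤z = Final.main (Final.same-parity px k≤x) (Final.same-parity py k≤y) (Final.same-parity pz k≤z)
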